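{- Let $k\geq 1$ be an integer, let $n\geq 2^{4k}$, and let $G$ be a graph of order $n$. (a) If $\mu(G)\geq \mu(S_{n,k})$, then $G$ contains a path $P_{2k+2}$ as a subgraph, unless $G=S_{n,k}$. (b) If $\mu(G)\geq \mu(S_{n,k}^{+})$, then $G$ contains a path $P_{2k+3}$ as a subgraph, unless $G=S_{n,k}^{+}$.
   Context: All graphs are finite and simple. For a graph $G$, $\mu(G)$ denotes the largest eigenvalue (spectral radius) of its adjacency matrix. $P_r$ denotes the path on $r$ vertices. For $1\leq k<n$, $S_{n,k}$ is the join of the complete graph $K_k$ and the edgeless graph $\overline{K}_{n-k}$ (every vertex of a $k$-clique is joined to every vertex of an independent set of $n-k$ vertices); $S_{n,k}^{+}$ is the graph obtained from $S_{n,k}$ by adding one edge inside the independent set of size $n-k$. Equality of graphs is up to isomorphism. One has $\mu(S_{n,k})=(k-1)/2+\sqrt{kn-(3k^2+2k-1)/4}$. -}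

module Defs where

open import Data.Nat as ℕ using (ℕ; zero; suc; _∸_; _⊔_; _≡ᵇ_)
import Data.Nat.Properties as ℕₚ
open import Data.Bool using (Bool; true; false; not; _∧_; _∨_; if_then_else_)
open import Data.Bool.Properties using (∨-comm)
open import Data.Fin using (Fin; toℕ; splitAt; _≟_)
import Data.Fin as Fin
open import Data.Rational as ℚ using (ℚ; 0ℚ; 1ℚ; ½; ∣_∣; Positive; positive)
import Data.Rational.Properties as ℚₚ
open import Data.Rational.Solver using (module +-*-Solver)
open import Data.Product using (_×_; _,_; ∃-syntax; proj₁; proj₂)
open import Data.Sum using (_⊎_; inj₁; inj₂)
open import Data.Vec.Functional using (Vector; foldr)
open import Function using (_↔_; Inverse)
open import Function.Definitions using (Injective)
open import Relation.Nullary using (¬_; does; yes; no)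
open import Relation.Nullary.Decidable using (dec-true; dec-false)
open import Relation.Binary.PropositionalEquality

Cauchy : (ℕ → ℚ) → Set
Cauchy f = ∀ ε → 0ℚ ℚ.< ε →
  ∃[ N ] (∀ m n → N ℕ.≤ m → N ℕ.≤ n → ∣ f m ℚ.- f n ∣ ℚ.< ε)

record ℝ : Set where
  constructor mkℝ
  field
    seq    : ℕ → ℚ
    cauchy : Cauchy seq

open ℝ public

infix  4 _≃_ _≤ℝ_

_≃_ : ℝ → ℝ → Set
x ≃ y = ∀ ε → 0ℚ ℚ.< ε →
  ∃[ N ] (∀ n → N ℕ.≤ n → ∣ seq x n ℚ.- seq y n ∣ ℚ.< ε)

_≤ℝ_ : ℝ → ℝ → Set
x ≤ℝ y = ∀ ε → 0ℚ ℚ.< ε →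
  ∃[ N ] (∀ n → N ℕ.≤ n → seq x n ℚ.- seq y n ℚ.< ε)

const-cauchy : ∀ q → Cauchy (λ _ → q)
const-cauchy q ε 0<ε =
  0 , λ _ _ _ _ → subst (λ r → ∣ r ∣ ℚ.< ε) (sym (ℚₚ.+-inverseʳ q)) 0<ε

fromℚ : ℚ → ℝ
fromℚ q = mkℝ (λ _ → q) (const-cauchy q)

0ℝ 1ℝ : ℝ
0ℝ = fromℚ 0ℚ
1ℝ = fromℚ 1ℚ

+-cauchy : ∀ {f g} → Cauchy f → Cauchy g → Cauchy (λ n → f n ℚ.+ g n)
+-cauchy {f} {g} cf cg ε 0<ε = N₁ ⊔ N₂ , close
  where
  δ = ½ ℚ.* ε
  0<δ : 0ℚ ℚ.< δ
  0<δ = ℚₚ.positive⁻¹ δ {{ℚₚ.pos*pos⇒pos ½ ε {{positive 0<ε}}}}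
  N₁ = proj₁ (cf δ 0<δ)
  N₂ = proj₁ (cg δ 0<δ)
  split : ∀ a b c d → (a ℚ.+ b) ℚ.- (c ℚ.+ d) ≡ (a ℚ.- c) ℚ.+ (b ℚ.- d)
  split = solve 4 (λ a b c d → (a :+ b) :- (c :+ d) := (a :- c) :+ (b :- d)) refl
    where open +-*-Solver
  halves : δ ℚ.+ δ ≡ ε
  halves = trans (sym (ℚₚ.*-distribʳ-+ ε ½ ½)) (ℚₚ.*-identityˡ ε)
  close : ∀ m n → N₁ ⊔ N₂ ℕ.≤ m → N₁ ⊔ N₂ ℕ.≤ n →
          ∣ (f m ℚ.+ g m) ℚ.- (f n ℚ.+ g n) ∣ ℚ.< ε
  close m n p q = begin-strict
    ∣ (f m ℚ.+ g m) ℚ.- (f n ℚ.+ g n) ∣   ≡⟨ cong ∣_∣ (split (f m) (g m) (f n) (g n)) ⟩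
    ∣ (f m ℚ.- f n) ℚ.+ (g m ℚ.- g n) ∣   ≤⟨ ℚₚ.∣p+q∣≤∣p∣+∣q∣ (f m ℚ.- f n) (g m ℚ.- g n) ⟩
    ∣ f m ℚ.- f n ∣ ℚ.+ ∣ g m ℚ.- g n ∣   <⟨ ℚₚ.+-mono-<
      (proj₂ (cf δ 0<δ) m n (ℕₚ.m⊔n≤o⇒m≤o N₁ N₂ p) (ℕₚ.m⊔n≤o⇒m≤o N₁ N₂ q))
      (proj₂ (cg δ 0<δ) m n (ℕₚ.m⊔n≤o⇒n≤o N₁ N₂ p) (ℕₚ.m⊔n≤o⇒n≤o N₁ N₂ q)) ⟩
    δ ℚ.+ δ                               ≡⟨ halves ⟩
    ε                                     ∎
    where open ℚₚ.≤-Reasoning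

eventually-bounded : ∀ {f} → Cauchy f →
  ∃[ B ] Positive B × ∃[ N ] (∀ n → N ℕ.≤ n → ∣ f n ∣ ℚ.≤ B)
eventually-bounded {f} cf =
  B , ℚₚ.nonNeg+pos⇒pos ∣ f N ∣ {{ℚₚ.∣-∣-nonNeg (f N)}} 1ℚ , N , bound
  where
  0<1 : 0ℚ ℚ.< 1ℚ
  0<1 = ℚₚ.positive⁻¹ 1ℚ
  N = proj₁ (cf 1ℚ 0<1)
  B = ∣ f N ∣ ℚ.+ 1ℚ
  split : ∀ a b → a ≡ b ℚ.+ (a ℚ.- b)
  split = solve 2 (λ a b → a := b :+ (a :- b)) refl
    where open +-*-Solver
  bound : ∀ n → N ℕ.≤ n → ∣ f n ∣ ℚ.≤ B
  bound n p = begin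
    ∣ f n ∣                        ≡⟨ cong ∣_∣ (split (f n) (f N)) ⟩
    ∣ f N ℚ.+ (f n ℚ.- f N) ∣      ≤⟨ ℚₚ.∣p+q∣≤∣p∣+∣q∣ (f N) (f n ℚ.- f N) ⟩
    ∣ f N ∣ ℚ.+ ∣ f n ℚ.- f N ∣    ≤⟨ ℚₚ.+-monoʳ-≤ ∣ f N ∣
      (ℚₚ.<⇒≤ (proj₂ (cf 1ℚ 0<1) n N p ℕₚ.≤-refl)) ⟩
    ∣ f N ∣ ℚ.+ 1ℚ                 ∎
    where open ℚₚ.≤-Reasoning

divide : ∀ D → Positive D → ∀ ε → 0ℚ ℚ.< ε →
  ∃[ δ ] 0ℚ ℚ.< δ × D ℚ.* δ ≡ ε
divide D D⁺ ε 0<ε = δ , 0<δ , D*δ≡ε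
  where
  instance
    D≢0 : ℚ.NonZero D
    D≢0 = ℚₚ.pos⇒nonZero D {{D⁺}}
  δ = ℚ.1/ D ℚ.* ε
  0<δ : 0ℚ ℚ.< δ
  0<δ = ℚₚ.positive⁻¹ δ
    {{ℚₚ.pos*pos⇒pos (ℚ.1/ D) {{ℚₚ.1/pos⇒pos D {{D⁺}}}} ε {{positive 0<ε}}}}
  D*δ≡ε : D ℚ.* δ ≡ ε
  D*δ≡ε = begin
    D ℚ.* (ℚ.1/ D ℚ.* ε)     ≡⟨ ℚₚ.*-assoc D (ℚ.1/ D) ε ⟨
    (D ℚ.* ℚ.1/ D) ℚ.* ε     ≡⟨ cong (ℚ._* ε) (ℚₚ.*-inverseʳ D) ⟩
    1ℚ ℚ.* ε                 ≡⟨ ℚₚ.*-identityˡ ε ⟩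
    ε                        ∎
    where open ≡-Reasoning

*-<-bound : ∀ {a b K δ} → Positive K →
            ∣ a ∣ ℚ.≤ K → ∣ b ∣ ℚ.< δ → ∣ a ℚ.* b ∣ ℚ.< K ℚ.* δ
*-<-bound {a} {b} {K} {δ} K⁺ a≤K b<δ = begin-strict
  ∣ a ℚ.* b ∣        ≡⟨ ℚₚ.∣p*q∣≡∣p∣*∣q∣ a b ⟩
  ∣ a ∣ ℚ.* ∣ b ∣    ≤⟨ ℚₚ.*-monoʳ-≤-nonNeg ∣ b ∣ {{ℚₚ.∣-∣-nonNeg b}} a≤K ⟩
  K ℚ.* ∣ b ∣        <⟨ ℚₚ.*-monoʳ-<-pos K {{K⁺}} b<δ ⟩
  K ℚ.* δ            ∎
  where open ℚₚ.≤-Reasoning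

*-cauchy : ∀ {f g} → Cauchy f → Cauchy g → Cauchy (λ n → f n ℚ.* g n)
*-cauchy {f} {g} cf cg ε 0<ε = (M₁ ⊔ M₂) ⊔ (N₁ ⊔ N₂) , close
  where
  boundᶠ = eventually-bounded {f} cf
  boundᵍ = eventually-bounded {g} cg
  B = proj₁ boundᶠ
  B⁺ = proj₁ (proj₂ boundᶠ)
  M₁ = proj₁ (proj₂ (proj₂ boundᶠ))
  f≤B = proj₂ (proj₂ (proj₂ boundᶠ))
  C = proj₁ boundᵍ
  C⁺ = proj₁ (proj₂ boundᵍ)
  M₂ = proj₁ (proj₂ (proj₂ boundᵍ))
  g≤C = proj₂ (proj₂ (proj₂ boundᵍ))
  quotient = divide (B ℚ.+ C) (ℚₚ.pos+pos⇒pos B {{B⁺}} C {{C⁺}}) ε 0<ε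
  δ = proj₁ quotient
  0<δ = proj₁ (proj₂ quotient)
  D*δ≡ε = proj₂ (proj₂ quotient)
  N₁ = proj₁ (cf δ 0<δ)
  N₂ = proj₁ (cg δ 0<δ)
  split : ∀ a b c d → a ℚ.* b ℚ.- c ℚ.* d ≡ a ℚ.* (b ℚ.- d) ℚ.+ d ℚ.* (a ℚ.- c)
  split = solve 4 (λ a b c d → a :* b :- c :* d := a :* (b :- d) :+ d :* (a :- c)) refl
    where open +-*-Solver
  close : ∀ m n → (M₁ ⊔ M₂) ⊔ (N₁ ⊔ N₂) ℕ.≤ m → (M₁ ⊔ M₂) ⊔ (N₁ ⊔ N₂) ℕ.≤ n →
          ∣ f m ℚ.* g m ℚ.- f n ℚ.* g n ∣ ℚ.< ε
  close m n p q = begin-strict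
    ∣ f m ℚ.* g m ℚ.- f n ℚ.* g n ∣
      ≡⟨ cong ∣_∣ (split (f m) (g m) (f n) (g n)) ⟩
    ∣ f m ℚ.* (g m ℚ.- g n) ℚ.+ g n ℚ.* (f m ℚ.- f n) ∣
      ≤⟨ ℚₚ.∣p+q∣≤∣p∣+∣q∣ (f m ℚ.* (g m ℚ.- g n)) (g n ℚ.* (f m ℚ.- f n)) ⟩
    ∣ f m ℚ.* (g m ℚ.- g n) ∣ ℚ.+ ∣ g n ℚ.* (f m ℚ.- f n) ∣
      <⟨ ℚₚ.+-mono-<
           (*-<-bound {f m} {g m ℚ.- g n} B⁺
             (f≤B m (ℕₚ.m⊔n≤o⇒m≤o M₁ M₂ (left p)))
             (proj₂ (cg δ 0<δ) m n (ℕₚ.m⊔n≤o⇒n≤o N₁ N₂ (right p)) (ℕₚ.m⊔n≤o⇒n≤o N₁ N₂ (right q))))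
           (*-<-bound {g n} {f m ℚ.- f n} C⁺
             (g≤C n (ℕₚ.m⊔n≤o⇒n≤o M₁ M₂ (left q)))
             (proj₂ (cf δ 0<δ) m n (ℕₚ.m⊔n≤o⇒m≤o N₁ N₂ (right p)) (ℕₚ.m⊔n≤o⇒m≤o N₁ N₂ (right q)))) ⟩
    B ℚ.* δ ℚ.+ C ℚ.* δ
      ≡⟨ ℚₚ.*-distribʳ-+ δ B C ⟨
    (B ℚ.+ C) ℚ.* δ
      ≡⟨ D*δ≡ε ⟩
    ε ∎
    where
    open ℚₚ.≤-Reasoning
    left : ∀ {o} → (M₁ ⊔ M₂) ⊔ (N₁ ⊔ N₂) ℕ.≤ o → M₁ ⊔ M₂ ℕ.≤ o
    left = ℕₚ.m⊔n≤o⇒m≤o (M₁ ⊔ M₂) (N₁ ⊔ N₂)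
    right : ∀ {o} → (M₁ ⊔ M₂) ⊔ (N₁ ⊔ N₂) ℕ.≤ o → N₁ ⊔ N₂ ℕ.≤ o
    right = ℕₚ.m⊔n≤o⇒n≤o (M₁ ⊔ M₂) (N₁ ⊔ N₂)

infixl 6 _+ℝ_
_+ℝ_ : ℝ → ℝ → ℝ
x +ℝ y = mkℝ (λ n → seq x n ℚ.+ seq y n) (+-cauchy {seq x} {seq y} (cauchy x) (cauchy y))

infixl 7 _*ℝ_
_*ℝ_ : ℝ → ℝ → ℝ
x *ℝ y = mkℝ (λ n → seq x n ℚ.* seq y n) (*-cauchy {seq x} {seq y} (cauchy x) (cauchy y))

Matrix : ℕ → Set
Matrix n = Fin n → Fin n → ℝ

_·_ : ∀ {n} → Matrix n → Vector ℝ n → Vector ℝ n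
(A · v) i = foldr _+ℝ_ 0ℝ (λ j → A i j *ℝ v j)

IsEigenvalue : ∀ {n} → Matrix n → ℝ → Set
IsEigenvalue A μ =
  ∃[ v ] ¬ (∀ i → v i ≃ 0ℝ) × (∀ i → (A · v) i ≃ μ *ℝ v i)

IsLargestEigenvalue : ∀ {n} → Matrix n → ℝ → Set
IsLargestEigenvalue A μ = IsEigenvalue A μ × (∀ ν → IsEigenvalue A ν → ν ≤ℝ μ)

record Graph (n : ℕ) : Set where
  field
    adj     : Fin n → Fin n → Bool
    symm    : ∀ i j → adj i j ≡ adj j i
    irrefl  : ∀ i → adj i i ≡ false

open Graph public

record _≅_ {m n} (G : Graph m) (H : Graph n) : Set where
  field
    bijection : Fin m ↔ Fin n
    adj-≡     : ∀ i j → adj H (Inverse.to bijection i) (Inverse.to bijection j) ≡ adj G i j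

infix 4 _≅_ _⊑_

-- H ⊑ G: G has a (not necessarily induced) subgraph isomorphic to H.
_⊑_ : ∀ {m n} → Graph m → Graph n → Set
_⊑_ {m} {n} H G = ∃[ f ] Injective {A = Fin m} {B = Fin n} _≡_ _≡_ f
  × (∀ i j → adj H i j ≡ true → adj G (f i) (f j) ≡ true)

adjacencyMatrix : ∀ {n} → Graph n → Matrix n
adjacencyMatrix G i j = if adj G i j then 1ℝ else 0ℝ

-- A relation, read μ(G) = x; x is determined only up to _≃_.  Adjacency matrices
-- are symmetric, so restricting to real eigenvalues loses nothing.
IsSpectralRadius : ∀ {n} → Graph n → ℝ → Set
IsSpectralRadius G x = IsLargestEigenvalue (adjacencyMatrix G) x

complete : ∀ n → Graph n
complete n = record
  { adj    = λ i j → not (does (i ≟ j))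
  ; symm   = λ i j → cong not (does-sym i j)
  ; irrefl = λ i → cong not (dec-true (i ≟ i) refl)
  }
  where
  does-sym : ∀ i j → does (i ≟ j) ≡ does (j ≟ i)
  does-sym i j with i ≟ j
  ... | yes i≡j = sym (dec-true (j ≟ i) (sym i≡j))
  ... | no  i≢j = sym (dec-false (j ≟ i) (λ j≡i → i≢j (sym j≡i)))

edgeless : ∀ n → Graph n
edgeless n = record
  { adj = λ _ _ → false ; symm = λ _ _ → refl ; irrefl = λ _ → refl }

-- The single edge joins vertices 0 and 1; there is none when n < 2.
oneEdge : ∀ n → Graph n
oneEdge n = record
  { adj    = λ i j → is01 i j ∨ is01 j i
  ; symm   = λ i j → ∨-comm (is01 i j) (is01 j i)
  ; irrefl = irr
  }
  where
  is01 : ∀ {n} → Fin n → Fin n → Bool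
  is01 i j = (toℕ i ≡ᵇ 0) ∧ (toℕ j ≡ᵇ 1)
  irr : ∀ {n} (i : Fin n) → is01 i i ∨ is01 i i ≡ false
  irr Fin.zero    = refl
  irr (Fin.suc _) = refl

path : ∀ r → Graph r
path r = record
  { adj    = λ i j → next i j ∨ next j i
  ; symm   = λ i j → ∨-comm (next i j) (next j i)
  ; irrefl = λ i → cong₂ _∨_ (suc≢ᵇ (toℕ i)) (suc≢ᵇ (toℕ i))
  }
  where
  next : Fin r → Fin r → Bool
  next i j = suc (toℕ i) ≡ᵇ toℕ j
  suc≢ᵇ : ∀ m → (suc m ≡ᵇ m) ≡ false
  suc≢ᵇ zero    = refl
  suc≢ᵇ (suc m) = suc≢ᵇ m

join : ∀ {m n} → Graph m → Graph n → Graph (m ℕ.+ n)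
join {m} {n} G H = record
  { adj    = λ i j → adj⊎ (splitAt m i) (splitAt m j)
  ; symm   = λ i j → symm⊎ (splitAt m i) (splitAt m j)
  ; irrefl = λ i → irrefl⊎ (splitAt m i)
  }
  where
  adj⊎ : Fin m ⊎ Fin n → Fin m ⊎ Fin n → Bool
  adj⊎ (inj₁ i) (inj₁ j) = adj G i j
  adj⊎ (inj₂ i) (inj₂ j) = adj H i j
  adj⊎ (inj₁ _) (inj₂ _) = true
  adj⊎ (inj₂ _) (inj₁ _) = true
  symm⊎ : ∀ x y → adj⊎ x y ≡ adj⊎ y x
  symm⊎ (inj₁ i) (inj₁ j) = symm G i j
  symm⊎ (inj₂ i) (inj₂ j) = symm H i j
  symm⊎ (inj₁ _) (inj₂ _) = refl
  symm⊎ (inj₂ _) (inj₁ _) = refl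
  irrefl⊎ : ∀ x → adj⊎ x x ≡ false
  irrefl⊎ (inj₁ i) = irrefl G i
  irrefl⊎ (inj₂ i) = irrefl H i

-- The order k + (n ∸ k) is n for k ≤ n; isomorphism and spectral radius
-- do not require the orders to be definitionally equal.
S : ∀ n k → Graph (k ℕ.+ (n ∸ k))
S n k = join (complete k) (edgeless (n ∸ k))

S⁺ : ∀ n k → Graph (k ℕ.+ (n ∸ k))
S⁺ n k = join (complete k) (oneEdge (n ∸ k))

{-# OPTIONS --safe #-}

-- Put k = k′ + 1, let e ∈ {0, 1} count the extra edges of the extremal graph T,
-- and let λ = μ(T), a root of (t - e) (t (t - k′) - k (n - k)) = 2 k e.  If w is
-- the absolute value of an eigenvector for μ(G) ≥ λ then A w ≥ λ w entrywise.
-- With d the degrees and W(x) the sum of d over the neighbours of x, this gives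
-- Σ W w = Σ d (A w) ≥ λ Σ d w and Σ d w ≥ λ Σ w, so some vertex x satisfies
-- W(x) - k′ d(x) ≥ k (n - k) + e.
--
-- Shrink the vertex set to a minimal U in which x still satisfies the analogous
-- bound; then U is connected with all degrees at least k.  For a longest path P in
-- U, the vertices outside P have degree at most k, and as W(x) is large, many of
-- them have all their neighbours on P.  By pigeonhole more than k of them share
-- the same neighbourhood L ⊆ P with |L| = k.  Zigzagging between L and these
-- vertices, any edge pattern outside L other than the extra edge would yield a
-- path that is too long.  (For k = e = 1 the count is too weak; there, counting
-- the two-step walks from x yields a triangle or a four-cycle, which is analysed
-- directly.)  Hence G embeds in T, and equality holds because deleting an edge of T
-- would force some entry of w, and then all of w, to vanish.
--
-- All goals reached on the way are negations, or decidable, so the case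
-- distinctions above are constructively available.

module Submission where

-- For T the cubic reads λ (λ - k′) = k (n - k) + 2 k e / (λ - e), while W - k′ d is the row sum of
-- A² - k′ A, whose average with weights w is at least λ (λ - k′). For e = 0 this gives the walk
-- bound at some vertex directly; for e = 1 the average strictly exceeds the integer k (n - k), and
-- integrality supplies the summand e. On a set of m vertices the analogous bound is k (m - k) + (n
-- - m) + e. Deleting a vertex of degree below k lowers W - k′ d by at most k′, exactly the drop of
-- this bound, so n - m records the deletions. Later counts give n + e ≤ m + B with B at most 2,
-- which leaves at most one vertex deleted and lets facts about U speak about G. The reals offer
-- neither decidable signs nor division. Hence factors known to be at least 1 replace positive ones,
-- the unknown is δ = λ - e instead of λ, eigenvector entries are cleared of denominators, and an
-- entry of w vanishes in the form w ≤ 0. The size of n leaves room for more than k vertices in one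
-- of the at most 2^(2 k + 1 + e) possible traces on P.

module Counting where

  open import Data.Bool using (Bool; if_then_else_)
  open import Data.Fin using (Fin)
  open import Data.Nat
  open import Data.Nat.Properties
  open import Relation.Binary.PropositionalEquality

  open import Algebra.Properties.Semiring.Sum +-*-semiring public
    using (*-distribˡ-sum; *-distribʳ-sum)
    renaming (sum to ∑; sum-cong-≗ to ∑-cong; ∑-distrib-+ to ∑-+; ∑-comm to ∑-swap)

  infixl 6 _⊕_
  infixl 7 _⊛_

  -- With `_⊛_` this forms nonnegative combinations of known inequalities, which `linear` takes as a
  -- single certificate.
  _⊕_ : ∀ {a b c d} → a ≤ b → c ≤ d → a + c ≤ b + d
  _⊕_ = +-mono-≤

  _⊛_ : ∀ {a b} c → a ≤ b → c * a ≤ c * b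
  c ⊛ p = *-monoʳ-≤ c p

  -- b − a = (R − L) + s, with all terms moved so that no subtraction occurs: the
  -- side condition is then a semiring identity.
  linear : ∀ {L R} a b s → L ≤ R → a + R + s ≡ b + L → a ≤ b
  linear {L} {R} a b s p e =
    +-cancelʳ-≤ R a b (≤-trans (m≤m+n (a + R) s) (≤-trans (≤-reflexive e) (+-monoʳ-≤ b p)))

  by-slack : ∀ {a b} s → a + s ≡ b → a ≤ b
  by-slack {a} s refl = m≤m+n a s

  ⟦_⟧ : Bool → ℕ
  ⟦ b ⟧ = if b then 1 else 0

  count : ∀ {n} → (Fin n → Bool) → ℕ
  count p = ∑ (λ i → ⟦ p i ⟧)

-- The Cauchy reals as an ordered ring with absolute value

module Real where

  open import Defs
  open import Algebra.Bundles using (CommutativeRing)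
  open import Data.Nat as ℕ using (ℕ; _⊔_)
  import Data.Nat.Properties as ℕₚ
  open import Data.Rational as ℚ using (ℚ; 0ℚ; 1ℚ; ½; ∣_∣)
  import Data.Rational.Properties as ℚₚ
  open import Data.Rational.Solver using (module +-*-Solver)
  open import Data.Product using (_×_; _,_; ∃-syntax; proj₁; proj₂)
  open import Data.Sum using (inj₁; inj₂)
  open import Level using (0ℓ)
  open import Relation.Binary.PropositionalEquality

  -- Interface of the spectral argument. It provides no totality, decidability or division, which
  -- the Cauchy reals could not supply constructively; the absolute value turns an eigenvector into
  -- a nonnegative vector.
  record OrderedRing : Set₁ where
    field
      commutativeRing : CommutativeRing 0ℓ 0ℓ
    open CommutativeRing commutativeRing public
    infix 4 _≤_
    field
      _≤_         : Carrier → Carrier → Set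
      ≤-reflexive : ∀ {x y} → x ≈ y → x ≤ y
      ≤-trans     : ∀ {x y z} → x ≤ y → y ≤ z → x ≤ z
      ≤-antisym   : ∀ {x y} → x ≤ y → y ≤ x → x ≈ y
      +-mono-≤    : ∀ {x y u v} → x ≤ y → u ≤ v → x + u ≤ y + v
      *-nonneg    : ∀ {x y} → 0# ≤ x → 0# ≤ y → 0# ≤ x * y
      0≤1         : 0# ≤ 1#
      abs         : Carrier → Carrier
      0≤abs       : ∀ x → 0# ≤ abs x
      ≤abs        : ∀ x → x ≤ abs x
      abs-cong    : ∀ {x y} → x ≈ y → abs x ≈ abs y
      abs-0       : abs 0# ≈ 0#
      abs-*       : ∀ x y → abs (x * y) ≈ abs x * abs y
      abs-+       : ∀ x y → abs (x + y) ≤ abs x + abs y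
      abs≤0       : ∀ {x} → abs x ≤ 0# → x ≈ 0#

  Eventually : (ℕ → Set) → Set
  Eventually P = ∃[ N ] (∀ n → N ℕ.≤ n → P n)

  eventually-map₂ : ∀ {P Q R : ℕ → Set} → (∀ {n} → P n → Q n → R n) →
                    Eventually P → Eventually Q → Eventually R
  eventually-map₂ f (M , p) (N , q) = M ⊔ N , λ n le →
    f (p n (ℕₚ.m⊔n≤o⇒m≤o M N le)) (q n (ℕₚ.m⊔n≤o⇒n≤o M N le))

  eventually-map : ∀ {P Q : ℕ → Set} → (∀ {n} → P n → Q n) →
                   Eventually P → Eventually Q
  eventually-map f (M , p) = M , λ n le → f (p n le)

  half : ∀ ε → 0ℚ ℚ.< ε → ∃[ δ ] 0ℚ ℚ.< δ × δ ℚ.+ δ ≡ ε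
  half ε 0<ε = ½ ℚ.* ε
    , ℚₚ.positive⁻¹ (½ ℚ.* ε) {{ℚₚ.pos*pos⇒pos ½ ε {{ℚ.positive 0<ε}}}}
    , trans (sym (ℚₚ.*-distribʳ-+ ε ½ ½)) (ℚₚ.*-identityˡ ε)

  -- Equality and order of reals say that the termwise difference is `Null`, respectively
  -- `SmallAbove`, so ring and order laws reduce to closure properties of these two classes.
  Null SmallAbove : (ℕ → ℚ) → Set
  Null f       = ∀ ε → 0ℚ ℚ.< ε → Eventually (λ n → ∣ f n ∣ ℚ.< ε)
  SmallAbove f = ∀ ε → 0ℚ ℚ.< ε → Eventually (λ n → f n ℚ.< ε)

  q≤∣q∣ : ∀ q → q ℚ.≤ ∣ q ∣
  q≤∣q∣ q with ℚₚ.≤-total 0ℚ q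
  ... | inj₁ 0≤q = ℚₚ.≤-reflexive (sym (ℚₚ.0≤p⇒∣p∣≡p 0≤q))
  ... | inj₂ q≤0 = ℚₚ.≤-trans q≤0 (ℚₚ.0≤∣p∣ q)

  null-resp : ∀ {f g} → (∀ n → g n ≡ f n) → Null f → Null g
  null-resp eq nf ε 0<ε = eventually-map
    (λ {n} → subst (λ q → ∣ q ∣ ℚ.< ε) (sym (eq n))) (nf ε 0<ε)

  null-+ : ∀ {f g} → Null f → Null g → Null (λ n → f n ℚ.+ g n)
  null-+ {f} {g} nf ng ε 0<ε with half ε 0<ε
  ... | δ , 0<δ , refl = eventually-map₂
    (λ {n} p q → ℚₚ.≤-<-trans (ℚₚ.∣p+q∣≤∣p∣+∣q∣ (f n) (g n)) (ℚₚ.+-mono-< p q))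
    (nf δ 0<δ) (ng δ 0<δ)

  null-neg : ∀ {f} → Null f → Null (λ n → ℚ.- f n)
  null-neg {f} nf ε 0<ε = eventually-map
    (λ {n} → subst (ℚ._< ε) (sym (ℚₚ.∣-p∣≡∣p∣ (f n)))) (nf ε 0<ε)

  -- A Cauchy factor is eventually bounded by some B, and the null factor is brought below ε / B.
  null-* : ∀ x {f} → Null f → Null (λ n → seq x n ℚ.* f n)
  null-* x {f} nf ε 0<ε = from-bound (eventually-bounded {seq x} (cauchy x))
    where
    from-bound : ∃[ B ] ℚ.Positive B × Eventually (λ n → ∣ seq x n ∣ ℚ.≤ B) →
                 Eventually (λ n → ∣ seq x n ℚ.* f n ∣ ℚ.< ε)
    from-bound (B , B⁺ , bound) = from-quotient (divide B B⁺ ε 0<ε)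
      where
      from-quotient : ∃[ δ ] 0ℚ ℚ.< δ × B ℚ.* δ ≡ ε →
                      Eventually (λ n → ∣ seq x n ℚ.* f n ∣ ℚ.< ε)
      from-quotient (δ , 0<δ , refl) = eventually-map₂
        (λ {n} p q → *-<-bound {seq x n} {f n} B⁺ p q) bound (nf δ 0<δ)

  smallAbove-resp : ∀ {f g} → (∀ n → g n ℚ.≤ f n) → SmallAbove f → SmallAbove g
  smallAbove-resp le sf ε 0<ε =
    eventually-map (λ {n} → ℚₚ.≤-<-trans (le n)) (sf ε 0<ε)

  smallAbove-+ : ∀ {f g} → SmallAbove f → SmallAbove g →
                 SmallAbove (λ n → f n ℚ.+ g n)
  smallAbove-+ sf sg ε 0<ε with half ε 0<ε
  ... | δ , 0<δ , refl = eventually-map₂ ℚₚ.+-mono-< (sf δ 0<δ) (sg δ 0<δ)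

  null⇒smallAbove : ∀ {f} → Null f → SmallAbove f
  null⇒smallAbove {f} nf ε 0<ε =
    eventually-map (λ {n} → ℚₚ.≤-<-trans (q≤∣q∣ (f n))) (nf ε 0<ε)

  module _ where
    open +-*-Solver

    telescope : ∀ a b c → a ℚ.- c ≡ (a ℚ.- b) ℚ.+ (b ℚ.- c)
    telescope = solve 3 (λ a b c → a :- c := (a :- b) :+ (b :- c)) refl

    flip-- : ∀ a b → b ℚ.- a ≡ ℚ.- (a ℚ.- b)
    flip-- = solve 2 (λ a b → b :- a := :- (a :- b)) refl

    sum-- : ∀ a b c d → (a ℚ.+ c) ℚ.- (b ℚ.+ d) ≡ (a ℚ.- b) ℚ.+ (c ℚ.- d)
    sum-- = solve 4 (λ a b c d → (a :+ c) :- (b :+ d) := (a :- b) :+ (c :- d)) refl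

    product-- : ∀ a b c d → (a ℚ.* c) ℚ.- (b ℚ.* d) ≡ a ℚ.* (c ℚ.- d) ℚ.+ d ℚ.* (a ℚ.- b)
    product-- = solve 4 (λ a b c d → (a :* c) :- (b :* d) := a :* (c :- d) :+ d :* (a :- b)) refl

  ≃-pointwise : ∀ {x y} → (∀ n → seq x n ≡ seq y n) → x ≃ y
  ≃-pointwise {x} {y} eq ε 0<ε = 0 , λ n _ → subst (ℚ._< ε)
    (sym (trans (cong ∣_∣ (cong (ℚ._- seq y n) (eq n))) (cong ∣_∣ (ℚₚ.+-inverseʳ (seq y n))))) 0<ε

  ≤ℝ-pointwise : ∀ {x y} → (∀ n → seq x n ℚ.≤ seq y n) → x ≤ℝ y
  ≤ℝ-pointwise {x} {y} le ε 0<ε = 0 , λ n _ → ℚₚ.≤-<-trans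
    (subst (seq x n ℚ.- seq y n ℚ.≤_) (ℚₚ.+-inverseʳ (seq y n)) (ℚₚ.+-monoˡ-≤ (ℚ.- seq y n) (le n))) 0<ε

  ≃-sym : ∀ {x y} → x ≃ y → y ≃ x
  ≃-sym {x} {y} p = null-resp (λ n → flip-- (seq x n) (seq y n)) (null-neg p)

  ≃-trans : ∀ {x y z} → x ≃ y → y ≃ z → x ≃ z
  ≃-trans {x} {y} {z} p q =
    null-resp (λ n → telescope (seq x n) (seq y n) (seq z n)) (null-+ p q)

  +-cong : ∀ {x y u v} → x ≃ y → u ≃ v → x +ℝ u ≃ y +ℝ v
  +-cong {x} {y} {u} {v} p q =
    null-resp (λ n → sum-- (seq x n) (seq y n) (seq u n) (seq v n)) (null-+ p q)

  *-cong : ∀ {x y u v} → x ≃ y → u ≃ v → x *ℝ u ≃ y *ℝ v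
  *-cong {x} {y} {u} {v} p q =
    null-resp (λ n → product-- (seq x n) (seq y n) (seq u n) (seq v n))
      (null-+ (null-* x q) (null-* v p))

  -ℝ_ : ℝ → ℝ
  -ℝ x = mkℝ (λ n → ℚ.- seq x n) λ ε 0<ε → proj₁ (cauchy x ε 0<ε) , λ m n p q →
    subst (ℚ._< ε) (trans (sym (ℚₚ.∣-p∣≡∣p∣ (seq x m ℚ.- seq x n))) (cong ∣_∣ (lemma (seq x m) (seq x n))))
      (proj₂ (cauchy x ε 0<ε) m n p q)
    where
    open +-*-Solver
    lemma : ∀ a b → ℚ.- (a ℚ.- b) ≡ ℚ.- a ℚ.- (ℚ.- b)
    lemma = solve 2 (λ a b → :- (a :- b) := :- a :- (:- b)) refl

  ℝ-commutativeRing : CommutativeRing 0ℓ 0ℓ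
  ℝ-commutativeRing = record
    { Carrier = ℝ ; _≈_ = _≃_ ; _+_ = _+ℝ_ ; _*_ = _*ℝ_ ; -_ = -ℝ_ ; 0# = 0ℝ ; 1# = 1ℝ
    ; isCommutativeRing = record
      { isRing = record
        { +-isAbelianGroup = record
          { isGroup = record
            { isMonoid = record
              { isSemigroup = record
                { isMagma = record
                  { isEquivalence = record
                    { refl  = λ {x} → ≃-pointwise {x} {x} (λ _ → refl)
                    ; sym   = λ {x} {y} → ≃-sym {x} {y}
                    ; trans = λ {x} {y} {z} → ≃-trans {x} {y} {z} }
                  ; ∙-cong = λ {x} {y} {u} {v} → +-cong {x} {y} {u} {v} }
                ; assoc = λ x y z → ≃-pointwise {(x +ℝ y) +ℝ z} {x +ℝ (y +ℝ z)}
                    (λ n → ℚₚ.+-assoc (seq x n) (seq y n) (seq z n)) }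
              ; identity = (λ x → ≃-pointwise {0ℝ +ℝ x} {x} (λ n → ℚₚ.+-identityˡ (seq x n)))
                         , (λ x → ≃-pointwise {x +ℝ 0ℝ} {x} (λ n → ℚₚ.+-identityʳ (seq x n))) }
            ; inverse = (λ x → ≃-pointwise {(-ℝ x) +ℝ x} {0ℝ} (λ n → ℚₚ.+-inverseˡ (seq x n)))
                      , (λ x → ≃-pointwise {x +ℝ (-ℝ x)} {0ℝ} (λ n → ℚₚ.+-inverseʳ (seq x n)))
            ; ⁻¹-cong = λ {x} {y} p → null-resp (λ n → neg-- (seq x n) (seq y n)) (null-neg p) }
          ; comm = λ x y → ≃-pointwise {x +ℝ y} {y +ℝ x} (λ n → ℚₚ.+-comm (seq x n) (seq y n)) }
        ; *-cong = λ {x} {y} {u} {v} → *-cong {x} {y} {u} {v}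
        ; *-assoc = λ x y z → ≃-pointwise {(x *ℝ y) *ℝ z} {x *ℝ (y *ℝ z)}
            (λ n → ℚₚ.*-assoc (seq x n) (seq y n) (seq z n))
        ; *-identity = (λ x → ≃-pointwise {1ℝ *ℝ x} {x} (λ n → ℚₚ.*-identityˡ (seq x n)))
                     , (λ x → ≃-pointwise {x *ℝ 1ℝ} {x} (λ n → ℚₚ.*-identityʳ (seq x n)))
        ; distrib = (λ x y z → ≃-pointwise {x *ℝ (y +ℝ z)} {(x *ℝ y) +ℝ (x *ℝ z)}
                      (λ n → ℚₚ.*-distribˡ-+ (seq x n) (seq y n) (seq z n)))
                  , (λ x y z → ≃-pointwise {(y +ℝ z) *ℝ x} {(y *ℝ x) +ℝ (z *ℝ x)}
                      (λ n → ℚₚ.*-distribʳ-+ (seq x n) (seq y n) (seq z n))) }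
      ; *-comm = λ x y → ≃-pointwise {x *ℝ y} {y *ℝ x} (λ n → ℚₚ.*-comm (seq x n) (seq y n)) } }
    where
    open +-*-Solver
    neg-- : ∀ a b → ℚ.- a ℚ.- (ℚ.- b) ≡ ℚ.- (a ℚ.- b)
    neg-- = solve 2 (λ a b → :- a :- (:- b) := :- (a :- b)) refl

  ∣∣-∣∣≤∣-∣ : ∀ a b → ∣ a ∣ ℚ.- ∣ b ∣ ℚ.≤ ∣ a ℚ.- b ∣
  ∣∣-∣∣≤∣-∣ a b = subst (∣ a ∣ ℚ.- ∣ b ∣ ℚ.≤_) (cancel ∣ a ℚ.- b ∣ ∣ b ∣)
    (ℚₚ.+-monoˡ-≤ (ℚ.- ∣ b ∣) (subst (ℚ._≤ ∣ a ℚ.- b ∣ ℚ.+ ∣ b ∣) (cong ∣_∣ (sym (restore a b)))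
      (ℚₚ.∣p+q∣≤∣p∣+∣q∣ (a ℚ.- b) b)))
    where
    open +-*-Solver
    restore : ∀ a b → a ≡ (a ℚ.- b) ℚ.+ b
    restore = solve 2 (λ a b → a := (a :- b) :+ b) refl
    cancel : ∀ p q → p ℚ.+ q ℚ.- q ≡ p
    cancel = solve 2 (λ p q → p :+ q :- q := p) refl

  ∣∣-∣∣-close : ∀ a b → ∣ ∣ a ∣ ℚ.- ∣ b ∣ ∣ ℚ.≤ ∣ a ℚ.- b ∣
  ∣∣-∣∣-close a b with ℚₚ.∣p∣≡p∨∣p∣≡-p (∣ a ∣ ℚ.- ∣ b ∣)
  ... | inj₁ eq = subst (ℚ._≤ ∣ a ℚ.- b ∣) (sym eq) (∣∣-∣∣≤∣-∣ a b)
  ... | inj₂ eq = subst₂ ℚ._≤_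
      (trans (flip-- ∣ a ∣ ∣ b ∣) (sym eq))
      (trans (cong ∣_∣ (flip-- a b)) (ℚₚ.∣-p∣≡∣p∣ (a ℚ.- b)))
      (∣∣-∣∣≤∣-∣ b a)

  ∣_∣ℝ : ℝ → ℝ
  ∣ x ∣ℝ = mkℝ (λ n → ∣ seq x n ∣) λ ε 0<ε → proj₁ (cauchy x ε 0<ε) , λ m n p q →
    ℚₚ.≤-<-trans (∣∣-∣∣-close (seq x m) (seq x n)) (proj₂ (cauchy x ε 0<ε) m n p q)

  ≃⇒≤ℝ : ∀ {x y} → x ≃ y → x ≤ℝ y
  ≃⇒≤ℝ = null⇒smallAbove

  ≤ℝ-trans : ∀ {x y z} → x ≤ℝ y → y ≤ℝ z → x ≤ℝ z
  ≤ℝ-trans {x} {y} {z} p q = smallAbove-resp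
    (λ n → ℚₚ.≤-reflexive (telescope (seq x n) (seq y n) (seq z n))) (smallAbove-+ p q)

  ≤ℝ-antisym : ∀ {x y} → x ≤ℝ y → y ≤ℝ x → x ≃ y
  ≤ℝ-antisym {x} {y} p q ε 0<ε = eventually-map₂ (λ {n} → below n) (p ε 0<ε) (q ε 0<ε)
    where
    below : ∀ n → seq x n ℚ.- seq y n ℚ.< ε → seq y n ℚ.- seq x n ℚ.< ε →
            ∣ seq x n ℚ.- seq y n ∣ ℚ.< ε
    below n r s with ℚₚ.∣p∣≡p∨∣p∣≡-p (seq x n ℚ.- seq y n)
    ... | inj₁ eq = subst (ℚ._< ε) (sym eq) r
    ... | inj₂ eq = subst (ℚ._< ε) (trans (flip-- (seq x n) (seq y n)) (sym eq)) s

  -- The assumption only makes late terms exceed `- δ`, never nonnegative. Taking the absolute value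
  -- of a negative term a changes it by `- a - a`, which is then below 2 δ.
  nonneg⇒≃abs : ∀ x → 0ℝ ≤ℝ x → ∣ x ∣ℝ ≃ x
  nonneg⇒≃abs x 0≤x ε 0<ε with half ε 0<ε
  ... | δ , 0<δ , refl = eventually-map (λ {n} → close (seq x n)) (0≤x δ 0<δ)
    where
    open +-*-Solver
    double : ∀ a → ℚ.- a ℚ.- a ≡ (0ℚ ℚ.- a) ℚ.+ (0ℚ ℚ.- a)
    double = solve 1 (λ a → :- a :- a := (con 0ℚ :- a) :+ (con 0ℚ :- a)) refl
    close : ∀ a → 0ℚ ℚ.- a ℚ.< δ → ∣ ∣ a ∣ ℚ.- a ∣ ℚ.< δ ℚ.+ δ
    close a lt with ℚₚ.∣p∣≡p∨∣p∣≡-p a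
    ... | inj₁ eq = subst (ℚ._< δ ℚ.+ δ)
          (sym (trans (cong (λ b → ∣ b ℚ.- a ∣) eq) (cong ∣_∣ (ℚₚ.+-inverseʳ a)))) 0<ε
    ... | inj₂ eq = subst (ℚ._< δ ℚ.+ δ)
          (sym (trans (ℚₚ.0≤p⇒∣p∣≡p (subst (ℚ._≤ ∣ a ∣ ℚ.- a) (ℚₚ.+-inverseʳ a) (ℚₚ.+-monoˡ-≤ (ℚ.- a) (q≤∣q∣ a))))
            (trans (cong (ℚ._- a) eq) (double a))))
          (ℚₚ.+-mono-< lt lt)

  -- Both factors are replaced by their absolute values, whose product is nonnegative term by term.
  *-nonnegℝ : ∀ {x y} → 0ℝ ≤ℝ x → 0ℝ ≤ℝ y → 0ℝ ≤ℝ x *ℝ y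
  *-nonnegℝ {x} {y} 0≤x 0≤y = ≤ℝ-trans {0ℝ} {∣ x ∣ℝ *ℝ ∣ y ∣ℝ} {x *ℝ y}
    (≤ℝ-pointwise {0ℝ} {∣ x ∣ℝ *ℝ ∣ y ∣ℝ} λ n →
      subst (0ℚ ℚ.≤_) (ℚₚ.∣p*q∣≡∣p∣*∣q∣ (seq x n) (seq y n)) (ℚₚ.0≤∣p∣ (seq x n ℚ.* seq y n)))
    (≃⇒≤ℝ {∣ x ∣ℝ *ℝ ∣ y ∣ℝ} {x *ℝ y}
      (*-cong {∣ x ∣ℝ} {x} {∣ y ∣ℝ} {y} (nonneg⇒≃abs x 0≤x) (nonneg⇒≃abs y 0≤y)))

  ℝ-orderedRing : OrderedRing
  ℝ-orderedRing = record
    { commutativeRing = ℝ-commutativeRing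
    ; _≤_         = _≤ℝ_
    ; ≤-reflexive = λ {x} {y} → ≃⇒≤ℝ {x} {y}
    ; ≤-trans     = λ {x} {y} {z} → ≤ℝ-trans {x} {y} {z}
    ; ≤-antisym   = λ {x} {y} → ≤ℝ-antisym {x} {y}
    ; +-mono-≤    = λ {x} {y} {u} {v} p q → smallAbove-resp
        (λ n → ℚₚ.≤-reflexive (sum-- (seq x n) (seq y n) (seq u n) (seq v n))) (smallAbove-+ p q)
    ; *-nonneg    = λ {x} {y} → *-nonnegℝ {x} {y}
    ; 0≤1         = ≤ℝ-pointwise {0ℝ} {1ℝ} (λ _ → ℚₚ.nonNegative⁻¹ 1ℚ)
    ; abs         = ∣_∣ℝ
    ; 0≤abs       = λ x → ≤ℝ-pointwise {0ℝ} {∣ x ∣ℝ} (λ n → ℚₚ.0≤∣p∣ (seq x n))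
    ; ≤abs        = λ x → ≤ℝ-pointwise {x} {∣ x ∣ℝ} (λ n → q≤∣q∣ (seq x n))
    ; abs-cong    = λ {x} {y} p ε 0<ε → eventually-map
        (λ {n} → ℚₚ.≤-<-trans (∣∣-∣∣-close (seq x n) (seq y n))) (p ε 0<ε)
    ; abs-0       = ≃-pointwise {∣ 0ℝ ∣ℝ} {0ℝ} (λ _ → refl)
    ; abs-*       = λ x y → ≃-pointwise {∣ x *ℝ y ∣ℝ} {∣ x ∣ℝ *ℝ ∣ y ∣ℝ}
        (λ n → ℚₚ.∣p*q∣≡∣p∣*∣q∣ (seq x n) (seq y n))
    ; abs-+       = λ x y → ≤ℝ-pointwise {∣ x +ℝ y ∣ℝ} {∣ x ∣ℝ +ℝ ∣ y ∣ℝ}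
        (λ n → ℚₚ.∣p+q∣≤∣p∣+∣q∣ (seq x n) (seq y n))
    ; abs≤0       = λ {x} p ε 0<ε → eventually-map
        (λ {n} → subst (ℚ._< ε) (trans (ℚₚ.+-identityʳ ∣ seq x n ∣) (cong ∣_∣ (sym (ℚₚ.+-identityʳ (seq x n)))))) (p ε 0<ε)
    }

-- Nonnegative subharmonic vectors and walk counts

module Spectral where

  open import Defs using (Graph; adj; symm)
  open Counting using (∑; ⟦_⟧; count)
  open Real using (OrderedRing)
  open import Data.Bool using (Bool; true; false; if_then_else_)
  open import Data.Fin using (Fin; zero; suc)
  open import Data.Nat as ℕ using (ℕ; zero; suc)
  import Data.Nat.Properties as ℕₚ
  open import Data.Product using (_×_; _,_)
  open import Data.Sum using (_⊎_; inj₁; inj₂)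
  open import Function using (_∘_)
  open import Relation.Binary.PropositionalEquality as ≡ using (_≡_)

  degree : ∀ {n} → Graph n → Fin n → ℕ
  degree G v = count (adj G v)

  -- The number of two-step walks from a vertex, called W in the overview.
  walks : ∀ {n} → Graph n → Fin n → ℕ
  walks G v = ∑ (λ z → ⟦ adj G v z ⟧ ℕ.* degree G z)

  module Subharmonic (R : OrderedRing) where
    open OrderedRing R hiding (zero)
    open import Algebra.Properties.Semiring.Sum semiring
      using (sum; sum-cong-≋; ∑-distrib-+; ∑-comm; *-distribˡ-sum)
    open import Algebra.Properties.Semiring.Mult semiring
      using (×-homo-+; ×1-homo-*) renaming (_×_ to _·_)
    open import Algebra.Solver.Ring.NaturalCoefficients.Default commutativeSemiring
      using (solve; _:+_; _:*_; _:=_; con)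

    ≤-refl : ∀ {x} → x ≤ x
    ≤-refl = ≤-reflexive refl

    infixr 2 _≤⟨_⟩_ _≈⟨_⟩_
    infix  3 _∎
    _≤⟨_⟩_ : ∀ x {y z} → x ≤ y → y ≤ z → x ≤ z
    _ ≤⟨ p ⟩ q = ≤-trans p q
    _≈⟨_⟩_ : ∀ x {y z} → x ≈ y → y ≤ z → x ≤ z
    _ ≈⟨ p ⟩ q = ≤-trans (≤-reflexive p) q
    _∎ : ∀ x → x ≤ x
    _ ∎ = ≤-refl

    ≤-cancelʳ : ∀ {x y} z → x + z ≤ y + z → x ≤ y
    ≤-cancelʳ {x} {y} z p = x ≈⟨ shift x ⟩ x + z - z ≤⟨ +-mono-≤ p ≤-refl ⟩ y + z - z ≈⟨ sym (shift y) ⟩ y ∎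
      where
      shift : ∀ t → t ≈ t + z - z
      shift t = sym (trans (+-assoc t z (- z)) (trans (+-congˡ (-‿inverseʳ z)) (+-identityʳ t)))

    linear : ∀ {a b L R} → L ≤ R → a + R ≈ b + L → a ≤ b
    linear {a} {b} {L} {R} p e = ≤-cancelʳ R
      (a + R ≈⟨ e ⟩ b + L ≤⟨ +-mono-≤ ≤-refl p ⟩ b + R ∎)

    0≤+ : ∀ {x y} → 0# ≤ x → 0# ≤ y → 0# ≤ x + y
    0≤+ {x} {y} p q = 0# ≈⟨ sym (+-identityˡ 0#) ⟩ 0# + 0# ≤⟨ +-mono-≤ p q ⟩ x + y ∎

    *-monoˡ : ∀ {x y z} → 0# ≤ z → x ≤ y → z * x ≤ z * y
    *-monoˡ {x} {y} {z} 0≤z x≤y = linear (*-nonneg 0≤z 0≤y-x)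
      (trans (+-congˡ (distribˡ z y (- x))) (trans (cancel (z * x) (z * y) (z * - x) cancels) (sym (+-identityʳ (z * y)))))
      where
      0≤y-x : 0# ≤ y - x
      0≤y-x = 0# ≈⟨ sym (-‿inverseʳ x) ⟩ x - x ≤⟨ +-mono-≤ x≤y ≤-refl ⟩ y - x ∎
      cancels : z * x + z * - x ≈ 0#
      cancels = trans (sym (distribˡ z x (- x))) (trans (*-congˡ (-‿inverseʳ x)) (zeroʳ z))
      cancel : ∀ a b c → a + c ≈ 0# → a + (b + c) ≈ b
      cancel a b c e = trans (solve 3 (λ a b c → a :+ (b :+ c) := b :+ (a :+ c)) refl a b c)
        (trans (+-congˡ e) (+-identityʳ b))

    *-monoʳ : ∀ {x y z} → 0# ≤ z → x ≤ y → x * z ≤ y * z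
    *-monoʳ {x} {y} {z} 0≤z x≤y = x * z ≈⟨ *-comm x z ⟩ z * x ≤⟨ *-monoˡ 0≤z x≤y ⟩ z * y ≈⟨ *-comm z y ⟩ y * z ∎

    ι : ℕ → Carrier
    ι n = n · 1#

    ι-nonneg : ∀ n → 0# ≤ ι n
    ι-nonneg zero    = ≤-refl
    ι-nonneg (suc n) = 0≤+ 0≤1 (ι-nonneg n)

    ι-mono : ∀ {m n} → m ℕ.≤ n → ι m ≤ ι n
    ι-mono {n = n} ℕ.z≤n = ι-nonneg n
    ι-mono (ℕ.s≤s p) = +-mono-≤ ≤-refl (ι-mono p)

    -- Stands in for division by a positive quantity.
    ≤0-by-scaling : ∀ {x y} → 0# ≤ x → 1# ≤ y → y * x ≤ 0# → x ≤ 0#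
    ≤0-by-scaling {x} {y} 0≤x 1≤y p = x ≈⟨ sym (*-identityˡ x) ⟩ 1# * x ≤⟨ *-monoʳ 0≤x 1≤y ⟩ y * x ≤⟨ p ⟩ 0# ∎

    sum-mono : ∀ {n} {f g : Fin n → Carrier} → (∀ i → f i ≤ g i) → sum f ≤ sum g
    sum-mono {zero}  p = ≤-refl
    sum-mono {suc n} p = +-mono-≤ (p zero) (sum-mono (p ∘ suc))

    sum-nonneg : ∀ {n} {f : Fin n → Carrier} → (∀ i → 0# ≤ f i) → 0# ≤ sum f
    sum-nonneg {zero}  p = ≤-refl
    sum-nonneg {suc n} p = 0≤+ (p zero) (sum-nonneg (p ∘ suc))

    term≤sum : ∀ {n} {f : Fin n → Carrier} → (∀ i → 0# ≤ f i) → ∀ i → f i ≤ sum f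
    term≤sum {suc n} {f} p zero    = f zero ≈⟨ sym (+-identityʳ _) ⟩ f zero + 0# ≤⟨ +-mono-≤ ≤-refl (sum-nonneg (p ∘ suc)) ⟩ sum f ∎
    term≤sum {suc n} {f} p (suc i) = f (suc i) ≤⟨ term≤sum (p ∘ suc) i ⟩ sum (f ∘ suc) ≈⟨ sym (+-identityˡ _) ⟩
      0# + sum (f ∘ suc) ≤⟨ +-mono-≤ (p zero) ≤-refl ⟩ sum f ∎

    -- The difference of the sums collects nonnegative gaps, one of which is `f i - g i`.
    sum-gap : ∀ {n} {f g : Fin n → Carrier} → (∀ i → g i ≤ f i) → ∀ i → f i + sum g ≤ sum f + g i
    sum-gap {suc n} {f} {g} le zero    = linear (sum-mono (le ∘ suc))
      (solve 4 (λ a b c d → (a :+ (b :+ c)) :+ d := ((a :+ d) :+ b) :+ c) refl (f zero) (g zero) (sum (g ∘ suc)) (sum (f ∘ suc)))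
    sum-gap {suc n} {f} {g} le (suc i) = linear (+-mono-≤ (sum-gap (le ∘ suc) i) (le zero))
      (solve 6 (λ a b c d x y → (x :+ (b :+ c)) :+ ((d :+ y) :+ a) := ((a :+ d) :+ y) :+ ((x :+ c) :+ b)) refl
        (f zero) (g zero) (sum (g ∘ suc)) (sum (f ∘ suc)) (f (suc i)) (g (suc i)))

    -- Turns an equality between pairings into equalities at the single vertices.
    sum-tight : ∀ {n} {f g : Fin n → Carrier} → (∀ i → g i ≤ f i) → sum f ≤ sum g → ∀ i → f i ≤ g i
    sum-tight {f = f} {g} le p i = linear (+-mono-≤ (sum-gap le i) p)
      (solve 4 (λ a b c d → a :+ ((c :+ b) :+ d) := b :+ ((a :+ d) :+ c)) refl (f i) (g i) (sum f) (sum g))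

    χ : Bool → Carrier
    χ b = if b then 1# else 0#

    χ-nonneg : ∀ b → 0# ≤ χ b
    χ-nonneg true  = 0≤1
    χ-nonneg false = ≤-refl

    χ≈ι : ∀ b → χ b ≈ ι ⟦ b ⟧
    χ≈ι true  = sym (+-identityʳ 1#)
    χ≈ι false = refl

    ι-∑ : ∀ {n} (f : Fin n → ℕ) → ι (∑ f) ≈ sum (ι ∘ f)
    ι-∑ {zero}  f = refl
    ι-∑ {suc n} f = trans (×-homo-+ 1# (f zero) (∑ (f ∘ suc))) (+-congˡ (ι-∑ (f ∘ suc)))

    module _ {n : ℕ} where

      apply : Graph n → (Fin n → Carrier) → Fin n → Carrier
      apply G w i = sum (λ j → χ (adj G i j) * w j)

      pair : (Fin n → Carrier) → (Fin n → Carrier) → Carrier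
      pair u w = sum (λ i → u i * w i)

      pair-comm : ∀ u w → pair u w ≈ pair w u
      pair-comm u w = sum-cong-≋ (λ i → *-comm (u i) (w i))

      apply-selfadjoint : ∀ G u w → pair w (apply G u) ≈ pair u (apply G w)
      apply-selfadjoint G u w =
        trans (sum-cong-≋ (λ i → *-distribˡ-sum (w i) (λ j → χ (adj G i j) * u j)))
        (trans (∑-comm (λ i j → w i * (χ (adj G i j) * u j)))
        (sum-cong-≋ (λ j → trans (sum-cong-≋ (λ i → swap i j))
          (sym (*-distribˡ-sum (u j) (λ i → χ (adj G j i) * w i))))))
        where
        swap : ∀ i j → w i * (χ (adj G i j) * u j) ≈ u j * (χ (adj G j i) * w i)
        swap i j rewrite symm G i j = solve 3 (λ a b c → a :* (b :* c) := c :* (b :* a)) refl (w i) (χ (adj G j i)) (u j)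

      apply-nonneg : ∀ G {w} → (∀ i → 0# ≤ w i) → ∀ i → 0# ≤ apply G w i
      apply-nonneg G p i = sum-nonneg (λ j → *-nonneg (χ-nonneg (adj G i j)) (p j))

      neighbour≤apply : ∀ G {w} → (∀ i → 0# ≤ w i) → ∀ i j → adj G i j ≡ true → w j ≤ apply G w i
      neighbour≤apply G {w} p i j eq = w j ≈⟨ sym (*-identityˡ (w j)) ⟩ 1# * w j ≈⟨ *-congʳ (reflexive (≡.cong χ (≡.sym eq))) ⟩
        χ (adj G i j) * w j ≤⟨ term≤sum {f = λ j → χ (adj G i j) * w j} (λ j → *-nonneg (χ-nonneg (adj G i j)) (p j)) j ⟩
        apply G w i ∎

      sum-scaled : ∀ a (w : Fin n → Carrier) → sum (λ i → a * w i) ≈ a * sum w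
      sum-scaled a w = sym (*-distribˡ-sum a w)

      apply-degree : ∀ G i → apply G (ι ∘ degree G) i ≈ ι (walks G i)
      apply-degree G i = trans
        (sum-cong-≋ (λ j → trans (*-congʳ (χ≈ι (adj G i j))) (sym (×1-homo-* ⟦ adj G i j ⟧ (degree G j)))))
        (sym (ι-∑ (λ z → ⟦ adj G i z ⟧ ℕ.* degree G z)))

      apply-one : ∀ G i → apply G (λ _ → 1#) i ≈ ι (degree G i)
      apply-one G i = trans
        (sum-cong-≋ (λ j → trans (*-identityʳ _) (χ≈ι (adj G i j))))
        (sym (ι-∑ (λ j → ⟦ adj G i j ⟧)))

      module _ (G : Graph n) (k k′ N e : ℕ) (w : Fin n → Carrier) (δ ρ : Carrier)
               (w-nonneg : ∀ i → 0# ≤ w i) (1≤δ : 1# ≤ δ) (0≤ρ : 0# ≤ ρ) where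

        σ D Q : Carrier
        σ = sum w
        D = pair w (ι ∘ degree G)
        Q = pair w (ι ∘ walks G)

        -- Pair `sub` with the all-ones vector; symmetry moves the matrix onto that vector and
        -- produces the degrees.
        λ*σ≤D : ∀ {l} → (∀ i → l * w i ≤ apply G w i) → l * σ ≤ D
        λ*σ≤D {l} sub = l * σ ≈⟨ sym (sum-scaled l w) ⟩ sum (λ i → l * w i) ≤⟨ sum-mono sub ⟩
          sum (apply G w) ≈⟨ sum-cong-≋ {n} {apply G w} {λ i → 1# * apply G w i} (λ i → sym (*-identityˡ _)) ⟩ pair (λ _ → 1#) (apply G w)
            ≈⟨ sym (apply-selfadjoint G (λ _ → 1#) w) ⟩ pair w (apply G (λ _ → 1#))
            ≈⟨ sum-cong-≋ (λ i → *-congˡ (apply-one G i)) ⟩ D ∎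

        -- The same with the degree vector, which the matrix turns into two-step walk counts.
        λ*D≤Q : ∀ {l} → (∀ i → l * w i ≤ apply G w i) → l * D ≤ Q
        λ*D≤Q {l} sub = l * D ≈⟨ *-congˡ (pair-comm w (ι ∘ degree G)) ⟩ l * pair (ι ∘ degree G) w
            ≈⟨ sym (sum-scaled l (λ i → ι (degree G i) * w i)) ⟩ sum (λ i → l * (ι (degree G i) * w i))
            ≈⟨ sum-cong-≋ (λ i → solve 3 (λ a b c → a :* (b :* c) := b :* (a :* c)) refl l (ι (degree G i)) (w i)) ⟩
          sum (λ i → ι (degree G i) * (l * w i)) ≤⟨ sum-mono (λ i → *-monoˡ (ι-nonneg (degree G i)) (sub i)) ⟩
          pair (ι ∘ degree G) (apply G w) ≈⟨ sym (apply-selfadjoint G (ι ∘ degree G) w) ⟩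
          pair w (apply G (ι ∘ degree G)) ≈⟨ sum-cong-≋ (λ i → *-congˡ (apply-degree G i)) ⟩ Q ∎

        -- The hypothesis is W - k′ d ≤ k N + e - 1 at every vertex, the negation of the walk bound,
        -- with k² + 1 added to avoid subtraction; it is averaged with weights w.
        Q-bound : (∀ v → walks G v ℕ.+ (k ℕ.* k ℕ.+ 1) ℕ.≤ k′ ℕ.* degree G v ℕ.+ (k ℕ.* (k ℕ.+ N) ℕ.+ e)) →
                  Q + (ι k * ι k + 1#) * σ ≤ ι k′ * D + (ι k * (ι k + ι N) + ι e) * σ
        Q-bound small =
          Q + (ι k * ι k + 1#) * σ ≈⟨ +-cong refl (sym (sum-scaled _ w)) ⟩
          Q + sum (λ v → (ι k * ι k + 1#) * w v) ≈⟨ sym (∑-distrib-+ (λ v → w v * ι (walks G v)) (λ v → (ι k * ι k + 1#) * w v)) ⟩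
          sum (λ v → w v * ι (walks G v) + (ι k * ι k + 1#) * w v) ≤⟨ sum-mono vertexwise ⟩
          sum (λ v → ι k′ * (w v * ι (degree G v)) + (ι k * (ι k + ι N) + ι e) * w v) ≈⟨ ∑-distrib-+ (λ v → ι k′ * (w v * ι (degree G v))) (λ v → (ι k * (ι k + ι N) + ι e) * w v) ⟩
          sum (λ v → ι k′ * (w v * ι (degree G v))) + sum (λ v → (ι k * (ι k + ι N) + ι e) * w v)
            ≈⟨ +-cong (sum-scaled (ι k′) (λ v → w v * ι (degree G v))) (sum-scaled (ι k * (ι k + ι N) + ι e) w) ⟩
          ι k′ * D + (ι k * (ι k + ι N) + ι e) * σ ∎
          where
          lhs : ∀ v → ι (walks G v ℕ.+ (k ℕ.* k ℕ.+ 1)) ≈ ι (walks G v) + (ι k * ι k + 1#)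
          lhs v = trans (×-homo-+ 1# (walks G v) _) (+-congˡ (trans (×-homo-+ 1# (k ℕ.* k) 1) (+-cong (×1-homo-* k k) (+-identityʳ 1#))))
          rhs : ∀ v → ι (k′ ℕ.* degree G v ℕ.+ (k ℕ.* (k ℕ.+ N) ℕ.+ e)) ≈ ι k′ * ι (degree G v) + (ι k * (ι k + ι N) + ι e)
          rhs v = trans (×-homo-+ 1# (k′ ℕ.* degree G v) _) (+-cong (×1-homo-* k′ (degree G v))
            (trans (×-homo-+ 1# (k ℕ.* (k ℕ.+ N)) e) (+-congʳ (trans (×1-homo-* k (k ℕ.+ N)) (*-congˡ (×-homo-+ 1# k N))))))
          vertexwise : ∀ v → w v * ι (walks G v) + (ι k * ι k + 1#) * w v
                     ≤ ι k′ * (w v * ι (degree G v)) + (ι k * (ι k + ι N) + ι e) * w v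
          vertexwise v =
            w v * ι (walks G v) + (ι k * ι k + 1#) * w v
              ≈⟨ solve 3 (λ a b c → a :* b :+ c :* a := a :* (b :+ c)) refl (w v) (ι (walks G v)) _ ⟩
            w v * (ι (walks G v) + (ι k * ι k + 1#)) ≈⟨ *-congˡ (sym (lhs v)) ⟩
            w v * ι (walks G v ℕ.+ (k ℕ.* k ℕ.+ 1)) ≤⟨ *-monoˡ (w-nonneg v) (ι-mono (small v)) ⟩
            w v * ι (k′ ℕ.* degree G v ℕ.+ (k ℕ.* (k ℕ.+ N) ℕ.+ e)) ≈⟨ *-congˡ (rhs v) ⟩
            w v * (ι k′ * ι (degree G v) + (ι k * (ι k + ι N) + ι e))
              ≈⟨ solve 4 (λ a b c d → a :* (b :* c :+ d) := b :* (a :* c) :+ d :* a) refl (w v) (ι k′) (ι (degree G v)) _ ⟩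
            ι k′ * (w v * ι (degree G v)) + (ι k * (ι k + ι N) + ι e) * w v ∎

        module _ (l : Carrier) (l≈δ+e : l ≈ δ + ι e) (l≈k′+ρ : l ≈ ι k′ + ρ)
                 (root : δ * (l * ρ) ≈ (1# + 1#) * ι k * ι e + ι k * ι N * δ)
                 (sub : ∀ i → l * w i ≤ apply G w i)
                 (small : ∀ v → walks G v ℕ.+ (k ℕ.* k ℕ.+ 1) ℕ.≤ k′ ℕ.* degree G v ℕ.+ (k ℕ.* (k ℕ.+ N) ℕ.+ e)) where

          -- With Q ≥ l D and ρ = l - k′, `Q-bound` gives ρ D ≤ (k N + e - 1) σ; then D ≥ l σ is
          -- inserted.
          l*ρ*σ-bound : l * ρ * σ + σ ≤ (ι k * ι N + ι e) * σ
          l*ρ*σ-bound = linear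
            (+-mono-≤ (+-mono-≤ (Q-bound small) (λ*D≤Q sub)) (*-monoˡ 0≤ρ (λ*σ≤D sub)))
            (trans
              (solve 9 (λ l r s q d k k′ N e →
                 (l :* r :* s :+ s) :+ (((k′ :* d :+ (k :* (k :+ N) :+ e) :* s) :+ q) :+ r :* d)
                 := ((k :* N :+ e) :* s) :+ (((q :+ (k :* k :+ con 1) :* s) :+ (k′ :+ r) :* d) :+ r :* (l :* s)))
                refl l ρ σ Q D (ι k) (ι k′) (ι N) (ι e))
              (+-congˡ (+-congʳ (+-congˡ (*-congʳ (sym l≈k′+ρ))))))

          -- Multiplying by δ and inserting `root` cancels k N δ σ and leaves (2 k e + δ) σ ≤ δ e σ,
          -- that is δ σ ≤ 0 for e = 0 and 2 k σ ≤ 0 for e = 1.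
          vanishing : (e ≡ 0) ⊎ (e ≡ 1 × 1 ℕ.≤ k) → ∀ v → w v ≤ 0#
          vanishing e01 v = w v ≤⟨ term≤sum w-nonneg v ⟩ σ ≤⟨ σ≤0 e01 ⟩ 0# ∎
            where
            0≤δ = ≤-trans 0≤1 1≤δ
            0≤σ = sum-nonneg w-nonneg
            scaled : ((1# + 1#) * ι k * ι e + δ) * σ ≤ δ * ι e * σ
            scaled = linear (*-monoˡ 0≤δ l*ρ*σ-bound)
              (trans
                (solve 5 (λ d s k N e → ((con 1 :+ con 1) :* k :* e :+ d) :* s :+ d :* ((k :* N :+ e) :* s)
                   := d :* e :* s :+ (((con 1 :+ con 1) :* k :* e :+ k :* N :* d) :* s :+ d :* s)) refl δ σ (ι k) (ι N) (ι e))
                (+-congˡ (trans (+-congʳ (*-congʳ (sym root)))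
                  (solve 4 (λ d l r s → d :* (l :* r) :* s :+ d :* s := d :* (l :* r :* s :+ s)) refl δ l ρ σ))))
            σ≤0 : (e ≡ 0) ⊎ (e ≡ 1 × 1 ℕ.≤ k) → σ ≤ 0#
            σ≤0 (inj₁ ≡.refl) = ≤0-by-scaling 0≤σ 1≤δ (δ * σ ≈⟨ solve 3 (λ d s k → d :* s := ((con 1 :+ con 1) :* k :* con 0 :+ d) :* s) refl δ σ (ι k) ⟩
              _ ≤⟨ scaled ⟩ δ * 0# * σ ≈⟨ solve 2 (λ d s → d :* con 0 :* s := con 0) refl δ σ ⟩ 0# ∎)
            σ≤0 (inj₂ (≡.refl , 1≤k)) = ≤0-by-scaling 0≤σ 1≤2k (linear scaled
              (solve 3 (λ d s k → ((con 1 :+ con 1) :* k) :* s :+ d :* (con 1 :+ con 0) :* s := con 0 :+ ((con 1 :+ con 1) :* k :* (con 1 :+ con 0) :+ d) :* s) refl δ σ (ι k)))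
              where
              1≤2k : 1# ≤ (1# + 1#) * ι k
              1≤2k = 1# ≈⟨ sym (+-identityʳ 1#) ⟩ ι 1 ≤⟨ ι-mono (ℕₚ.≤-trans 1≤k (ℕₚ.m≤m+n k _)) ⟩ ι (2 ℕ.* k) ≈⟨ trans (×1-homo-* 2 k) (*-congʳ (+-congˡ (+-identityʳ 1#))) ⟩ (1# + 1#) * ι k ∎

      module _ (G H : Graph n) (u w : Fin n → Carrier) (l : Carrier)
               (w-nonneg : ∀ i → 0# ≤ w i) (1≤u : ∀ i → 1# ≤ u i)
               (sub : ∀ i → l * w i ≤ apply G w i) (eigen : ∀ i → apply H u i ≈ l * u i)
               (G⊆H : ∀ i j → adj G i j ≡ true → adj H i j ≡ true) where

        0≤u : ∀ i → 0# ≤ u i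
        0≤u i = ≤-trans 0≤1 (1≤u i)

        -- Both sides are compared with l times the pairing of w and u. The opposite inequality
        -- holds entry by entry because H contains G, so equality is forced.
        pair-apply-H : pair w (apply H u) ≤ pair w (apply G u)
        pair-apply-H =
          pair w (apply H u) ≈⟨ sum-cong-≋ (λ i → trans (*-congˡ (eigen i))
            (solve 3 (λ a b c → a :* (b :* c) := c :* (b :* a)) refl (w i) l (u i))) ⟩
          sum (λ i → u i * (l * w i)) ≤⟨ sum-mono (λ i → *-monoˡ (0≤u i) (sub i)) ⟩
          pair u (apply G w) ≈⟨ sym (apply-selfadjoint G u w) ⟩ pair w (apply G u) ∎

        χ-mono : ∀ i j → χ (adj G i j) ≤ χ (adj H i j)
        χ-mono i j with adj G i j | G⊆H i j
        ... | false | _ = χ-nonneg (adj H i j)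
        ... | true  | h = ≤-reflexive (reflexive (≡.cong χ (≡.sym (h ≡.refl))))

        apply-mono : ∀ {f} → (∀ i → 0# ≤ f i) → ∀ i → apply G f i ≤ apply H f i
        apply-mono p i = sum-mono (λ j → *-monoʳ (p j) (χ-mono i j))

        -- The forced equality at i bounds `w i * apply H u i` by `w i * apply G u i`, yet the
        -- missing edge separates the two applications by at least `u j`; hence `w i * u j ≤ 0`.
        missing⇒≤0 : ∀ i j → adj G i j ≡ false → adj H i j ≡ true → w i ≤ 0#
        missing⇒≤0 i j ¬g h = ≤0-by-scaling (w-nonneg i) (1≤u j) (u j * w i ≈⟨ *-comm (u j) (w i) ⟩ w i * u j ≤⟨ linear
            (+-mono-≤ (sum-tight {f = λ i → w i * apply H u i} {g = λ i → w i * apply G u i}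
               (λ i → *-monoˡ (w-nonneg i) (apply-mono 0≤u i)) pair-apply-H i)
              (*-monoˡ (w-nonneg i) extra))
            (solve 4 (λ w a b c → w :* c :+ (w :* a :+ w :* b) := con 0 :+ (w :* b :+ w :* (a :+ c))) refl (w i) (apply G u i) (apply H u i) (u j)) ⟩ 0# ∎)
          where
          extra : apply G u i + u j ≤ apply H u i
          extra = linear (sum-gap {f = λ t → χ (adj H i t) * u t} {g = λ t → χ (adj G i t) * u t}
              (λ t → *-monoʳ (0≤u t) (χ-mono i t)) j)
            (trans (solve 5 (λ a u b x y → (a :+ u) :+ (b :+ x) := b :+ ((u :+ x) :+ a)) refl
                     (apply G u i) (u j) (apply H u i) (χ (adj G i j) * u j) (χ (adj H i j) * u j))
              (+-congˡ (+-congʳ edge)))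
            where
            edge : u j + χ (adj G i j) * u j ≈ χ (adj H i j) * u j
            edge rewrite ¬g | h = trans (+-congˡ (zeroˡ (u j))) (trans (+-identityʳ (u j)) (sym (*-identityˡ (u j))))

        -- After pairing with u, the chain l w ≤ A w ≤ B w, with A and B the matrices of G and H,
        -- has equal ends. So where w vanishes, B w vanishes too, and with it w at every
        -- H-neighbour.
        zero-spreads : ∀ i j → adj H i j ≡ true → w i ≤ 0# → w j ≤ 0#
        zero-spreads i j h wᵢ≤0 = w j ≤⟨ neighbour≤apply H w-nonneg i j h ⟩ apply H w i
          ≤⟨ ≤0-by-scaling (apply-nonneg H w-nonneg i) (1≤u i)
            (u i * apply H w i ≤⟨ tight ⟩ u i * (l * w i)
              ≈⟨ solve 3 (λ u l w → u :* (l :* w) := l :* u :* w) refl (u i) l (w i) ⟩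
             l * u i * w i ≈⟨ *-congʳ (sym (eigen i)) ⟩ apply H u i * w i
              ≤⟨ *-monoˡ (apply-nonneg H 0≤u i) wᵢ≤0 ⟩ apply H u i * 0# ≈⟨ zeroʳ _ ⟩ 0# ∎) ⟩ 0# ∎
          where
          tight : u i * apply H w i ≤ u i * (l * w i)
          tight = sum-tight {f = λ i → u i * apply H w i} {g = λ i → u i * (l * w i)}
            (λ i → *-monoˡ (0≤u i) (≤-trans (sub i) (apply-mono w-nonneg i)))
            (pair u (apply H w) ≈⟨ sym (apply-selfadjoint H u w) ⟩ pair w (apply H u)
              ≈⟨ sum-cong-≋ (λ i → trans (*-congˡ (eigen i))
                (solve 3 (λ a b c → a :* (b :* c) := c :* (b :* a)) refl (w i) l (u i))) ⟩
             sum (λ i → u i * (l * w i)) ∎) i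

      -- By the triangle inequality |m| |v| = |A v| ≤ A |v|, and l ≤ m ≤ |m|.
      abs-subharmonic : ∀ (G : Graph n) (v : Fin n → Carrier) {l m} → l ≤ m →
        (∀ i → apply G v i ≈ m * v i) → ∀ i → l * abs (v i) ≤ apply G (abs ∘ v) i
      abs-subharmonic G v {l} {m} l≤m eigen i =
        l * abs (v i) ≤⟨ *-monoʳ (0≤abs (v i)) (≤-trans l≤m (≤abs m)) ⟩ abs m * abs (v i) ≈⟨ sym (abs-* m (v i)) ⟩
        abs (m * v i) ≈⟨ abs-cong (sym (eigen i)) ⟩ abs (apply G v i) ≤⟨ abs-sum (λ j → χ (adj G i j) * v j) ⟩
        sum (λ j → abs (χ (adj G i j) * v j)) ≤⟨ sum-mono (λ j → abs-χ (adj G i j) (v j)) ⟩ apply G (abs ∘ v) i ∎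
        where
        abs-sum : ∀ {m} (f : Fin m → Carrier) → abs (sum f) ≤ sum (abs ∘ f)
        abs-sum {zero}  f = ≤-reflexive abs-0
        abs-sum {suc m} f = abs (sum f) ≤⟨ abs-+ _ _ ⟩ abs (f zero) + abs (sum (f ∘ suc)) ≤⟨ +-mono-≤ ≤-refl (abs-sum (f ∘ suc)) ⟩ sum (abs ∘ f) ∎
        abs-χ : ∀ b x → abs (χ b * x) ≤ χ b * abs x
        abs-χ true  x = abs (1# * x) ≈⟨ abs-cong (*-identityˡ x) ⟩ abs x ≈⟨ sym (*-identityˡ (abs x)) ⟩ 1# * abs x ∎
        abs-χ false x = abs (0# * x) ≈⟨ abs-cong (zeroˡ x) ⟩ abs 0# ≈⟨ abs-0 ⟩ 0# ≈⟨ sym (zeroˡ (abs x)) ⟩ 0# * abs x ∎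

-- The extremal graph and its eigenvector

module Extremal where

  open import Defs using (Graph; adj; complete; edgeless; oneEdge; join)
  open Counting using (⟦_⟧; count)
  open Real using (OrderedRing)
  open Spectral using (module Subharmonic)
  open import Data.Bool using (Bool; true; false; not)
  open import Data.Fin using (Fin; zero; suc; splitAt; _↑ˡ_; _↑ʳ_; _≟_)
  import Data.Fin.Properties as Fₚ
  open import Data.Nat as ℕ using (ℕ; zero; suc)
  open import Data.Sum using (inj₁; inj₂; [_,_]′)
  open import Function using (_∘_)
  open import Relation.Nullary using (does)
  open import Relation.Binary.PropositionalEquality as ≡ using (_≡_)

  extraEdge : Bool → ∀ n → Graph n
  extraEdge false = edgeless
  extraEdge true  = oneEdge

  -- Unfolds to `S` or `S⁺` according to the flag, so that both parts of the theorem share one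
  -- proof.
  extremal : Bool → ∀ k n → Graph (k ℕ.+ n)
  extremal e k n = join (complete k) (extraEdge e n)

  module _ {m n} (G : Graph m) (H : Graph n) where

    join-ˡˡ : ∀ i j → adj (join G H) (i ↑ˡ n) (j ↑ˡ n) ≡ adj G i j
    join-ˡˡ i j rewrite Fₚ.splitAt-↑ˡ m i n | Fₚ.splitAt-↑ˡ m j n = ≡.refl

    join-ˡʳ : ∀ i j → adj (join G H) (i ↑ˡ n) (m ↑ʳ j) ≡ true
    join-ˡʳ i j rewrite Fₚ.splitAt-↑ˡ m i n | Fₚ.splitAt-↑ʳ m n j = ≡.refl

    join-ʳˡ : ∀ i j → adj (join G H) (m ↑ʳ i) (j ↑ˡ n) ≡ true
    join-ʳˡ i j rewrite Fₚ.splitAt-↑ʳ m n i | Fₚ.splitAt-↑ˡ m j n = ≡.refl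

    join-ʳʳ : ∀ i j → adj (join G H) (m ↑ʳ i) (m ↑ʳ j) ≡ adj H i j
    join-ʳʳ i j rewrite Fₚ.splitAt-↑ʳ m n i | Fₚ.splitAt-↑ʳ m n j = ≡.refl

  data Split m n : Fin (m ℕ.+ n) → Set where
    left  : ∀ i → Split m n (i ↑ˡ n)
    right : ∀ j → Split m n (m ↑ʳ j)

  split : ∀ m n i → Split m n i
  split m n i with splitAt m i in eq
  ... | inj₁ j rewrite ≡.sym (Fₚ.splitAt⁻¹-↑ˡ eq) = left j
  ... | inj₂ j rewrite ≡.sym (Fₚ.splitAt⁻¹-↑ʳ {m} eq) = right j

  count-true : ∀ n → count {n} (λ _ → true) ≡ n
  count-true zero    = ≡.refl
  count-true (suc n) = ≡.cong suc (count-true n)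

  count-others : ∀ {n} (i : Fin (suc n)) → count (λ j → not (does (i ≟ j))) ≡ n
  count-others {n}     zero    = count-true n
  count-others {suc n} (suc i) = ≡.cong suc (count-others i)

  module Eigenvector (R : OrderedRing) where
    open OrderedRing R hiding (zero)
    open Subharmonic R
    open import Algebra.Properties.Semiring.Sum semiring
      using (sum; sum-cong-≋; sum-replicate-zero; *-distribʳ-sum)
    open import Algebra.Solver.Ring.NaturalCoefficients.Default commutativeSemiring
      using (solve; _:+_; _:*_; _:=_; con)

    sum-↑ : ∀ m {n} (f : Fin (m ℕ.+ n) → Carrier) →
            sum f ≈ sum (λ i → f (i ↑ˡ n)) + sum (λ j → f (m ↑ʳ j))
    sum-↑ zero    f = sym (+-identityˡ (sum f))
    sum-↑ (suc m) f = trans (+-congˡ (sum-↑ m (f ∘ suc))) (sym (+-assoc _ _ _))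

    sum-χ : ∀ {n} (p : Fin n → Bool) x → sum (λ j → χ (p j) * x) ≈ ι (count p) * x
    sum-χ p x = trans (sym (*-distribʳ-sum x (χ ∘ p)))
      (*-congʳ (trans (sum-cong-≋ (χ≈ι ∘ p)) (sym (ι-∑ (λ i → ⟦ p i ⟧)))))

    module _ (e : Bool) (k′ M : ℕ) (δ : Carrier) where

      l X Y Z cubicˡ cubicʳ : Carrier
      l = δ + ι ⟦ e ⟧
      X = l * δ
      Y = ι (suc k′) * l
      Z = ι (suc k′) * δ

      -- With k = k′ + 1 and N = M + 2, equality of the two sides means
      -- (l - e) (l (l - k′) - k N) = 2 k e.
      cubicˡ = δ * (l * l)
      cubicʳ = ι k′ * (l * δ) + ((1# + 1#) * ι (suc k′) * l + ι M * ι (suc k′) * δ)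

      private
        k N : ℕ
        k = suc k′
        N = suc (suc M)

      independentPart : ∀ {n} → Fin n → Carrier
      independentPart zero          = Y
      independentPart (suc zero)    = Y
      independentPart (suc (suc _)) = Z

      -- X sits on the clique, Y on the first two independent vertices (the ends of the extra edge),
      -- Z on the others. With denominators cleared, the eigenvalue equations at independent
      -- vertices hold identically and the one at a clique vertex is the cubic. For e = 0 the values
      -- Y and Z agree.
      eigenvector : Fin (k ℕ.+ N) → Carrier
      eigenvector i = [ (λ _ → X) , independentPart ]′ (splitAt k i)

      eigenvector-ˡ : ∀ (i : Fin k) → eigenvector (i ↑ˡ N) ≡ X
      eigenvector-ˡ i = ≡.cong [ (λ _ → X) , independentPart ]′ (Fₚ.splitAt-↑ˡ k i N)

      eigenvector-ʳ : ∀ (j : Fin N) → eigenvector (k ↑ʳ j) ≡ independentPart j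
      eigenvector-ʳ j = ≡.cong [ (λ _ → X) , independentPart ]′ (Fₚ.splitAt-↑ʳ k N j)

      1≤* : ∀ {x y} → 1# ≤ x → 1# ≤ y → 1# ≤ x * y
      1≤* {x} {y} p q = 1# ≤⟨ q ⟩ y ≈⟨ sym (*-identityˡ y) ⟩ 1# * y ≤⟨ *-monoʳ (≤-trans 0≤1 q) p ⟩ x * y ∎

      1≤ιk : 1# ≤ ι k
      1≤ιk = 1# ≈⟨ sym (+-identityʳ 1#) ⟩ 1# + 0# ≤⟨ +-mono-≤ ≤-refl (ι-nonneg k′) ⟩ ι k ∎

      1≤l : 1# ≤ δ → 1# ≤ l
      1≤l 1≤δ = 1# ≈⟨ sym (+-identityʳ 1#) ⟩ 1# + 0# ≤⟨ +-mono-≤ 1≤δ (ι-nonneg ⟦ e ⟧) ⟩ l ∎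

      1≤eigenvector : 1# ≤ δ → ∀ i → 1# ≤ eigenvector i
      1≤eigenvector 1≤δ i with splitAt k i
      ... | inj₁ _ = 1≤* (1≤l 1≤δ) 1≤δ
      ... | inj₂ j = right-bound j
        where
        right-bound : ∀ {n} (j : Fin n) → 1# ≤ independentPart j
        right-bound zero          = 1≤* 1≤ιk (1≤l 1≤δ)
        right-bound (suc zero)    = 1≤* 1≤ιk (1≤l 1≤δ)
        right-bound (suc (suc _)) = 1≤* 1≤ιk 1≤δ

      fromClique : ∀ (i : Fin k) → sum (λ j → χ (adj (complete k) i j) * X) ≈ ι k′ * X
      fromClique i = trans (sum-χ (adj (complete k) i) X) (*-congʳ (reflexive (≡.cong ι (count-others i))))

      fromIndependent : sum {N} independentPart ≈ Y + (Y + ι M * Z)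
      fromIndependent = +-congˡ (+-congˡ (trans
        (sum-cong-≋ {M} {λ _ → Z} {λ _ → χ true * Z} (λ _ → sym (*-identityˡ Z)))
        (trans (sum-χ {M} (λ _ → true) Z) (*-congʳ (reflexive (≡.cong ι (count-true M)))))))

      clique-equation : cubicˡ ≈ cubicʳ →
                        ι k′ * X + (Y + (Y + ι M * Z)) ≈ l * X
      clique-equation root = sym (trans
        (solve 2 (λ l d → l :* (l :* d) := d :* (l :* l)) refl l δ)
        (trans root (solve 5 (λ l d k′ k M → k′ :* (l :* d) :+ ((con 1 :+ con 1) :* k :* l :+ M :* k :* d)
          := k′ :* (l :* d) :+ (k :* l :+ (k :* l :+ M :* (k :* d)))) refl l δ (ι k′) (ι k) (ι M))))

      sum-zero : ∀ {n} {f : Fin n → Carrier} → (∀ j → f j ≈ 0#) → sum f ≈ 0#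
      sum-zero {n} p = trans (sum-cong-≋ p) (sum-replicate-zero n)

      extra-equation : ∀ j → ι k * X + sum (λ i → χ (adj (extraEdge e N) j i) * independentPart i)
                           ≈ l * independentPart j
      extra-equation = go e ≡.refl
        where
        E : Bool → Fin N → Carrier
        E b j = sum (λ i → χ (adj (extraEdge b N) j i) * independentPart i)
        onZ : ι k * X + 0# ≈ l * Z
        onZ = solve 3 (λ k l d → k :* (l :* d) :+ con 0 := l :* (k :* d)) refl (ι k) l δ
        noEdge : ∀ j → E false j ≈ 0#
        noEdge j = sum-zero {N} (λ i → zeroˡ (independentPart i))
        onY : ∀ s → s ≈ ι ⟦ e ⟧ * Y → ι k * X + s ≈ l * Y
        onY s p = trans (+-congˡ p) (solve 3 (λ k d e → k :* ((d :+ e) :* d) :+ e :* (k :* (d :+ e))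
                                            := (d :+ e) :* (k :* (d :+ e))) refl (ι k) δ (ι ⟦ e ⟧))
        one*Y : ι 1 * Y ≈ Y
        one*Y = trans (*-congʳ (+-identityʳ 1#)) (*-identityˡ Y)
        -- The flag is matched through a copy b, because l and the entries are fixed in terms of the
        -- module parameter e.
        go : ∀ b → b ≡ e → ∀ j → ι k * X + E b j ≈ l * independentPart j
        go false ≡.refl zero          = onY _ (trans (noEdge zero) (sym (zeroˡ Y)))
        go false ≡.refl (suc zero)    = onY _ (trans (noEdge (suc zero)) (sym (zeroˡ Y)))
        go false ≡.refl (suc (suc j)) = trans (+-congˡ (noEdge (suc (suc j)))) onZ
        go true  ≡.refl zero          = onY _ (trans (+-cong (zeroˡ Y) (+-cong (*-identityˡ Y) (sum-zero {M} (λ i → zeroˡ Z))))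
          (trans (+-identityˡ _) (trans (+-identityʳ Y) (sym one*Y))))
        go true  ≡.refl (suc zero)    = onY _ (trans (+-cong (*-identityˡ Y) (+-cong (zeroˡ Y) (sum-zero {M} (λ i → zeroˡ Z))))
          (trans (+-congˡ (+-identityˡ _)) (trans (+-identityʳ Y) (sym one*Y))))
        go true  ≡.refl (suc (suc j)) = trans (+-congˡ (+-cong (zeroˡ Y) (+-cong (zeroˡ Y) (sum-zero {M} (λ i → zeroˡ Z)))))
          (trans (+-congˡ (trans (+-identityˡ _) (+-identityˡ _))) onZ)

      eigen-equation : cubicˡ ≈ cubicʳ →
                       ∀ i → apply (extremal e k N) eigenvector i ≈ l * eigenvector i
      eigen-equation root i with split k N i
      ... | left i′ = trans (sum-↑ k {N} (λ j → χ (adj T (i′ ↑ˡ N) j) * eigenvector j))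
        (trans (+-cong
            (sum-cong-≋ {k} (λ j → *-cong (reflexive (≡.cong χ (join-ˡˡ (complete k) (extraEdge e N) i′ j))) (reflexive (eigenvector-ˡ j))))
            (sum-cong-≋ {N} (λ j → trans (*-cong (reflexive (≡.cong χ (join-ˡʳ (complete k) (extraEdge e N) i′ j))) (reflexive (eigenvector-ʳ j))) (*-identityˡ _))))
        (trans (+-cong (fromClique i′) fromIndependent)
        (trans (clique-equation root) (*-congˡ (reflexive (≡.sym (eigenvector-ˡ i′)))))))
        where T = extremal e k N
      ... | right i′ = trans (sum-↑ k {N} (λ j → χ (adj T (k ↑ʳ i′) j) * eigenvector j))
        (trans (+-cong
            (trans (sum-cong-≋ {k} (λ j → *-cong (reflexive (≡.cong χ (join-ʳˡ (complete k) (extraEdge e N) i′ j))) (reflexive (eigenvector-ˡ j))))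
                   (trans (sum-χ {k} (λ _ → true) X) (*-congʳ (reflexive (≡.cong ι (count-true k))))))
            (sum-cong-≋ {N} (λ j → *-cong (reflexive (≡.cong χ (join-ʳʳ (complete k) (extraEdge e N) i′ j))) (reflexive (eigenvector-ʳ j)))))
        (trans (extra-equation i′) (*-congˡ (reflexive (≡.sym (eigenvector-ʳ i′))))))
        where T = extremal e k N

    module _ (e : Bool) (k′ M : ℕ) {x y : Carrier} (x≈y : x ≈ y) where

      l-cong : l e k′ M x ≈ l e k′ M y
      l-cong = +-congʳ x≈y

      cubicˡ-cong : cubicˡ e k′ M x ≈ cubicˡ e k′ M y
      cubicˡ-cong = *-cong x≈y (*-cong l-cong l-cong)

      cubicʳ-cong : cubicʳ e k′ M x ≈ cubicʳ e k′ M y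
      cubicʳ-cong = +-cong (*-congˡ (*-cong l-cong x≈y)) (+-cong (*-congˡ l-cong) (*-congˡ x≈y))

-- A root of the cubic by bisection

module Root where

  open import Defs
  open Counting using (_⊕_; _⊛_; linear; by-slack; ⟦_⟧)
  open Real
  open Spectral using (module Subharmonic)
  open Extremal using (module Eigenvector)
  open import Data.Bool using (Bool; true; false)
  open import Data.Nat as ℕ using (ℕ; zero; suc; z≤n; s≤s)
  import Data.Nat.Properties as ℕₚ
  import Data.Nat.Tactic.RingSolver as ℕ-Solver
  open import Data.Integer as ℤ using (ℤ; +_; -[1+_])
  import Data.Integer.Properties as ℤₚ
  open import Data.Rational as ℚ using (ℚ; mkℚ; 0ℚ; 1ℚ; ½; ∣_∣)
  open import Data.Rational.Unnormalised as ℚᵘ using (mkℚᵘ; *<*; *≡*)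
  import Data.Rational.Unnormalised.Properties as ℚᵘₚ
  import Data.Rational.Properties as ℚₚ
  open import Data.Rational.Solver using (module +-*-Solver)
  open import Data.Product using (_×_; _,_; ∃-syntax; proj₁; proj₂)
  open import Data.Sum using (_⊎_; inj₁; inj₂)
  open import Relation.Binary.PropositionalEquality

  open Subharmonic ℝ-orderedRing using (ι)
  open Eigenvector ℝ-orderedRing using (cubicˡ; cubicʳ; cubicˡ-cong; cubicʳ-cong)

  fromℕ : ℕ → ℚ
  fromℕ zero    = 0ℚ
  fromℕ (suc n) = 1ℚ ℚ.+ fromℕ n

  seq-ι : ∀ m n → seq (ι m) n ≡ fromℕ m
  seq-ι zero    n = refl
  seq-ι (suc m) n = cong (1ℚ ℚ.+_) (seq-ι m n)

  fromℕ-+ : ∀ m n → fromℕ (m ℕ.+ n) ≡ fromℕ m ℚ.+ fromℕ n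
  fromℕ-+ zero    n = sym (ℚₚ.+-identityˡ (fromℕ n))
  fromℕ-+ (suc m) n = trans (cong (1ℚ ℚ.+_) (fromℕ-+ m n)) (sym (ℚₚ.+-assoc 1ℚ (fromℕ m) (fromℕ n)))

  fromℕ-* : ∀ m n → fromℕ (m ℕ.* n) ≡ fromℕ m ℚ.* fromℕ n
  fromℕ-* zero    n = sym (ℚₚ.*-zeroˡ (fromℕ n))
  fromℕ-* (suc m) n = trans (fromℕ-+ n (m ℕ.* n))
    (trans (cong₂ ℚ._+_ (sym (ℚₚ.*-identityˡ (fromℕ n))) (fromℕ-* m n)) (sym (ℚₚ.*-distribʳ-+ (fromℕ n) 1ℚ (fromℕ m))))

  0≤fromℕ : ∀ n → 0ℚ ℚ.≤ fromℕ n
  0≤fromℕ zero    = ℚₚ.≤-refl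
  0≤fromℕ (suc n) = ℚₚ.+-mono-≤ (ℚₚ.nonNegative⁻¹ 1ℚ) (0≤fromℕ n)

  fromℕ-mono : ∀ {m n} → m ℕ.≤ n → fromℕ m ℚ.≤ fromℕ n
  fromℕ-mono {n = n} z≤n     = 0≤fromℕ n
  fromℕ-mono         (s≤s p) = ℚₚ.+-monoʳ-≤ 1ℚ (fromℕ-mono p)

  toℚᵘ-fromℕ : ∀ n → ℚ.toℚᵘ (fromℕ n) ℚᵘ.≃ mkℚᵘ (+ n) 0
  toℚᵘ-fromℕ zero    = ℚᵘₚ.≃-refl
  toℚᵘ-fromℕ (suc n) = ℚᵘₚ.≃-trans (ℚₚ.toℚᵘ-homo-+ 1ℚ (fromℕ n))
    (ℚᵘₚ.≃-trans (ℚᵘₚ.+-congʳ (ℚ.toℚᵘ 1ℚ) (toℚᵘ-fromℕ n))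
      (*≡* (cong (ℤ._* + 1) (cong (λ t → + 1 ℤ.+ t) (ℤₚ.*-identityʳ (+ n))))))

  below-fromℕ : ∀ q → ∃[ N ] q ℚ.< fromℕ (suc N)
  below-fromℕ q@(mkℚ p d _) = ℤ.∣ p ∣ , ℚₚ.toℚᵘ-cancel-< (ℚᵘₚ.<-respʳ-≃ (ℚᵘₚ.≃-sym (toℚᵘ-fromℕ (suc ℤ.∣ p ∣)))
    (*<* (ℤₚ.≤-<-trans (ℤₚ.≤-reflexive (ℤₚ.*-identityʳ p))
      (ℤₚ.≤-<-trans (p≤∣p∣ p) (ℤ.+<+ (ℕₚ.<-≤-trans (ℕₚ.n<1+n ℤ.∣ p ∣) (ℕₚ.m≤m*n (suc ℤ.∣ p ∣) (suc d))))))))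
    where
    p≤∣p∣ : ∀ p → p ℤ.≤ + ℤ.∣ p ∣
    p≤∣p∣ (+ n)    = ℤₚ.≤-refl
    p≤∣p∣ -[1+ n ] = ℤ.-≤+

  archimedean : ∀ q ε → 0ℚ ℚ.< ε → ∃[ N ] q ℚ.< ε ℚ.* fromℕ (suc N)
  archimedean q ε 0<ε = N , ℚₚ.≤-<-trans (q≤∣q∣ q) (ℚₚ.<-trans ∣q∣<∣q∣+1
    (subst (ℚ._< ε ℚ.* fromℕ (suc N)) (proj₂ (proj₂ quotient)) (ℚₚ.*-monoʳ-<-pos ε {{ℚ.positive 0<ε}} (proj₂ (below-fromℕ r)))))
    where
    ∣q∣<∣q∣+1 : ∣ q ∣ ℚ.< ∣ q ∣ ℚ.+ 1ℚ
    ∣q∣<∣q∣+1 = subst (ℚ._< ∣ q ∣ ℚ.+ 1ℚ) (ℚₚ.+-identityʳ ∣ q ∣) (ℚₚ.+-monoʳ-< ∣ q ∣ (ℚₚ.positive⁻¹ 1ℚ))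
    quotient = divide ε (ℚ.positive 0<ε) (∣ q ∣ ℚ.+ 1ℚ) (ℚₚ.≤-<-trans (ℚₚ.0≤∣p∣ q) ∣q∣<∣q∣+1)
    r = proj₁ quotient
    N = proj₁ (below-fromℕ r)

  module Bisection (f g : ℚ → ℚ) where

    -- A sign change of f - g, with non-strict inequalities so that comparing two rationals at the
    -- midpoint always yields the next bracket.
    record Bracket : Set where
      constructor bracket
      field
        lo hi : ℚ
        lo≤hi : lo ℚ.≤ hi
        at-lo : f lo ℚ.≤ g lo
        at-hi : g hi ℚ.≤ f hi
    open Bracket public

    width : Bracket → ℚ
    width s = hi s ℚ.- lo s

    record _⊇_ (s t : Bracket) : Set where
      field
        lo-≤  : lo s ℚ.≤ lo t
        hi-≥  : hi t ℚ.≤ hi s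
    open _⊇_

    mid : Bracket → ℚ
    mid s = ½ ℚ.* (lo s ℚ.+ hi s)

    module _ where
      open +-*-Solver
      lo-double : ∀ a → ½ ℚ.* (a ℚ.+ a) ≡ a
      lo-double = solve 1 (λ a → con ½ :* (a :+ a) := a) refl
      upper-half : ∀ a b → b ℚ.- ½ ℚ.* (a ℚ.+ b) ≡ ½ ℚ.* (b ℚ.- a)
      upper-half = solve 2 (λ a b → b :- con ½ :* (a :+ b) := con ½ :* (b :- a)) refl
      lower-half : ∀ a b → ½ ℚ.* (a ℚ.+ b) ℚ.- a ≡ ½ ℚ.* (b ℚ.- a)
      lower-half = solve 2 (λ a b → con ½ :* (a :+ b) :- a := con ½ :* (b :- a)) refl
      half-≤ : ∀ w n → ½ ℚ.* w ℚ.* (1ℚ ℚ.+ (1ℚ ℚ.+ n)) ℚ.+ ½ ℚ.* (w ℚ.* n) ≡ w ℚ.* (1ℚ ℚ.+ n)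
      half-≤ = solve 2 (λ w n → con ½ :* w :* (con 1ℚ :+ (con 1ℚ :+ n)) :+ con ½ :* (w :* n) := w :* (con 1ℚ :+ n)) refl

    lo≤mid : ∀ s → lo s ℚ.≤ mid s
    lo≤mid s = subst (ℚ._≤ mid s) (lo-double (lo s)) (ℚₚ.*-monoˡ-≤-nonNeg ½ (ℚₚ.+-monoʳ-≤ (lo s) (lo≤hi s)))

    mid≤hi : ∀ s → mid s ℚ.≤ hi s
    mid≤hi s = subst (mid s ℚ.≤_) (lo-double (hi s)) (ℚₚ.*-monoˡ-≤-nonNeg ½ (ℚₚ.+-monoˡ-≤ (hi s) (lo≤hi s)))

    halve : ∀ s → f (mid s) ℚ.≤ g (mid s) ⊎ g (mid s) ℚ.≤ f (mid s) →
            ∃[ t ] s ⊇ t × width t ≡ ½ ℚ.* width s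
    halve s (inj₁ p) = bracket (mid s) (hi s) (mid≤hi s) p (at-hi s)
      , record { lo-≤ = lo≤mid s ; hi-≥ = ℚₚ.≤-refl } , upper-half (lo s) (hi s)
    halve s (inj₂ p) = bracket (lo s) (mid s) (lo≤mid s) (at-lo s) p
      , record { lo-≤ = ℚₚ.≤-refl ; hi-≥ = mid≤hi s } , lower-half (lo s) (hi s)

    step : ∀ s → ∃[ t ] s ⊇ t × width t ≡ ½ ℚ.* width s
    step s = halve s (ℚₚ.≤-total (f (mid s)) (g (mid s)))

    module _ (start : Bracket) where

      state : ℕ → Bracket
      state zero    = start
      state (suc n) = proj₁ (step (state n))

      nested : ∀ N d → state N ⊇ state (d ℕ.+ N)
      nested N zero    = record { lo-≤ = ℚₚ.≤-refl ; hi-≥ = ℚₚ.≤-refl }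
      nested N (suc d) = record
        { lo-≤ = ℚₚ.≤-trans (lo-≤ (nested N d)) (lo-≤ (proj₁ (proj₂ (step (state (d ℕ.+ N))))))
        ; hi-≥ = ℚₚ.≤-trans (hi-≥ (proj₁ (proj₂ (step (state (d ℕ.+ N)))))) (hi-≥ (nested N d)) }

      nested-≤ : ∀ {N n} → N ℕ.≤ n → state N ⊇ state n
      nested-≤ {N} {n} p = subst (λ m → state N ⊇ state m) (ℕₚ.m∸n+n≡m p) (nested N (n ℕ.∸ N))

      0≤width : ∀ s → 0ℚ ℚ.≤ width s
      0≤width s = subst (ℚ._≤ width s) (ℚₚ.+-inverseʳ (lo s)) (ℚₚ.+-monoˡ-≤ (ℚ.- lo s) (lo≤hi s))

      -- Halving beats the factor (n + 1) / (n + 2). Decay like 1 / (n + 1) suffices and matches the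
      -- linear form of `archimedean`.
      width-decay : ∀ n → width (state n) ℚ.* fromℕ (suc n) ℚ.≤ width start
      width-decay zero    = ℚₚ.≤-reflexive (ℚₚ.*-identityʳ (width start))
      width-decay (suc n) = ℚₚ.≤-trans (subst (λ w → w ℚ.* fromℕ (suc (suc n)) ℚ.≤ width (state n) ℚ.* fromℕ (suc n))
          (sym (proj₂ (proj₂ (step (state n))))) shrink) (width-decay n)
        where
        w = width (state n)
        0≤rest : 0ℚ ℚ.≤ ½ ℚ.* (w ℚ.* fromℕ n)
        0≤rest = subst (ℚ._≤ ½ ℚ.* (w ℚ.* fromℕ n)) (trans (cong (½ ℚ.*_) (ℚₚ.*-zeroʳ w)) (ℚₚ.*-zeroʳ ½))
          (ℚₚ.*-monoˡ-≤-nonNeg ½ (ℚₚ.*-monoˡ-≤-nonNeg w {{ℚ.nonNegative (0≤width (state n))}} (0≤fromℕ n)))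
        v = ½ ℚ.* w ℚ.* fromℕ (suc (suc n))
        shrink : ½ ℚ.* w ℚ.* fromℕ (suc (suc n)) ℚ.≤ w ℚ.* fromℕ (suc n)
        shrink = subst (½ ℚ.* w ℚ.* fromℕ (suc (suc n)) ℚ.≤_) (half-≤ w (fromℕ n))
          (subst (ℚ._≤ ½ ℚ.* w ℚ.* fromℕ (suc (suc n)) ℚ.+ ½ ℚ.* (w ℚ.* fromℕ n)) (ℚₚ.+-identityʳ v) (ℚₚ.+-monoʳ-≤ v 0≤rest))

      width-small : ∀ ε → 0ℚ ℚ.< ε → ∃[ N ] width (state N) ℚ.< ε
      width-small ε 0<ε = N , ℚₚ.≰⇒> λ ε≤w → ℚₚ.<-irrefl refl (ℚₚ.<-≤-trans (proj₂ (archimedean (width start) ε 0<ε))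
        (ℚₚ.≤-trans (ℚₚ.*-monoʳ-≤-nonNeg (fromℕ (suc N)) {{ℚ.nonNegative (0≤fromℕ (suc N))}} ε≤w) (width-decay N)))
        where N = proj₁ (archimedean (width start) ε 0<ε)

      close : ∀ {a b u v} → u ℚ.≤ a → a ℚ.≤ v → u ℚ.≤ b → b ℚ.≤ v → ∣ a ℚ.- b ∣ ℚ.≤ v ℚ.- u
      close {a} {b} {u} {v} u≤a a≤v u≤b b≤v = cases (ℚₚ.∣p∣≡p∨∣p∣≡-p (a ℚ.- b))
        where
        cases : ∣ a ℚ.- b ∣ ≡ a ℚ.- b ⊎ ∣ a ℚ.- b ∣ ≡ ℚ.- (a ℚ.- b) → ∣ a ℚ.- b ∣ ℚ.≤ v ℚ.- u
        cases (inj₁ eq) = subst (ℚ._≤ v ℚ.- u) (sym eq) (ℚₚ.+-mono-≤ a≤v (ℚₚ.neg-antimono-≤ u≤b))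
        cases (inj₂ eq) = subst (ℚ._≤ v ℚ.- u) (trans (flip-- a b) (sym eq)) (ℚₚ.+-mono-≤ b≤v (ℚₚ.neg-antimono-≤ u≤a))

      lower upper : ℝ
      lower = mkℝ (λ n → lo (state n)) λ ε 0<ε → let (N , small) = width-small ε 0<ε in N , λ m n p q →
        ℚₚ.≤-<-trans (close (lo-≤ (nested-≤ p)) (ℚₚ.≤-trans (lo≤hi (state m)) (hi-≥ (nested-≤ p)))
                            (lo-≤ (nested-≤ q)) (ℚₚ.≤-trans (lo≤hi (state n)) (hi-≥ (nested-≤ q)))) small
      upper = mkℝ (λ n → hi (state n)) λ ε 0<ε → let (N , small) = width-small ε 0<ε in N , λ m n p q →
        ℚₚ.≤-<-trans (close (ℚₚ.≤-trans (lo-≤ (nested-≤ p)) (lo≤hi (state m))) (hi-≥ (nested-≤ p))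
                            (ℚₚ.≤-trans (lo-≤ (nested-≤ q)) (lo≤hi (state n))) (hi-≥ (nested-≤ q))) small

      lower≃upper : lower ≃ upper
      lower≃upper ε 0<ε = let (N , small) = width-small ε 0<ε in N , λ n p →
        ℚₚ.≤-<-trans (close (lo-≤ (nested-≤ p)) (ℚₚ.≤-trans (lo≤hi (state n)) (hi-≥ (nested-≤ p)))
                            (ℚₚ.≤-trans (lo-≤ (nested-≤ p)) (lo≤hi (state n))) (hi-≥ (nested-≤ p))) small

      start≤lower : fromℚ (lo start) ≤ℝ lower
      start≤lower = ≤ℝ-pointwise {fromℚ (lo start)} {lower} (λ n → lo-≤ (nested-≤ {0} {n} z≤n))

      -- Continuity enters only as congruence: `lower` and `upper` are equal reals and F, G act term
      -- by term, so the inequalities at the two ends of the brackets combine to an equality.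
      root : (F G : ℝ → ℝ) → (∀ {x y} → x ≃ y → F x ≃ F y) → (∀ {x y} → x ≃ y → G x ≃ G y) →
             (∀ x n → seq (F x) n ≡ f (seq x n)) → (∀ x n → seq (G x) n ≡ g (seq x n)) → F lower ≃ G lower
      root F G F-cong G-cong F-seq G-seq = ≤ℝ-antisym {F lower} {G lower}
        (≤ℝ-pointwise {F lower} {G lower} (λ n → subst₂ ℚ._≤_ (sym (F-seq lower n)) (sym (G-seq lower n)) (at-lo (state n))))
        (≤ℝ-trans {G lower} {G upper} {F lower} (≃⇒≤ℝ {G lower} {G upper} (G-cong lower≃upper))
        (≤ℝ-trans {G upper} {F upper} {F lower}
          (≤ℝ-pointwise {G upper} {F upper} (λ n → subst₂ ℚ._≤_ (sym (G-seq upper n)) (sym (F-seq upper n)) (at-hi (state n))))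
          (≃⇒≤ℝ {F upper} {F lower} (≃-sym {F lower} {F upper} (F-cong lower≃upper)))))

  module _ (e : Bool) (k′ M : ℕ) where

    private
      fℕ gℕ : ℕ → ℕ → ℕ
      fℕ k x = x ℕ.* ((x ℕ.+ ⟦ e ⟧) ℕ.* (x ℕ.+ ⟦ e ⟧))
      gℕ k x = k′ ℕ.* ((x ℕ.+ ⟦ e ⟧) ℕ.* x) ℕ.+ (2 ℕ.* k ℕ.* (x ℕ.+ ⟦ e ⟧) ℕ.+ M ℕ.* k ℕ.* x)

      f g : ℕ → ℚ → ℚ
      f k q = q ℚ.* ((q ℚ.+ fromℕ ⟦ e ⟧) ℚ.* (q ℚ.+ fromℕ ⟦ e ⟧))
      g k q = fromℕ k′ ℚ.* ((q ℚ.+ fromℕ ⟦ e ⟧) ℚ.* q) ℚ.+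
        ((1ℚ ℚ.+ 1ℚ) ℚ.* fromℕ k ℚ.* (q ℚ.+ fromℕ ⟦ e ⟧) ℚ.+ fromℕ M ℚ.* fromℕ k ℚ.* q)

      f-fromℕ : ∀ k x → fromℕ (fℕ k x) ≡ f k (fromℕ x)
      f-fromℕ k x = trans (fromℕ-* x _) (cong (fromℕ x ℚ.*_) (trans (fromℕ-* (x ℕ.+ ⟦ e ⟧) _)
        (cong₂ ℚ._*_ (fromℕ-+ x ⟦ e ⟧) (fromℕ-+ x ⟦ e ⟧))))

      g-fromℕ : ∀ k x → fromℕ (gℕ k x) ≡ g k (fromℕ x)
      g-fromℕ k x = trans (fromℕ-+ (k′ ℕ.* ((x ℕ.+ ⟦ e ⟧) ℕ.* x)) _) (cong₂ ℚ._+_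
        (trans (fromℕ-* k′ _) (cong (fromℕ k′ ℚ.*_) (trans (fromℕ-* (x ℕ.+ ⟦ e ⟧) x) (cong (ℚ._* fromℕ x) (fromℕ-+ x ⟦ e ⟧)))))
        (trans (fromℕ-+ (2 ℕ.* k ℕ.* (x ℕ.+ ⟦ e ⟧)) _) (cong₂ ℚ._+_
          (trans (fromℕ-* (2 ℕ.* k) (x ℕ.+ ⟦ e ⟧)) (cong₂ ℚ._*_ (fromℕ-* 2 k) (fromℕ-+ x ⟦ e ⟧)))
          (trans (fromℕ-* (M ℕ.* k) x) (cong (ℚ._* fromℕ x) (fromℕ-* M k))))))

      cubicˡ-seq : ∀ δ n → seq (cubicˡ e k′ M δ) n ≡ f (suc k′) (seq δ n)
      cubicˡ-seq δ n = cong (λ t → seq δ n ℚ.* ((seq δ n ℚ.+ t) ℚ.* (seq δ n ℚ.+ t))) (seq-ι ⟦ e ⟧ n)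

      cubicʳ-seq : ∀ δ n → seq (cubicʳ e k′ M δ) n ≡ g (suc k′) (seq δ n)
      cubicʳ-seq δ n = cong₂ ℚ._+_
        (cong₂ ℚ._*_ (seq-ι k′ n) (cong (λ t → (seq δ n ℚ.+ t) ℚ.* seq δ n) (seq-ι ⟦ e ⟧ n)))
        (cong₂ ℚ._+_ (cong₂ (λ s t → (1ℚ ℚ.+ 1ℚ) ℚ.* s ℚ.* (seq δ n ℚ.+ t)) (seq-ι (suc k′) n) (seq-ι ⟦ e ⟧ n))
          (cong₂ (λ s t → s ℚ.* t ℚ.* seq δ n) (seq-ι M n) (seq-ι (suc k′) n)))

    bracketing : ∀ k h → k ℕ.≤ h → fℕ k k ℕ.≤ gℕ k k → gℕ k h ℕ.≤ fℕ k h → Bisection.Bracket (f k) (g k)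
    bracketing k h k≤h at-k at-h = Bisection.bracket (fromℕ k) (fromℕ h) (fromℕ-mono k≤h)
      (subst₂ ℚ._≤_ (f-fromℕ k k) (g-fromℕ k k) (fromℕ-mono at-k))
      (subst₂ ℚ._≤_ (g-fromℕ k h) (f-fromℕ k h) (fromℕ-mono at-h))

    module _ (s : Bisection.Bracket (f (suc k′)) (g (suc k′))) (lo≡ : fromℕ (suc k′) ≡ Bisection.lo s) where
      open Bisection (f (suc k′)) (g (suc k′))

      bisected : ∃[ δ ] ι (suc k′) ≤ℝ δ × cubicˡ e k′ M δ ≃ cubicʳ e k′ M δ
      bisected = lower s
        , ≤ℝ-trans {ι (suc k′)} {fromℚ (lo s)} {lower s}
            (≤ℝ-pointwise {ι (suc k′)} {fromℚ (lo s)} (λ n → ℚₚ.≤-reflexive (trans (seq-ι (suc k′) n) lo≡))) (start≤lower s)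
        , root s (cubicˡ e k′ M) (cubicʳ e k′ M)
            (λ {x} {y} → cubicˡ-cong e k′ M {x} {y}) (λ {x} {y} → cubicʳ-cong e k′ M {x} {y}) cubicˡ-seq cubicʳ-seq

  ⟦⟧-01 : ∀ b → ⟦ b ⟧ ≡ 0 ⊎ ⟦ b ⟧ ≡ 1
  ⟦⟧-01 false = inj₁ refl
  ⟦⟧-01 true  = inj₂ refl

  -- Moving the terms without M to the left leaves k (k + e) (e - 1), which is not positive since e
  -- ≤ 1.
  cubic-at-k : ∀ k k′ M e → k ≡ suc k′ → e ≡ 0 ⊎ e ≡ 1 →
    k ℕ.* ((k ℕ.+ e) ℕ.* (k ℕ.+ e)) ℕ.≤ k′ ℕ.* ((k ℕ.+ e) ℕ.* k) ℕ.+ (2 ℕ.* k ℕ.* (k ℕ.+ e) ℕ.+ M ℕ.* k ℕ.* k)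
  cubic-at-k k k′ M e k≡ e01 = linear (k ℕ.* ((k ℕ.+ e) ℕ.* (k ℕ.+ e))) _ _
      ((k ℕ.* (k ℕ.+ e)) ⊛ ℕₚ.≤-reflexive k≡ ⊕ (k ℕ.* (k ℕ.+ e)) ⊛ e≤1 e01) (lemma k k′ M e)
    where
    e≤1 : ∀ {e} → e ≡ 0 ⊎ e ≡ 1 → e ℕ.≤ 1
    e≤1 (inj₁ refl) = z≤n
    e≤1 (inj₂ refl) = s≤s z≤n
    lemma : ∀ k k′ M e → k ℕ.* ((k ℕ.+ e) ℕ.* (k ℕ.+ e)) ℕ.+ (k ℕ.* (k ℕ.+ e) ℕ.* suc k′ ℕ.+ k ℕ.* (k ℕ.+ e) ℕ.* 1) ℕ.+ M ℕ.* k ℕ.* k ≡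
      k′ ℕ.* ((k ℕ.+ e) ℕ.* k) ℕ.+ (2 ℕ.* k ℕ.* (k ℕ.+ e) ℕ.+ M ℕ.* k ℕ.* k) ℕ.+ (k ℕ.* (k ℕ.+ e) ℕ.* k ℕ.+ k ℕ.* (k ℕ.+ e) ℕ.* e)
    lemma = ℕ-Solver.solve-∀

  -- The upper end h is the order of the extremal graph; the slack read off from `expand` has no
  -- negative coefficients.
  cubic-at-h : ∀ k k′ M e h → k ≡ suc k′ → h ≡ M ℕ.+ 2 ℕ.+ k →
    k′ ℕ.* ((h ℕ.+ e) ℕ.* h) ℕ.+ (2 ℕ.* k ℕ.* (h ℕ.+ e) ℕ.+ M ℕ.* k ℕ.* h) ℕ.≤ h ℕ.* ((h ℕ.+ e) ℕ.* (h ℕ.+ e))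
  cubic-at-h k k′ M e h k≡ h≡ = by-slack _ (expand k h k≡ h≡)
    where
    lemma : ∀ k′ M e → (k′ ℕ.* ((M ℕ.+ 2 ℕ.+ suc k′ ℕ.+ e) ℕ.* (M ℕ.+ 2 ℕ.+ suc k′)) ℕ.+
        (2 ℕ.* suc k′ ℕ.* (M ℕ.+ 2 ℕ.+ suc k′ ℕ.+ e) ℕ.+ M ℕ.* suc k′ ℕ.* (M ℕ.+ 2 ℕ.+ suc k′)))
        ℕ.+ ((M ℕ.+ 2 ℕ.+ suc k′ ℕ.+ e) ℕ.* ((M ℕ.+ 2) ℕ.* (M ℕ.+ 2) ℕ.+ (M ℕ.+ 2 ℕ.+ suc k′) ℕ.* (1 ℕ.+ e)) ℕ.+ M ℕ.* suc k′ ℕ.* e) ≡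
      (M ℕ.+ 2 ℕ.+ suc k′) ℕ.* ((M ℕ.+ 2 ℕ.+ suc k′ ℕ.+ e) ℕ.* (M ℕ.+ 2 ℕ.+ suc k′ ℕ.+ e))
    lemma = ℕ-Solver.solve-∀
    expand : ∀ k h → k ≡ suc k′ → h ≡ M ℕ.+ 2 ℕ.+ k →
      (k′ ℕ.* ((h ℕ.+ e) ℕ.* h) ℕ.+ (2 ℕ.* k ℕ.* (h ℕ.+ e) ℕ.+ M ℕ.* k ℕ.* h))
      ℕ.+ ((h ℕ.+ e) ℕ.* ((M ℕ.+ 2) ℕ.* (M ℕ.+ 2) ℕ.+ h ℕ.* (1 ℕ.+ e)) ℕ.+ M ℕ.* k ℕ.* e) ≡
      h ℕ.* ((h ℕ.+ e) ℕ.* (h ℕ.+ e))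
    expand k h refl refl = lemma k′ M e

  abstract
    cubic-root : ∀ e k′ M → ∃[ δ ] ι (suc k′) ≤ℝ δ × cubicˡ e k′ M δ ≃ cubicʳ e k′ M δ
    cubic-root e k′ M = bisected e k′ M (bracketing e k′ M (suc k′) (M ℕ.+ 2 ℕ.+ suc k′) (ℕₚ.m≤n+m (suc k′) (M ℕ.+ 2))
      (cubic-at-k (suc k′) k′ M ⟦ e ⟧ refl (⟦⟧-01 e)) (cubic-at-h (suc k′) k′ M ⟦ e ⟧ (M ℕ.+ 2 ℕ.+ suc k′) refl refl)) refl

-- From spectral radii to walk counts and forced edges

module SpectralBound where

  open import Defs
  open Counting using (⟦_⟧)
  open Real
  open Spectral
  open Extremal
  open Root
  open import Data.Bool using (Bool; true; false; if_then_else_)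
  open import Data.Fin using (Fin; zero; suc; _↑ˡ_)
  open import Data.Nat as ℕ using (ℕ; zero; suc; z≤n; s≤s)
  import Data.Nat.Properties as ℕₚ
  open import Data.Rational as ℚ using (1ℚ)
  import Data.Rational.Properties as ℚₚ
  open import Data.Product using (_×_; _,_; ∃-syntax; proj₂)
  open import Data.Sum using (_⊎_; inj₁; inj₂)
  open import Data.Vec.Functional using (foldr)
  open import Function using (_↔_; Inverse; _∘_)
  open import Relation.Nullary using (¬_)
  open import Relation.Binary.PropositionalEquality as ≡ using (_≡_)

  -- A dominating vertex, through which a zero entry reaches every other entry.
  edge-to-first : ∀ e k′ N (i : Fin (suc k′ ℕ.+ N)) →
    adj (extremal e (suc k′) N) i (zero ↑ˡ N) ≡ true ⊎ i ≡ zero ↑ˡ N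
  edge-to-first e k′ N i with split (suc k′) N i
  ... | left zero     = inj₂ ≡.refl
  ... | left (suc i′) = inj₁ (join-ˡˡ (complete (suc k′)) (extraEdge e N) (suc i′) zero)
  ... | right j       = inj₁ (join-ʳˡ (complete (suc k′)) (extraEdge e N) j zero)

  pullback : ∀ {m n} → (Fin m → Fin n) → Graph n → Graph m
  pullback f H = record
    { adj    = λ i j → adj H (f i) (f j)
    ; symm   = λ i j → symm H (f i) (f j)
    ; irrefl = λ i → irrefl H (f i)
    }

  module Comparison (R : OrderedRing) where
    open OrderedRing R hiding (zero)
    open Subharmonic R
    open Eigenvector R
    open import Algebra.Properties.Semiring.Sum semiring using (sum-permute)
    open import Algebra.Properties.Group +-group using (∙-cancelˡ)
    open import Algebra.Solver.Ring.NaturalCoefficients.Default commutativeSemiring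
      using (solve; _:+_; _:*_; _:=_; con)

    module _ {n} (e : Bool) (k′ M : ℕ) (G : Graph n) (δ μ : Carrier) (v : Fin n → Carrier)
             (k≤δ : ι (suc k′) ≤ δ)
             (cubic : cubicˡ e k′ M δ ≈ cubicʳ e k′ M δ)
             (v≉0 : ¬ (∀ i → v i ≈ 0#)) (eigen : ∀ i → apply G v i ≈ μ * v i) (l≤μ : l e k′ M δ ≤ μ) where

      private
        k N : ℕ
        k = suc k′
        N = suc (suc M)
        T : Graph (k ℕ.+ N)
        T = extremal e k N
        l₀ ρ : Carrier
        l₀ = l e k′ M δ
        ρ = l₀ - ι k′
        w : Fin n → Carrier
        w = abs ∘ v
        0≤w : ∀ i → 0# ≤ w i
        0≤w i = 0≤abs (v i)
        1≤δ : 1# ≤ δ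
        1≤δ = ≤-trans (1≤ιk e k′ M δ) k≤δ
        l₀≈k′+ρ : l₀ ≈ ι k′ + ρ
        l₀≈k′+ρ = sym (trans (solve 3 (λ a b c → a :+ (b :+ c) := b :+ (a :+ c)) refl (ι k′) l₀ (- ι k′))
          (trans (+-congˡ (-‿inverseʳ (ι k′))) (+-identityʳ l₀)))
        0≤ρ : 0# ≤ ρ
        0≤ρ = 0# ≈⟨ sym (-‿inverseʳ (ι k′)) ⟩ ι k′ - ι k′ ≤⟨ +-mono-≤ k′≤l₀ ≤-refl ⟩ ρ ∎
          where
          k′≤l₀ : ι k′ ≤ l₀
          k′≤l₀ = ι k′ ≈⟨ sym (+-identityʳ (ι k′)) ⟩ ι k′ + 0#
            ≤⟨ +-mono-≤ (≤-trans (ι-mono (ℕₚ.n≤1+n k′)) k≤δ) (ι-nonneg ⟦ e ⟧) ⟩ l₀ ∎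
        -- The cubic with k′ l δ cancelled and l - k′ written as ρ.
        root : δ * (l₀ * ρ) ≈ (1# + 1#) * ι k * ι ⟦ e ⟧ + ι k * ι N * δ
        root = ∙-cancelˡ (ι k′ * (l₀ * δ)) _ _
          (trans (solve 4 (λ a l d r → a :* (l :* d) :+ d :* (l :* r) := d :* (l :* (a :+ r))) refl (ι k′) l₀ δ ρ)
          (trans (*-congˡ (*-congˡ (sym l₀≈k′+ρ)))
          (trans cubic (+-congˡ
            (solve 4 (λ k d e m → (con 1 :+ con 1) :* k :* (d :+ e) :+ m :* k :* d
               := (con 1 :+ con 1) :* k :* e :+ k :* (con 1 :+ (con 1 :+ m)) :* d) refl (ι k) δ (ι ⟦ e ⟧) (ι M))))))
        sub : ∀ i → l₀ * w i ≤ apply G w i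
        sub = abs-subharmonic G v l≤μ eigen

      not-all-≤0 : ¬ (∀ i → w i ≤ 0#)
      not-all-≤0 p = v≉0 (λ i → abs≤0 (p i))

      ⟦⟧-cases : ∀ b → ⟦ b ⟧ ≡ 0 ⊎ (⟦ b ⟧ ≡ 1 × 1 ℕ.≤ k)
      ⟦⟧-cases false = inj₁ ≡.refl
      ⟦⟧-cases true  = inj₂ (≡.refl , s≤s z≤n)

      walks-large : ¬ (∀ u → walks G u ℕ.+ (k ℕ.* k ℕ.+ 1) ℕ.≤ k′ ℕ.* degree G u ℕ.+ (k ℕ.* (k ℕ.+ N) ℕ.+ ⟦ e ⟧))
      walks-large small = not-all-≤0
        (vanishing G k k′ N ⟦ e ⟧ w δ ρ 0≤w 1≤δ 0≤ρ l₀ refl l₀≈k′+ρ root sub small (⟦⟧-cases e))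

      module _ (π : Fin n ↔ Fin (k ℕ.+ N))
               (G⊆T : ∀ i j → adj G i j ≡ true → adj T (Inverse.to π i) (Inverse.to π j) ≡ true) where

        private
          to = Inverse.to π
          from = Inverse.from π
          H : Graph n
          H = pullback to T
          u : Fin n → Carrier
          u = eigenvector e k′ M δ ∘ to
          eigen-H : ∀ i → apply H u i ≈ l₀ * u i
          eigen-H i = trans (sym (sum-permute (λ j → χ (adj T (to i) j) * eigenvector e k′ M δ j) π))
            (eigen-equation e k′ M δ cubic (to i))
          spread : ∀ i j → adj H i j ≡ true → w i ≤ 0# → w j ≤ 0#
          spread = zero-spreads G H u w l₀ 0≤w (λ i → 1≤eigenvector e k′ M δ 1≤δ (to i)) sub eigen-H G⊆T
          first : Fin n
          first = from (zero ↑ˡ N)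
          to-first : to first ≡ zero ↑ˡ N
          to-first = Inverse.strictlyInverseˡ π (zero ↑ˡ N)

        edge-first : ∀ i → adj H i first ≡ true ⊎ i ≡ first
        edge-first i rewrite to-first with edge-to-first e k′ N (to i)
        ... | inj₁ p = inj₁ p
        ... | inj₂ p = inj₂ (≡.trans (≡.sym (Inverse.strictlyInverseʳ π i)) (≡.cong from p))

        -- The missing edge kills `w i`; zeros spread from i to the dominating vertex and from there
        -- everywhere, against v being nonzero.
        no-missing : ∀ i j → adj G i j ≡ false → ¬ (adj T (to i) (to j) ≡ true)
        no-missing i j ¬g h = not-all-≤0 (λ t → all-≤0 t (edge-first t))
          where
          wᵢ≤0 : w i ≤ 0#
          wᵢ≤0 = missing⇒≤0 G H u w l₀ 0≤w (λ i → 1≤eigenvector e k′ M δ 1≤δ (to i)) sub eigen-H G⊆T i j ¬g h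
          first≤0 : w first ≤ 0#
          first≤0 with edge-first i
          ... | inj₁ p = spread i first p wᵢ≤0
          ... | inj₂ ≡.refl = wᵢ≤0
          all-≤0 : ∀ t → adj H t first ≡ true ⊎ t ≡ first → w t ≤ 0#
          all-≤0 t (inj₁ p) = spread first t (≡.trans (symm H first t) p) first≤0
          all-≤0 t (inj₂ ≡.refl) = first≤0

  -- Sealed, since unfolding the real operations would expose their Cauchy moduli.
  abstract
    𝓡 : OrderedRing
    𝓡 = ℝ-orderedRing

  module 𝓡 = OrderedRing 𝓡

  abstract
    to : ℝ → 𝓡.Carrier
    to x = x

    from : 𝓡.Carrier → ℝ
    from x = x

    to-from : ∀ x → to (from x) 𝓡.≈ x
    to-from x = OrderedRing.refl ℝ-orderedRing {x}

    to-cong : ∀ x y → x ≃ y → to x 𝓡.≈ to y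
    to-cong x y p = p

    to-injective : ∀ x y → to x 𝓡.≈ to y → x ≃ y
    to-injective x y p = p

    to-mono : ∀ x y → x ≤ℝ y → to x 𝓡.≤ to y
    to-mono x y p = p

    to-+ : ∀ x y → to (x +ℝ y) 𝓡.≈ to x 𝓡.+ to y
    to-+ x y = OrderedRing.refl ℝ-orderedRing {x +ℝ y}

    to-* : ∀ x y → to (x *ℝ y) 𝓡.≈ to x 𝓡.* to y
    to-* x y = OrderedRing.refl ℝ-orderedRing {x *ℝ y}

    to-0 : to 0ℝ 𝓡.≈ 𝓡.0#
    to-0 = OrderedRing.refl ℝ-orderedRing {0ℝ}

    to-1 : to 1ℝ 𝓡.≈ 𝓡.1#
    to-1 = OrderedRing.refl ℝ-orderedRing {1ℝ}

    1≰0 : ¬ 𝓡.1# 𝓡.≤ 𝓡.0#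
    1≰0 p = ℚₚ.<-irrefl ≡.refl (proj₂ (p 1ℚ (ℚₚ.positive⁻¹ 1ℚ)) _ ℕₚ.≤-refl)

  open Subharmonic 𝓡
  open Eigenvector 𝓡
  open Comparison 𝓡
  open import Algebra.Properties.Semiring.Sum 𝓡.semiring using (sum; sum-cong-≋)

  abstract
    cubic-root-𝓡 : ∀ e k′ M → ∃[ δ ] ι (suc k′) 𝓡.≤ δ × cubicˡ e k′ M δ 𝓡.≈ cubicʳ e k′ M δ
    cubic-root-𝓡 = cubic-root

  -- Carries the `foldr` in the matrix product over the concrete reals into a sum of the sealed
  -- ring.
  foldr-homo : ∀ {A : Set} (_⊕_ : A → A → A) (z : A) (h : A → 𝓡.Carrier) →
    (∀ x y → h (x ⊕ y) 𝓡.≈ h x 𝓡.+ h y) → h z 𝓡.≈ 𝓡.0# →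
    ∀ {n} (f : Fin n → A) → h (foldr _⊕_ z f) 𝓡.≈ sum (h ∘ f)
  foldr-homo _⊕_ z h h-⊕ h-z {zero}  f = h-z
  foldr-homo _⊕_ z h h-⊕ h-z {suc n} f = 𝓡.trans (h-⊕ (f zero) (foldr _⊕_ z (f ∘ suc)))
    (𝓡.+-congˡ (foldr-homo _⊕_ z h h-⊕ h-z (f ∘ suc)))

  to-χ : ∀ b → to (if b then 1ℝ else 0ℝ) 𝓡.≈ χ b
  to-χ true  = to-1
  to-χ false = to-0

  to-entry : ∀ {n} (G : Graph n) i j → to (adjacencyMatrix G i j) 𝓡.≈ χ (adj G i j)
  to-entry G i j = to-χ (adj G i j)

  to-dot : ∀ {n} (a v : Fin n → ℝ) {b : Fin n → 𝓡.Carrier} → (∀ j → to (a j) 𝓡.≈ b j) →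
    to (foldr _+ℝ_ 0ℝ (λ j → a j *ℝ v j)) 𝓡.≈ sum (λ j → b j 𝓡.* to (v j))
  to-dot {n} a v {b} a≈b = 𝓡.trans (foldr-homo _+ℝ_ 0ℝ to to-+ to-0 (λ j → a j *ℝ v j))
    (sum-cong-≋ {n} {λ j → to (a j *ℝ v j)} {λ j → b j 𝓡.* to (v j)}
      (λ j → 𝓡.trans (to-* (a j) (v j)) (𝓡.*-congʳ (a≈b j))))

  module _ {n} (A : Matrix n) (b : Fin n → Fin n → 𝓡.Carrier) (A≈b : ∀ i j → to (A i j) 𝓡.≈ b i j) where

    to-· : ∀ v i → to ((A · v) i) 𝓡.≈ sum (λ j → b i j 𝓡.* to (v j))
    to-· v i = to-dot (A i) v (A≈b i)

    to-eigenvalue : ∀ {m} → IsEigenvalue A m → ∃[ w ] ¬ (∀ i → w i 𝓡.≈ 𝓡.0#) ×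
      (∀ i → sum (λ j → b i j 𝓡.* w j) 𝓡.≈ to m 𝓡.* w i)
    to-eigenvalue {m} (v , v≄0 , eigen) = to ∘ v
      , (λ p → v≄0 (λ i → to-injective (v i) 0ℝ (𝓡.trans (p i) (𝓡.sym to-0))))
      , λ i → 𝓡.trans (𝓡.sym (to-· v i))
          (𝓡.trans (to-cong ((A · v) i) (m *ℝ v i) (eigen i)) (to-* m (v i)))

    from-eigenvalue : ∀ μ (u : Fin n → 𝓡.Carrier) → ¬ (∀ i → u i 𝓡.≈ 𝓡.0#) →
      (∀ i → sum (λ j → b i j 𝓡.* u j) 𝓡.≈ μ 𝓡.* u i) → IsEigenvalue A (from μ)
    from-eigenvalue μ u u≉0 eigen = build (from ∘ u) (from μ) (λ i → to-from (u i)) (to-from μ)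
      where
      build : ∀ v m → (∀ i → to (v i) 𝓡.≈ u i) → to m 𝓡.≈ μ → IsEigenvalue A m
      build v m v≈u m≈μ = v
        , (λ p → u≉0 (λ i → 𝓡.trans (𝓡.sym (v≈u i)) (𝓡.trans (to-cong (v i) 0ℝ (p i)) to-0)))
        , λ i → to-injective ((A · v) i) (m *ℝ v i)
            (𝓡.trans (to-· v i)
            (𝓡.trans (sum-cong-≋ {n} {λ j → b i j 𝓡.* to (v j)} {λ j → b i j 𝓡.* u j} (λ j → 𝓡.*-congˡ (v≈u j)))
            (𝓡.trans (eigen i) (𝓡.trans (𝓡.*-cong (𝓡.sym m≈μ) (𝓡.sym (v≈u i))) (𝓡.sym (to-* m (v i)))))))

  module _ (e : Bool) (k′ M : ℕ) (δ : 𝓡.Carrier) (k≤δ : ι (suc k′) 𝓡.≤ δ)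
           (cubic : cubicˡ e k′ M δ 𝓡.≈ cubicʳ e k′ M δ) where

    private
      u : Fin (suc k′ ℕ.+ suc (suc M)) → 𝓡.Carrier
      u = eigenvector e k′ M δ
      u≉0 : ¬ (∀ i → u i 𝓡.≈ 𝓡.0#)
      u≉0 p = 1≰0 (𝓡.≤-trans (1≤eigenvector e k′ M δ (𝓡.≤-trans (1≤ιk e k′ M δ) k≤δ) zero) (𝓡.≤-reflexive (p zero)))

    root-isEigenvalue : IsEigenvalue (adjacencyMatrix (extremal e (suc k′) (suc (suc M)))) (from (l e k′ M δ))
    root-isEigenvalue = from-eigenvalue (adjacencyMatrix T) (λ i j → χ (adj T i j)) (to-entry T)
      (l e k′ M δ) u u≉0 (eigen-equation e k′ M δ cubic)
      where
      T : Graph (suc k′ ℕ.+ suc (suc M))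
      T = extremal e (suc k′) (suc (suc M))

    -- The root is only known to be some eigenvalue of the extremal graph; the maximality contained
    -- in `IsSpectralRadius` puts it below μT.
    root≤ : ∀ {μT μG} → IsSpectralRadius (extremal e (suc k′) (suc (suc M))) μT → μT ≤ℝ μG → l e k′ M δ 𝓡.≤ to μG
    root≤ {μT} {μG} (_ , largest) μT≤μG = 𝓡.≤-trans (𝓡.≤-reflexive (𝓡.sym (to-from (l e k′ M δ))))
      (𝓡.≤-trans (to-mono (from (l e k′ M δ)) μT (largest (from (l e k′ M δ)) root-isEigenvalue)) (to-mono μT μG μT≤μG))

  module _ {n} (e : Bool) (k′ M : ℕ) (G : Graph n) {μG μT : ℝ} (radiusG : IsSpectralRadius G μG)
           (radiusT : IsSpectralRadius (extremal e (suc k′) (suc (suc M))) μT) (μT≤μG : μT ≤ℝ μG) where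

    private
      isEigenvalue : ∀ {μ} → IsSpectralRadius G μ → IsEigenvalue (adjacencyMatrix G) μ
      isEigenvalue (p , _) = p
      Eigenvector-G : Set
      Eigenvector-G = ∃[ w ] ¬ (∀ i → w i 𝓡.≈ 𝓡.0#) × (∀ i → apply G w i 𝓡.≈ to μG 𝓡.* w i)
      eigenvector-G : Eigenvector-G
      eigenvector-G = to-eigenvalue (adjacencyMatrix G) (λ i j → χ (adj G i j)) (to-entry G) {μG} (isEigenvalue {μG} radiusG)

    not-all-walks-small : ¬ (∀ u → walks G u ℕ.+ (suc k′ ℕ.* suc k′ ℕ.+ 1) ℕ.≤
                            k′ ℕ.* degree G u ℕ.+ (suc k′ ℕ.* (suc k′ ℕ.+ suc (suc M)) ℕ.+ ⟦ e ⟧))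
    not-all-walks-small = conclude (cubic-root-𝓡 e k′ M) eigenvector-G
      where
      conclude : ∃[ δ ] ι (suc k′) 𝓡.≤ δ × cubicˡ e k′ M δ 𝓡.≈ cubicʳ e k′ M δ → Eigenvector-G → _
      conclude (δ , k≤δ , cubic) (w , w≉0 , eigen) = walks-large e k′ M G δ (to μG) w k≤δ cubic w≉0 eigen
          (root≤ e k′ M δ k≤δ cubic {μT} {μG} radiusT μT≤μG)

    no-missing-edge : (π : Fin n ↔ Fin (suc k′ ℕ.+ suc (suc M))) →
      (∀ i j → adj G i j ≡ true → adj (extremal e (suc k′) (suc (suc M))) (Inverse.to π i) (Inverse.to π j) ≡ true) →
      ∀ i j → adj G i j ≡ false → ¬ (adj (extremal e (suc k′) (suc (suc M))) (Inverse.to π i) (Inverse.to π j) ≡ true)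
    no-missing-edge π G⊆T = conclude (cubic-root-𝓡 e k′ M) eigenvector-G
      where
      conclude : ∃[ δ ] ι (suc k′) 𝓡.≤ δ × cubicˡ e k′ M δ 𝓡.≈ cubicʳ e k′ M δ → Eigenvector-G → _
      conclude (δ , k≤δ , cubic) (w , w≉0 , eigen) = no-missing e k′ M G δ (to μG) w k≤δ cubic w≉0 eigen
          (root≤ e k′ M δ k≤δ cubic {μT} {μG} radiusT μT≤μG) π G⊆T

open import Defs
open Counting
open import Data.Bool using (Bool; true; false; not; _∧_; _∨_; T)
import Data.Bool as Bool
open import Data.Empty using (⊥; ⊥-elim)
open import Data.Fin using (Fin; zero; suc; _≟_; toℕ; inject≤)
open import Data.List using (List; []; _∷_; _++_; length; filterᵇ; filter; allFin; _ʳ++_; reverse; lookup)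
open import Data.List.Membership.Propositional using (_∈_; _∉_; find; lose)
open import Data.List.Membership.Propositional.Properties using (∈-filter⁺; ∈-filter⁻; ∈-allFin; ∈-++⁺ˡ; ∈-++⁺ʳ; ∈-++⁻; ∈-∃++; ∈-lookup)
import Data.List.Membership.DecPropositional as DecMembership
open import Data.List.Relation.Unary.All using (All; []; _∷_)
import Data.List.Relation.Unary.All as All
open import Data.List.Relation.Unary.Any using (here; there; Any; any?; index)
open import Data.List.Relation.Unary.AllPairs using ([]; _∷_)
open import Data.List.Relation.Unary.Unique.Propositional using (Unique)
import Data.List.Relation.Unary.Unique.Propositional.Properties as Uniqueₚ
open import Data.Nat hiding (_≟_)
open import Data.Nat.Properties hiding (_≟_)
open import Data.Product using (_×_; _,_; ∃-syntax; proj₁; proj₂; Σ)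
open import Data.Sum using (_⊎_; inj₁; inj₂; [_,_]′)
open import Function using (_∘_; _|>_; _↔_; mk↔ₛ′; Inverse)
open import Relation.Nullary using (¬_; Dec; yes; no; does)
open import Relation.Nullary.Negation using (contradiction)
open import Relation.Nullary.Decidable using (dec-true; dec-false; map′; decidable-stable; ¬?; _×-dec_; _→-dec_)
open import Relation.Binary.PropositionalEquality
open import Data.List.Properties using (++-assoc; length-++; reverse-++; unfold-reverse; length-reverse; ++-ʳ++; ʳ++-defn)
open import Data.List.Relation.Binary.Permutation.Propositional using (_↭_; ↭-refl; ↭-sym; ↭-trans; prep; swap; ↭⇒↭ₛ; ↭-reflexive)
open import Data.List.Relation.Binary.Permutation.Propositional.Properties using (∈-resp-↭; ↭-length; shift; ++↭ʳ++; ++⁺ˡ; shifts; ++-comm)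
import Data.List.Relation.Binary.Permutation.Setoid.Properties as PermSetoid
open import Data.List.Relation.Unary.Linked using (Linked; []; [-]; _∷_)
open import Data.Nat.Tactic.RingSolver using (solve-∀)
open Spectral using (degree; walks)
open Extremal using (extraEdge; extremal; join-ˡˡ; join-ˡʳ; join-ʳˡ; join-ʳʳ)
open SpectralBound using (not-all-walks-small; no-missing-edge)
import Data.Bool.Properties as Boolₚ
import Data.Fin.Properties as Finₚ
open import Data.List.Relation.Unary.Any.Properties using (lookup-index)
open import Data.Vec as Vec using (Vec; []; _∷_)
import Data.Vec.Properties as Vecₚ
open import Function.Construct.Composition using (_↔-∘_)
open import Function.Construct.Symmetry using (↔-sym)

-- Subsets of Fin n

∧-true : ∀ {a b} → a ∧ b ≡ true → a ≡ true × b ≡ true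
∧-true {true} {true} _ = refl , refl

∧-intro : ∀ {a b} → a ≡ true → b ≡ true → a ∧ b ≡ true
∧-intro refl refl = refl

not-true : ∀ {a} → not a ≡ true → a ≡ false
not-true {false} _ = refl

not-intro : ∀ {a} → a ≡ false → not a ≡ true
not-intro refl = refl

true≢false : ∀ {a} → a ≡ true → a ≡ false → ⊥
true≢false refl ()

does-true : ∀ {P : Set} (d : Dec P) → does d ≡ true → P
does-true (yes p) _ = p

does-false : ∀ {P : Set} (d : Dec P) → does d ≡ false → ¬ P
does-false (no ¬p) _ = ¬p

bool-cases : ∀ b → b ≡ true ⊎ b ≡ false
bool-cases true  = inj₁ refl
bool-cases false = inj₂ refl

⟦⟧≤1 : ∀ b → ⟦ b ⟧ ≤ 1
⟦⟧≤1 true  = s≤s z≤n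
⟦⟧≤1 false = z≤n

⟦∧⟧ : ∀ a b → ⟦ a ∧ b ⟧ ≡ ⟦ a ⟧ * ⟦ b ⟧
⟦∧⟧ true  b = sym (+-identityʳ ⟦ b ⟧)
⟦∧⟧ false b = refl

∑-mono : ∀ {n} {f g : Fin n → ℕ} → (∀ i → f i ≤ g i) → ∑ f ≤ ∑ g
∑-mono {zero}  p = z≤n
∑-mono {suc n} p = p zero ⊕ ∑-mono (p ∘ suc)

∑-zero : ∀ {n} {f : Fin n → ℕ} → (∀ i → f i ≡ 0) → ∑ f ≡ 0
∑-zero {zero}  p = refl
∑-zero {suc n} p = cong₂ _+_ (p zero) (∑-zero (p ∘ suc))

Subset : ℕ → Set
Subset n = Fin n → Bool

module _ {n : ℕ} where

  open DecMembership (_≟_ {n}) public using (_∈?_)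

  infixl 7 _∩_
  infixl 6 _∖_
  _∩_ _∖_ : Subset n → Subset n → Subset n
  (p ∩ q) v = p v ∧ q v
  (p ∖ q) v = p v ∧ not (q v)

  ⁅_⁆ : Fin n → Subset n
  ⁅ x ⁆ v = does (v ≟ x)

  members : List (Fin n) → Subset n
  members l v = does (v ∈? l)

  ∈⇒members : ∀ {l v} → v ∈ l → members l v ≡ true
  ∈⇒members {l} {v} v∈l = dec-true (v ∈? l) v∈l

  ∉⇒members : ∀ {l v} → v ∉ l → members l v ≡ false
  ∉⇒members {l} {v} v∉l = dec-false (v ∈? l) v∉l

  members⇒∈ : ∀ {l v} → members l v ≡ true → v ∈ l
  members⇒∈ {l} {v} = does-true (v ∈? l)

  members⇒∉ : ∀ {l v} → members l v ≡ false → v ∉ l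
  members⇒∉ {l} {v} = does-false (v ∈? l)

count-mono : ∀ {n} {p q : Subset n} → (∀ v → p v ≡ true → q v ≡ true) → count p ≤ count q
count-mono {p = p} {q} imp = ∑-mono (λ v → ind (p v) (q v) (imp v))
  where
  ind : ∀ a b → (a ≡ true → b ≡ true) → ⟦ a ⟧ ≤ ⟦ b ⟧
  ind true  b h rewrite h refl = ≤-refl
  ind false b h = z≤n

count-split : ∀ {n} (p q : Subset n) → count p ≡ count (p ∩ q) + count (p ∖ q)
count-split p q = trans (∑-cong (λ v → split (p v) (q v))) (∑-+ (λ v → ⟦ p v ∧ q v ⟧) (λ v → ⟦ p v ∧ not (q v) ⟧))
  where
  split : ∀ a b → ⟦ a ⟧ ≡ ⟦ a ∧ b ⟧ + ⟦ a ∧ not b ⟧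
  split true  true  = refl
  split true  false = refl
  split false b     = refl

count-⁅⁆ : ∀ {n} (x : Fin n) → count ⁅ x ⁆ ≡ 1
count-⁅⁆ {suc n} zero = cong suc (∑-zero {n} (λ _ → refl))
count-⁅⁆ (suc x)      = count-⁅⁆ x

count-∩-⁅⁆ : ∀ {n} (p : Subset n) x → count (p ∩ ⁅ x ⁆) ≡ ⟦ p x ⟧
count-∩-⁅⁆ p x with p x in eq
... | true  = ≤-antisym (≤-trans (count-mono {p = p ∩ ⁅ x ⁆} (λ v → proj₂ ∘ ∧-true)) (≤-reflexive (count-⁅⁆ x)))
  (≤-trans (≤-reflexive (sym (count-⁅⁆ x))) (count-mono {q = p ∩ ⁅ x ⁆} (λ v h → ∧-intro (subst (λ t → p t ≡ true) (sym (does-true (v ≟ x) h)) eq) h)))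
... | false = ∑-zero (λ v → empty v)
  where
  empty : ∀ v → ⟦ p v ∧ does (v ≟ x) ⟧ ≡ 0
  empty v with v ≟ x
  ... | yes refl rewrite eq = refl
  ... | no _ with p v
  ... | true  = refl
  ... | false = refl

count-remove : ∀ {n} (p : Subset n) x → count p ≡ ⟦ p x ⟧ + count (p ∖ ⁅ x ⁆)
count-remove p x = trans (count-split p ⁅ x ⁆) (cong (_+ count (p ∖ ⁅ x ⁆)) (count-∩-⁅⁆ p x))

count-cover : ∀ {n} (p : Subset n) l → (∀ v → p v ≡ true → v ∈ l) → count p ≤ length l
count-cover p []       cover = ≤-reflexive (∑-zero (λ v → none v (p v) refl))
  where
  none : ∀ v b → p v ≡ b → ⟦ b ⟧ ≡ 0
  none v true  eq with () ← cover v eq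
  none v false eq = refl
count-cover p (x ∷ l) cover = ≤-trans (≤-reflexive (count-remove p x))
  (⟦⟧≤1 (p x) ⊕ count-cover (p ∖ ⁅ x ⁆) l rest)
  where
  rest : ∀ v → (p ∖ ⁅ x ⁆) v ≡ true → v ∈ l
  rest v h with cover v (proj₁ (∧-true h))
  ... | here v≡x = contradiction v≡x (does-false (v ≟ x) (not-true (proj₂ (∧-true h))))
  ... | there v∈l = v∈l

unique⇒length≤count : ∀ {n} (p : Subset n) {l} → Unique l → (∀ {v} → v ∈ l → p v ≡ true) → length l ≤ count p
unique⇒length≤count p {[]}    _ _ = z≤n
unique⇒length≤count p {x ∷ l} (x∉l ∷ uniq) sub = ≤-trans
  (s≤s (unique⇒length≤count (p ∖ ⁅ x ⁆) uniq (λ {v} v∈l →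
    ∧-intro (sub (there v∈l)) (not-intro (dec-false (v ≟ x) (λ v≡x → All.lookup x∉l v∈l (sym v≡x)))))))
  (≤-reflexive (sym (trans (count-remove p x) (cong (λ b → ⟦ b ⟧ + count (p ∖ ⁅ x ⁆)) (sub (here refl))))))

count-full : ∀ n → count {n} (λ _ → true) ≡ n
count-full zero    = refl
count-full (suc n) = cong suc (count-full n)

count-positive : ∀ {n} (p : Subset n) → 1 ≤ count p → ∃[ v ] p v ≡ true
count-positive {suc n} p h with p zero in eq
... | true  = zero , eq
... | false with v , pv ← count-positive (p ∘ suc) h = suc v , pv

count-zero : ∀ {n} (p : Subset n) → count p ≡ 0 → ∀ v → p v ≡ false
count-zero p none v with bool-cases (p v)
... | inj₂ eq = eq
... | inj₁ eq = contradiction (trans (sym none) (trans (count-remove p v) (cong (λ b → ⟦ b ⟧ + count (p ∖ ⁅ v ⁆)) eq))) λ ()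

elements : ∀ {n} → Subset n → List (Fin n)
elements {n} p = filter (λ v → p v Bool.≟ true) (allFin n)

∈-elements⁺ : ∀ {n} (p : Subset n) {v} → p v ≡ true → v ∈ elements p
∈-elements⁺ p {v} = ∈-filter⁺ (λ v → p v Bool.≟ true) (∈-allFin v)

∈-elements⁻ : ∀ {n} (p : Subset n) {v} → v ∈ elements p → p v ≡ true
∈-elements⁻ {n} p v∈ = proj₂ (∈-filter⁻ (λ v → p v Bool.≟ true) {xs = allFin n} v∈)

elements-unique : ∀ {n} (p : Subset n) → Unique (elements p)
elements-unique {n} p = Uniqueₚ.filter⁺ (λ v → p v Bool.≟ true) (Uniqueₚ.allFin⁺ n)

count≤elements : ∀ {n} (p : Subset n) → count p ≤ length (elements p)
count≤elements p = count-cover p (elements p) (λ v → ∈-elements⁺ p)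

-- Each element of l splits p into two sides, and the larger side is kept.
agreeing-subset : ∀ {n} {A : Set} (r : Fin n → A → Bool) (l : List A) (p : Subset n) c →
  2 ^ length l * c < count p →
  ∃[ q ] c < count q × (∀ v → q v ≡ true → p v ≡ true) ×
    (∀ u v a → q u ≡ true → q v ≡ true → a ∈ l → r u a ≡ r v a)
agreeing-subset r []      p c c<p = p , subst (_< count p) (+-identityʳ c) c<p , (λ _ h → h) , λ u v a _ _ ()
agreeing-subset {n} r (x ∷ l) p c big = choose (2 ^ length l * c <? count (p ∩ side)) (2 ^ length l * c <? count (p ∖ side))
  where
  side : Subset n
  side v = r v x
  Result : Set
  Result = ∃[ q ] c < count q × (∀ v → q v ≡ true → p v ≡ true) ×
    (∀ u v a → q u ≡ true → q v ≡ true → a ∈ x ∷ l → r u a ≡ r v a)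
  extend : ∀ (s : Subset n) → (∀ v → s v ≡ true → p v ≡ true) → (∀ u v → s u ≡ true → s v ≡ true → r u x ≡ r v x) →
           2 ^ length l * c < count s → Result
  extend s s⊆p agree big′ with agreeing-subset r l s c big′
  ... | q , c<q , q⊆s , same = q , c<q , (λ v h → s⊆p v (q⊆s v h)) , λ where
    u v a qu qv (here refl) → agree u v (q⊆s u qu) (q⊆s v qv)
    u v a qu qv (there a∈l) → same u v a qu qv a∈l
  choose : Dec _ → Dec _ → Result
  choose (yes h) _ = extend (p ∩ side) (λ v → proj₁ ∘ ∧-true)
    (λ u v hu hv → trans (proj₂ (∧-true hu)) (sym (proj₂ (∧-true hv)))) h
  choose (no _) (yes h) = extend (p ∖ side) (λ v → proj₁ ∘ ∧-true)
    (λ u v hu hv → trans (not-true (proj₂ (∧-true hu))) (sym (not-true (proj₂ (∧-true hv))))) h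
  choose (no ¬a) (no ¬b) = contradiction big (≤⇒≯ (≤-trans (≤-reflexive (count-split p side))
    (≤-trans (≮⇒≥ ¬a ⊕ ≮⇒≥ ¬b) (≤-reflexive (sym (trans (*-assoc 2 (2 ^ length l) c)
      (cong (2 ^ length l * c +_) (+-identityʳ (2 ^ length l * c)))))))))

module _ {A : Set} (q : A → Bool) where

  NoAdjacent : List A → Set
  NoAdjacent xs = ∀ pre v v′ post → xs ≡ pre ++ v ∷ v′ ∷ post → q v ≡ true → q v′ ≡ true → ⊥

  After Before : ℕ → List A → Set
  After  s xs = ∀ pre v post → xs ≡ pre ++ v ∷ post → q v ≡ true → s ≤ length post
  Before r xs = ∀ pre v post → xs ≡ pre ++ v ∷ post → q v ≡ true → r ≤ length pre

  marks : List A → ℕ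
  marks xs = length (filterᵇ q xs)

  marks-after : ∀ s xs → NoAdjacent xs → After s xs → marks xs ≡ 0 ⊎ 2 * marks xs + s ≤ suc (length xs)
  marks-after s []       _  _  = inj₁ refl
  marks-after s (x ∷ xs) na af with q x in qx
  marks-after s (x ∷ xs) na af | false
    with marks-after s xs (λ pre v v′ post eq → na (x ∷ pre) v v′ post (cong (x ∷_) eq))
                          (λ pre v post eq → af (x ∷ pre) v post (cong (x ∷_) eq))
  ... | inj₁ none = inj₁ none
  ... | inj₂ le   = inj₂ (m≤n⇒m≤1+n le)
  marks-after s (x ∷ []) na af | true = inj₂ (+-monoʳ-≤ 2 (af [] x [] refl qx))
  -- A mark and its unmarked successor are dropped together, whence the factor 2.
  marks-after s (x ∷ y ∷ xs) na af | true with q y in qy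
  ... | true  = contradiction qy (λ h → na [] x y xs refl qx h)
  ... | false
    with marks-after s xs (λ pre v v′ post eq → na (x ∷ y ∷ pre) v v′ post (cong (λ l → x ∷ y ∷ l) eq))
                          (λ pre v post eq → af (x ∷ y ∷ pre) v post (cong (λ l → x ∷ y ∷ l) eq))
  ... | inj₁ none rewrite none = inj₂ (+-monoʳ-≤ 2 (af [] x (y ∷ xs) refl qx))
  ... | inj₂ le = inj₂ (subst (_≤ suc (suc (suc (length xs))))
      (cong (_+ s) (sym (*-suc 2 (marks xs)))) (s≤s (s≤s le)))

  -- If there are m marks and m > 0, they span at least 2 m - 1 positions as no two are adjacent,
  -- with r positions before the first and s after the last.
  marks-bound : ∀ r s xs → NoAdjacent xs → Before r xs → After s xs →
                marks xs ≡ 0 ⊎ 2 * marks xs + s + r ≤ suc (length xs)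
  marks-bound zero s xs na be af with marks-after s xs na af
  ... | inj₁ none = inj₁ none
  ... | inj₂ le   = inj₂ (≤-trans (≤-reflexive (+-identityʳ _)) le)
  marks-bound (suc r) s []       _  _  _  = inj₁ refl
  marks-bound (suc r) s (x ∷ xs) na be af with q x in qx
  ... | true  = contradiction (be [] x xs refl qx) λ ()
  ... | false
    with marks-bound r s xs (λ pre v v′ post eq → na (x ∷ pre) v v′ post (cong (x ∷_) eq))
      (λ pre v post eq h → s≤s⁻¹ (be (x ∷ pre) v post (cong (x ∷_) eq) h))
      (λ pre v post eq → af (x ∷ pre) v post (cong (x ∷_) eq))
  ... | inj₁ none = inj₁ none
  ... | inj₂ le   = inj₂ (≤-trans (≤-reflexive (+-suc _ r)) (s≤s le))

module _ {A : Set} (Q : A → Set) (μ : A → ℕ) where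

  -- Since Q need not be decidable, a maximal element cannot be exhibited, but it may be assumed
  -- when refuting: each larger element uses up one unit of the room below b.
  maximal : ∀ b → (∀ a → Q a → μ a ≤ b) → (∀ a → Q a → (∀ a′ → Q a′ → μ a′ ≤ μ a) → ⊥) → ∀ a → Q a → ⊥
  maximal b bounded handle a₀ qa₀ = climb b a₀ qa₀ (m≤n+m b (μ a₀))
    where
    climb : ∀ fuel a → Q a → b ≤ μ a + fuel → ⊥
    climb zero a qa le = handle a qa (λ a′ qa′ → ≤-trans (bounded a′ qa′) (≤-trans le (≤-reflexive (+-identityʳ (μ a)))))
    climb (suc fuel) a qa le = handle a qa λ a′ qa′ → ≮⇒≥ λ μa<μa′ → climb fuel a′ qa′
      (≤-trans le (≤-trans (≤-reflexive (+-suc (μ a) fuel)) (+-monoˡ-≤ fuel μa<μa′)))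

  minimal : (∀ a → Q a → (∀ a′ → Q a′ → μ a′ < μ a → ⊥) → ⊥) → ∀ a → Q a → ⊥
  minimal handle a qa = descend (suc (μ a)) a qa ≤-refl
    where
    descend : ∀ fuel a → Q a → μ a < fuel → ⊥
    descend (suc fuel) a qa (s≤s le) = handle a qa (λ a′ qa′ lt → descend fuel a′ qa′ (<-≤-trans lt le))

-- Paths and longest paths

module _ {A : Set} where

  unique-resp-↭ : ∀ {xs ys : List A} → xs ↭ ys → Unique xs → Unique ys
  unique-resp-↭ p = PermSetoid.Unique-resp-↭ (setoid A) (↭⇒↭ₛ p)

  unique-∷ : ∀ {x : A} {xs} → x ∉ xs → Unique xs → Unique (x ∷ xs)
  unique-∷ {x} {xs} x∉xs uniq = All.tabulate (λ {y} y∈xs x≡y → x∉xs (subst (_∈ xs) (sym x≡y) y∈xs)) ∷ uniq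

  unique⇒∉ : ∀ {x : A} {xs} → Unique (x ∷ xs) → x ∉ xs
  unique⇒∉ (x∉ ∷ _) x∈ = All.lookup x∉ x∈ refl

  unique-tail : ∀ {x : A} {xs} → Unique (x ∷ xs) → Unique xs
  unique-tail (_ ∷ uniq) = uniq

  unique-++ʳ : ∀ (xs : List A) {ys} → Unique (xs ++ ys) → Unique ys
  unique-++ʳ []       uniq       = uniq
  unique-++ʳ (x ∷ xs) (_ ∷ uniq) = unique-++ʳ xs uniq

module _ {A : Set} {R : A → A → Set} where

  linked-tail : ∀ {x xs} → Linked R (x ∷ xs) → Linked R xs
  linked-tail [-]       = []
  linked-tail (_ ∷ lxs) = lxs

  linked-++ʳ : ∀ xs {ys} → Linked R (xs ++ ys) → Linked R ys
  linked-++ʳ []       l = l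
  linked-++ʳ (x ∷ xs) l = linked-++ʳ xs (linked-tail l)

  linked-prefix : ∀ xs y {ys} → Linked R (xs ++ y ∷ ys) → Linked R (xs ++ y ∷ [])
  linked-prefix []            y l       = [-]
  linked-prefix (x ∷ [])      y (r ∷ l) = r ∷ [-]
  linked-prefix (x ∷ x′ ∷ xs) y (r ∷ l) = r ∷ linked-prefix (x′ ∷ xs) y l

  linked-init : ∀ xs {y} → Linked R (xs ++ y ∷ []) → Linked R xs
  linked-init []            _       = []
  linked-init (x ∷ [])      _       = [-]
  linked-init (x ∷ x′ ∷ xs) (r ∷ l) = r ∷ linked-init (x′ ∷ xs) l

  linked-join : ∀ xs y {ys} → Linked R (xs ++ y ∷ []) → Linked R (y ∷ ys) → Linked R (xs ++ y ∷ ys)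
  linked-join []            y _       l = l
  linked-join (x ∷ [])      y (r ∷ _) l = r ∷ l
  linked-join (x ∷ x′ ∷ xs) y (r ∷ k) l = r ∷ linked-join (x′ ∷ xs) y k l

  linked-ʳ++ : (∀ {x y} → R x y → R y x) → ∀ x xs {ys} →
               Linked R (x ∷ xs) → Linked R (x ∷ ys) → Linked R (xs ʳ++ x ∷ ys)
  linked-ʳ++ R-sym x []       _       l = l
  linked-ʳ++ R-sym x (y ∷ xs) (r ∷ k) l = linked-ʳ++ R-sym y xs k (R-sym r ∷ l)

  linked-reverse : (∀ {x y} → R x y → R y x) → ∀ xs → Linked R xs → Linked R (reverse xs)
  linked-reverse R-sym []       l = []
  linked-reverse R-sym (x ∷ xs) l = linked-ʳ++ R-sym x xs l [-]

module Adjacency {n} (G : Graph n) where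

  infix 4 _~_ _~?_
  _~_ : Fin n → Fin n → Set
  u ~ v = adj G u v ≡ true

  _~?_ : ∀ u v → Dec (u ~ v)
  u ~? v = adj G u v Bool.≟ true

  ~-sym : ∀ {u v} → u ~ v → v ~ u
  ~-sym {u} {v} p = trans (symm G v u) p

  ~-irrefl : ∀ {u} → ¬ u ~ u
  ~-irrefl {u} p = true≢false p (irrefl G u)

  record Path (l : List (Fin n)) : Set where
    constructor mkPath
    field
      unique : Unique l
      linked : Linked _~_ l
  open Path public

  infix 4 _⊆_
  _⊆_ : List (Fin n) → Subset n → Set
  l ⊆ U = ∀ {v} → v ∈ l → U v ≡ true

  degreeIn : Subset n → Fin n → ℕ
  degreeIn U v = count (U ∩ adj G v)

  neighbourIn : ∀ U v → 1 ≤ degreeIn U v → ∃[ u ] U u ≡ true × v ~ u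
  neighbourIn U v h with u , hu ← count-positive (U ∩ adj G v) h = u , proj₁ (∧-true hu) , proj₂ (∧-true hu)

  degree-split : ∀ U q v → degreeIn U v ≡ degreeIn (U ∩ q) v + degreeIn (U ∖ q) v
  degree-split U q v = trans (count-split (U ∩ adj G v) q)
    (cong₂ _+_ (∑-cong (λ u → cong ⟦_⟧ (swap∧ (U u) (adj G v u) (q u))))
               (∑-cong (λ u → cong ⟦_⟧ (swap∧ (U u) (adj G v u) (not (q u))))))
    where
    swap∧ : ∀ a b c → (a ∧ b) ∧ c ≡ (a ∧ c) ∧ b
    swap∧ true  true  c     = sym (∧-identity c)
      where
      ∧-identity : ∀ c → c ∧ true ≡ c
      ∧-identity true  = refl
      ∧-identity false = refl
    swap∧ true  false true  = refl
    swap∧ true  false false = refl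
    swap∧ false b     c     = refl

-- An attached vertex y outside P lies on a longest path Z that avoids P and hangs on it. The
-- extremality of P and Z leaves the head of Z just enough room for degree k; this rigidity lets
-- every vertex of Z take the place of the head.
module LongestPath {n} (G : Graph n) (U : Subset n) (P : List (Fin n)) (k : ℕ)
  (P-path : Adjacency.Path G P) (P⊆U : Adjacency._⊆_ G P U)
  (longest : ∀ l → Adjacency.Path G l → Adjacency._⊆_ G l U → length l ≤ length P)
  (p≤2k+2 : length P ≤ 2 * k + 2)
  (minDegree : ∀ v → U v ≡ true → k ≤ Adjacency.degreeIn G U v) where

  open Adjacency G

  Y : Subset n
  Y = U ∖ members P

  Y⇒U : ∀ {v} → Y v ≡ true → U v ≡ true
  Y⇒U h = proj₁ (∧-true h)

  Y⇒∉P : ∀ {v} → Y v ≡ true → v ∉ P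
  Y⇒∉P {v} h = members⇒∉ {l = P} (not-true (proj₂ (∧-true {U v} h)))

  Attached : Fin n → Set
  Attached t = Any (t ~_) P

  attached? : ∀ t → Dec (Attached t)
  attached? t = any? (t ~?_) P

  -- W is a path outside P whose last vertex is adjacent to the vertex v of P.
  prefix-bound : ∀ {Q} → Q ↭ P → Linked _~_ Q → ∀ pre v post → Q ≡ pre ++ v ∷ post →
    ∀ W → Unique W → W ⊆ Y → Linked _~_ (W ++ v ∷ []) → length W ≤ length pre
  prefix-bound Q↭P Q-linked pre v post refl W W-unique W⊆Y W-linked =
    +-cancelʳ-≤ (length (v ∷ post)) (length W) (length pre)
      (subst₂ _≤_ (length-++ W) (trans (sym (↭-length Q↭P)) (length-++ pre)) (longest (W ++ v ∷ post)
        (mkPath (Uniqueₚ.++⁺ W-unique (unique-++ʳ pre (unique-resp-↭ (↭-sym Q↭P) (unique P-path)))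
                  (λ (u∈W , u∈Q) → Y⇒∉P (W⊆Y u∈W) (in-P u∈Q)))
                (linked-join W v W-linked (linked-++ʳ pre Q-linked)))
        in-U))
    where
    in-P : ∀ {u} → u ∈ v ∷ post → u ∈ P
    in-P u∈ = ∈-resp-↭ Q↭P (∈-++⁺ʳ pre u∈)
    in-U : W ++ v ∷ post ⊆ U
    in-U u∈ with ∈-++⁻ W u∈
    ... | inj₁ u∈W = Y⇒U (W⊆Y u∈W)
    ... | inj₂ u∈Q = P⊆U (in-P u∈Q)

  reverse↭ : ∀ (l : List (Fin n)) → reverse l ↭ l
  reverse↭ l = ↭-sym (subst (_↭ reverse l) (++-[] l) (++↭ʳ++ l []))
    where
    ++-[] : ∀ (l : List (Fin n)) → l ++ [] ≡ l
    ++-[] []      = refl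
    ++-[] (x ∷ l) = cong (x ∷_) (++-[] l)

  -- `prefix-bound` for the reversed path, which is why that lemma admits any reordering Q of P.
  suffix-bound : ∀ pre v post → P ≡ pre ++ v ∷ post →
    ∀ W → Unique W → W ⊆ Y → Linked _~_ (W ++ v ∷ []) → length W ≤ length post
  suffix-bound pre v post eq W W-unique W⊆Y W-linked = subst (length W ≤_) (length-reverse post)
    (prefix-bound (reverse↭ P) (linked-reverse ~-sym P (linked P-path)) (reverse post) v (reverse pre)
      (trans (cong reverse eq) (trans (reverse-++ pre (v ∷ post))
        (trans (cong (_++ reverse pre) (unfold-reverse v post)) (++-assoc (reverse post) (v ∷ []) (reverse pre)))))
      W W-unique W⊆Y W-linked)

  no-insertion : ∀ {z} → Y z ≡ true → ∀ pre v v′ post → P ≡ pre ++ v ∷ v′ ∷ post → z ~ v → z ~ v′ → ⊥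
  no-insertion {z} Yz pre v v′ post eq z~v z~v′ = 1+n≰n (≤-trans (≤-reflexive (sym (↭-length perm)))
    (longest l (mkPath (unique-resp-↭ (↭-sym perm) (unique-∷ (Y⇒∉P Yz) (unique P-path)))
        (linked-join pre v (linked-prefix pre v P-linked) (~-sym z~v ∷ z~v′ ∷ linked-tail (linked-++ʳ pre P-linked))))
      (λ u∈ → in-U (∈-resp-↭ perm u∈))))
    where
    l : List (Fin n)
    l = pre ++ v ∷ z ∷ v′ ∷ post
    P-linked : Linked _~_ (pre ++ v ∷ v′ ∷ post)
    P-linked = subst (Linked _~_) eq (linked P-path)
    perm : l ↭ z ∷ P
    perm = ↭-trans (++⁺ˡ pre (swap v z ↭-refl)) (subst (λ Q → pre ++ z ∷ v ∷ v′ ∷ post ↭ z ∷ Q) (sym eq) (shift z pre (v ∷ v′ ∷ post)))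
    in-U : ∀ {u} → u ∈ z ∷ P → U u ≡ true
    in-U (here refl) = Y⇒U Yz
    in-U (there u∈P) = P⊆U u∈P

  -- The last vertex of the path hangs on P, so extension and rotation act at its head z.
  record Anchored (z : Fin n) (zs : List (Fin n)) : Set where
    field
      Z-unique : Unique (z ∷ zs)
      Z⊆Y      : z ∷ zs ⊆ Y
      anchor   : Fin n
      anchor∈P : anchor ∈ P
      Z-linked : Linked _~_ ((z ∷ zs) ++ anchor ∷ [])
  open Anchored

  pathDegree : Fin n → ℕ
  pathDegree z = degreeIn (U ∩ members P) z

  pathDegree≤marks : ∀ z → pathDegree z ≤ marks (adj G z) P
  pathDegree≤marks z = count-cover _ (filterᵇ (adj G z) P) λ v h →
    ∈-filter⁺ (λ u → Bool.T? (adj G z u)) {xs = P} (members⇒∈ {l = P} (proj₂ (∧-true {U v} (proj₁ (∧-true {(U ∩ members P) v} h)))))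
      (subst Bool.T (sym (proj₂ (∧-true {(U ∩ members P) v} h))) _)

  module _ {z zs} (Z : Anchored z zs)
           (maximal : ∀ {u} → Y u ≡ true → u ~ z → u ∈ z ∷ zs) where

    s : ℕ
    s = length (z ∷ zs)

    -- The anchor cuts P into two parts, and Z could replace either of them, so each is at least as
    -- long as Z.
    2s<p : s + suc s ≤ length P
    2s<p with pre , post , eq ← ∈-∃++ (anchor∈P Z) = ≤-trans
      (prefix-bound ↭-refl (linked P-path) pre (anchor Z) post eq (z ∷ zs) (Z-unique Z) (Z⊆Y Z) (Z-linked Z)
        ⊕ s≤s (suffix-bound pre (anchor Z) post eq (z ∷ zs) (Z-unique Z) (Z⊆Y Z) (Z-linked Z)))
      (≤-reflexive (trans (sym (length-++ pre)) (cong length (sym eq))))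

    s≤k : s ≤ k
    s≤k = s≤s⁻¹ (*-cancelˡ-< 2 s (suc k) (linear (suc (2 * s)) (2 * suc k) 0
      (≤-trans 2s<p p≤2k+2) (identity s k)))
      where
      identity : ∀ s k → suc (2 * s) + (2 * k + 2) + 0 ≡ 2 * suc k + (s + suc s)
      identity = solve-∀

    reversed : List (Fin n)
    reversed = reverse (z ∷ zs)

    reversed-linked : ∀ {v} → z ~ v → Linked _~_ (reversed ++ v ∷ [])
    reversed-linked {v} z~v = subst (Linked _~_) (ʳ++-defn (z ∷ zs))
      (linked-ʳ++ ~-sym z zs (linked-init (z ∷ zs) (Z-linked Z)) (z~v ∷ [-]))

    Yz : Y z ≡ true
    Yz = Z⊆Y Z (here refl)

    -- Read backwards Z ends in z, so it could replace either part of P next to a neighbour of z;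
    -- and z could be inserted between two consecutive neighbours. These are the conditions of
    -- `marks-bound`.
    marks-small : marks (adj G z) P ≡ 0 ⊎ 2 * marks (adj G z) P + s + s ≤ suc (length P)
    marks-small = marks-bound (adj G z) s s P
      (λ pre v v′ post eq → no-insertion Yz pre v v′ post eq)
      (λ pre v post eq z~v → subst (_≤ length pre) (length-reverse (z ∷ zs))
        (prefix-bound ↭-refl (linked P-path) pre v post eq reversed reversed-unique reversed⊆Y (reversed-linked z~v)))
      (λ pre v post eq z~v → subst (_≤ length post) (length-reverse (z ∷ zs))
        (suffix-bound pre v post eq reversed reversed-unique reversed⊆Y (reversed-linked z~v)))
      where
      reversed-unique : Unique reversed
      reversed-unique = unique-resp-↭ (↭-sym (reverse↭ (z ∷ zs))) (Z-unique Z)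
      reversed⊆Y : reversed ⊆ Y
      reversed⊆Y u∈ = Z⊆Y Z (∈-resp-↭ (reverse↭ (z ∷ zs)) u∈)

    neighbour∈zs : ∀ u → (Y ∩ adj G z) u ≡ true → u ∈ zs
    neighbour∈zs u h with maximal (proj₁ (∧-true h)) (~-sym (proj₂ (∧-true {Y u} h)))
    ... | here refl = ⊥-elim (~-irrefl (proj₂ (∧-true {Y u} h)))
    ... | there u∈  = u∈

    outside≤ : degreeIn Y z ≤ length zs
    outside≤ = count-cover (Y ∩ adj G z) zs neighbour∈zs

    k≤pathDegree+outside : k ≤ pathDegree z + degreeIn Y z
    k≤pathDegree+outside = ≤-trans (minDegree z (Y⇒U Yz)) (≤-reflexive (degree-split U (members P) z))

    -- With t neighbours on P, `marks-small` gives 2 (t + s) ≤ 2 k + 3, and halving drops the odd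
    -- unit. If t = 0, at most s - 1 < k neighbours would remain in all.
    pathDegree+s≤1+k : pathDegree z + s ≤ suc k
    pathDegree+s≤1+k with marks-small
    ... | inj₁ none = contradiction k≤pathDegree+outside (<⇒≱ (≤-trans
            (s≤s (≤-trans (pathDegree≤marks z) (≤-reflexive none) ⊕ outside≤)) s≤k))
    ... | inj₂ le   = ≤-trans (+-monoˡ-≤ s (pathDegree≤marks z)) (s≤s⁻¹ (*-cancelˡ-< 2 (t + s) (suc (suc k))
            (linear (suc (2 * (t + s))) (2 * suc (suc k)) 0 (≤-trans le (s≤s p≤2k+2)) (identity t s k))))
      where
      t : ℕ
      t = marks (adj G z) P
      identity : ∀ t s k → suc (2 * (t + s)) + suc (2 * k + 2) + 0 ≡ 2 * suc (suc k) + (2 * t + s + s)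
      identity = solve-∀

    degree≤k : degreeIn U z ≤ k
    degree≤k = ≤-trans (≤-reflexive (degree-split U (members P) z))
      (s≤s⁻¹ (linear _ (suc k) 0 (pathDegree+s≤1+k ⊕ outside≤) (identity (pathDegree z) (degreeIn Y z) (length zs) k)))
      where
      identity : ∀ a b c k → suc (a + b) + (suc k + c) + 0 ≡ suc k + (a + suc c + b)
      identity = solve-∀

    -- Of at least k neighbours at most k + 1 - s lie on P, so s - 1 or more lie outside, and these
    -- are all on Z. Thus z is adjacent to every other vertex of Z.
    length≤outside : length zs ≤ degreeIn Y z
    length≤outside = s≤s⁻¹ (linear _ _ 0 (pathDegree+s≤1+k ⊕ k≤pathDegree+outside) (identity (pathDegree z) (degreeIn Y z) (length zs) k))
      where
      identity : ∀ a b c k → suc c + (suc k + (a + b)) + 0 ≡ suc b + (a + suc c + k)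
      identity = solve-∀

    1≤pathDegree : 1 ≤ pathDegree z
    1≤pathDegree = linear _ _ 0 (k≤pathDegree+outside ⊕ outside≤ ⊕ s≤k) (identity (pathDegree z) (degreeIn Y z) (length zs) k)
      where
      identity : ∀ a b c k → 1 + (a + b + c + k) + 0 ≡ a + (k + b + suc c)
      identity = solve-∀

    attached-end : Attached z
    attached-end = attach (neighbourIn (U ∩ members P) z 1≤pathDegree)
      where
      attach : ∃[ v ] (U ∩ members P) v ≡ true × z ~ v → Attached z
      attach (v , h , z~v) = lose (members⇒∈ {l = P} (proj₂ (∧-true {U v} h))) z~v

    adjacent-to-all : ∀ {t} → t ∈ zs → z ~ t
    adjacent-to-all {t} t∈ with z ~? t
    ... | yes z~t = z~t
    ... | no z≁t with as , bs , refl ← ∈-∃++ t∈ = contradiction length≤outside (<⇒≱ (≤-trans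
          (s≤s (count-cover (Y ∩ adj G z) (as ++ bs) cover)) (≤-reflexive (sym (↭-length (shift t as bs))))))
      where
      cover : ∀ u → (Y ∩ adj G z) u ≡ true → u ∈ as ++ bs
      cover u h with ∈-resp-↭ (shift t as bs) (neighbour∈zs u h)
      ... | here refl = contradiction (proj₂ (∧-true {Y u} h)) z≁t
      ... | there u∈  = u∈

  -- The path z, as, u, bs becomes u, `as` reversed, z, bs. Here z is adjacent to the first vertex
  -- of bs; if bs is empty, z becomes the last vertex and its neighbour on P the new anchor.
  rotate : ∀ {z zs} → Anchored z zs → Attached z → (∀ {t} → t ∈ zs → z ~ t) → ∀ as {u bs} → zs ≡ as ++ u ∷ bs →
           Anchored u ((z ∷ as) ʳ++ bs) × (u ∷ ((z ∷ as) ʳ++ bs) ↭ z ∷ zs)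
  rotate {z} Z z-attached z~ as {u} {bs} refl = record
      { Z-unique = unique-resp-↭ (↭-sym perm) (Z-unique Z)
      ; Z⊆Y      = λ v∈ → Z⊆Y Z (∈-resp-↭ perm v∈)
      ; anchor   = proj₁ anchored
      ; anchor∈P = proj₁ (proj₂ anchored)
      ; Z-linked = proj₂ (proj₂ anchored) } , perm
    where
    perm : u ∷ ((z ∷ as) ʳ++ bs) ↭ z ∷ as ++ u ∷ bs
    perm = ↭-sym (↭-trans (shift u (z ∷ as) bs) (prep u (++↭ʳ++ (z ∷ as) bs)))
    ʳ++-++ : ∀ (xs : List (Fin n)) {ys zs} → (xs ʳ++ ys) ++ zs ≡ xs ʳ++ (ys ++ zs)
    ʳ++-++ []       = refl
    ʳ++-++ (x ∷ xs) = ʳ++-++ xs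
    front : Linked _~_ (z ∷ as ++ u ∷ [])
    front = linked-prefix (z ∷ as) u (subst (Linked _~_) (++-assoc (z ∷ as) (u ∷ bs) _) (Z-linked Z))
    rotated : ∀ {v} → Linked _~_ (z ∷ bs ++ v ∷ []) → Linked _~_ (u ∷ ((z ∷ as) ʳ++ bs) ++ v ∷ [])
    rotated {v} l = subst (Linked _~_) (trans (++-ʳ++ as) (cong (u ∷_) (sym (ʳ++-++ as)))) (linked-ʳ++ ~-sym z (as ++ u ∷ []) front l)
    back : ∀ bs → (∀ {t} → t ∈ bs → z ~ t) → Linked _~_ (bs ++ anchor Z ∷ []) →
           ∃[ v ] v ∈ P × Linked _~_ (z ∷ bs ++ v ∷ [])
    back []       z~ l with v , v∈P , z~v ← find z-attached = v , v∈P , z~v ∷ [-]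
    back (b ∷ bs) z~ l = anchor Z , anchor∈P Z , z~ (here refl) ∷ l
    tail-linked : Linked _~_ (bs ++ anchor Z ∷ [])
    tail-linked = linked-tail (linked-++ʳ (z ∷ as) (subst (Linked _~_) (++-assoc (z ∷ as) (u ∷ bs) _) (Z-linked Z)))
    anchored : ∃[ v ] v ∈ P × Linked _~_ (u ∷ ((z ∷ as) ʳ++ bs) ++ v ∷ [])
    anchored with v , v∈P , l ← back bs (λ t∈ → z~ (∈-++⁺ʳ as (there t∈))) tail-linked = v , v∈P , rotated l

  Good : Fin n → Set
  Good y = degreeIn U y ≤ k × (∀ u → Y u ≡ true → y ~ u → Attached u)

  module _ (y : Fin n) (Yy : Y y ≡ true) (y-attached : Attached y) where

    -- Passing through y, unlike starting at y, survives rotation, so the maximum is taken over this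
    -- class.
    record Candidate (l : List (Fin n)) : Set where
      field
        head      : Fin n
        tail      : List (Fin n)
        shape     : l ≡ head ∷ tail
        anchored  : Anchored head tail
        through-y : y ∈ l

    module _ {z zs} (Z : Anchored z zs) (y∈Z : y ∈ z ∷ zs)
             (maximal : ∀ {l} → Candidate l → length l ≤ length (z ∷ zs)) where

      closed : ∀ {u} → Y u ≡ true → u ~ z → u ∈ z ∷ zs
      closed {u} Yu u~z = decidable-stable (u ∈? z ∷ zs) λ u∉ → 1+n≰n (maximal {u ∷ z ∷ zs} record
        { head = u ; tail = z ∷ zs ; shape = refl ; through-y = there y∈Z
        ; anchored = record
          { Z-unique = unique-∷ u∉ (Z-unique Z)
          ; Z⊆Y      = λ { (here refl) → Yu ; (there v∈) → Z⊆Y Z v∈ }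
          ; anchor   = anchor Z
          ; anchor∈P = anchor∈P Z
          ; Z-linked = u~z ∷ Z-linked Z } })

    rotate-maximal : ∀ {z zs} (Z : Anchored z zs) → y ∈ z ∷ zs → (∀ {l} → Candidate l → length l ≤ length (z ∷ zs)) →
      ∀ {u} → u ∈ z ∷ zs → ∃[ us ] Anchored u us × y ∈ u ∷ us × (∀ {l} → Candidate l → length l ≤ length (u ∷ us))
    rotate-maximal {z} {zs} Z y∈Z maximal (here refl) = zs , Z , y∈Z , maximal
    rotate-maximal {z} {zs} Z y∈Z maximal {u} (there u∈) = rotated (∈-∃++ u∈)
      where
      rotated : ∃[ as ] ∃[ bs ] zs ≡ as ++ u ∷ bs →
        ∃[ us ] Anchored u us × y ∈ u ∷ us × (∀ {l} → Candidate l → length l ≤ length (u ∷ us))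
      rotated (as , bs , eq) = (z ∷ as) ʳ++ bs , proj₁ result , ∈-resp-↭ (↭-sym (proj₂ result)) y∈Z
        , λ c → ≤-trans (maximal c) (≤-reflexive (sym (↭-length (proj₂ result))))
        where
        result : Anchored u ((z ∷ as) ʳ++ bs) × (u ∷ ((z ∷ as) ʳ++ bs) ↭ z ∷ zs)
        result = rotate Z (attached-end Z (closed Z y∈Z maximal)) (adjacent-to-all Z (closed Z y∈Z maximal)) as eq

    -- One rotation makes y the head and bounds its degree. A neighbour of y outside P then lies on
    -- the path by maximality, and a second rotation makes that neighbour the head, hence attached.
    good : ¬ Good y → ⊥
    good ¬good = maximal Candidate length (length P) bounded handle (y ∷ []) start
      where
      start : Candidate (y ∷ [])
      start with v , v∈P , y~v ← find y-attached = record { head = y ; tail = [] ; shape = refl ; through-y = here refl ; anchored = record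
          { Z-unique = [] ∷ [] ; Z⊆Y = λ { (here refl) → Yy } ; anchor = v ; anchor∈P = v∈P ; Z-linked = y~v ∷ [-] } }
      bounded : ∀ l → Candidate l → length l ≤ length P
      bounded l c rewrite Candidate.shape c = longest (Candidate.head c ∷ Candidate.tail c)
        (mkPath (Z-unique Z) (linked-init (Candidate.head c ∷ Candidate.tail c) (Z-linked Z)))
        (λ v∈ → Y⇒U (Z⊆Y Z v∈))
        where
        Z = Candidate.anchored c
      handle : ∀ l → Candidate l → (∀ l′ → Candidate l′ → length l′ ≤ length l) → ⊥
      handle l record { shape = refl ; anchored = Z ; through-y = y∈Z } maximal
        with ys , Z₁ , y∈Z₁ , max₁ ← rotate-maximal Z y∈Z (λ {l} → maximal l) y∈Z
        = ¬good (degree≤k Z₁ (closed Z₁ y∈Z₁ max₁) , neighbours-attached)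
        where
        neighbours-attached : ∀ u → Y u ≡ true → y ~ u → Attached u
        neighbours-attached u Yu y~u
          with us , Z₂ , y∈Z₂ , max₂ ← rotate-maximal Z₁ y∈Z₁ max₁ (closed Z₁ y∈Z₁ max₁ Yu (~-sym y~u))
          = attached-end Z₂ (closed Z₂ y∈Z₂ max₂)

-- Minimal rich vertex sets

∑-⁅⁆ : ∀ {n} (v : Fin n) (f : Fin n → ℕ) → ∑ (λ z → ⟦ ⁅ v ⁆ z ⟧ * f z) ≡ f v
∑-⁅⁆ {suc n} zero    f = trans (cong (f zero + 0 +_) (∑-zero {n} (λ _ → refl)))
  (trans (+-identityʳ (f zero + 0)) (+-identityʳ (f zero)))
∑-⁅⁆         (suc v) f = ∑-⁅⁆ v (f ∘ suc)

module Walks {n} (G : Graph n) where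
  open Adjacency G public

  walksIn : Subset n → Fin n → ℕ
  walksIn U x = ∑ (λ z → ⟦ (U ∩ adj G x) z ⟧ * degreeIn U z)

  degreeSum : Subset n → Subset n → ℕ
  degreeSum p q = ∑ (λ z → ⟦ p z ⟧ * degreeIn q z)

  -- Double counting of the adjacent pairs between p and q.
  degreeSum-swap : ∀ p q → degreeSum p q ≡ degreeSum q p
  degreeSum-swap p q = trans (∑-cong (λ z → *-distribˡ-sum ⟦ p z ⟧ (λ y → ⟦ (q ∩ adj G z) y ⟧)))
    (trans (∑-swap (λ z y → ⟦ p z ⟧ * ⟦ (q ∩ adj G z) y ⟧))
    (∑-cong (λ y → trans (∑-cong (λ z → exchange z y)) (sym (*-distribˡ-sum ⟦ q y ⟧ (λ z → ⟦ (p ∩ adj G y) z ⟧))))))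
    where
    exchange : ∀ z y → ⟦ p z ⟧ * ⟦ (q ∩ adj G z) y ⟧ ≡ ⟦ q y ⟧ * ⟦ (p ∩ adj G y) z ⟧
    exchange z y rewrite ⟦∧⟧ (q y) (adj G z y) | ⟦∧⟧ (p z) (adj G y z) | symm G z y =
      identity ⟦ p z ⟧ ⟦ q y ⟧ ⟦ adj G y z ⟧
      where
      identity : ∀ p y b → p * (y * b) ≡ y * (p * b)
      identity = solve-∀

  -- As x is not its own neighbour, its term of the sum is still available.
  degreeSum-without : ∀ p q x → p x ≡ true →
    ∑ (λ z → ⟦ adj G x z ⟧ * (⟦ p z ⟧ * degreeIn q z)) + degreeIn q x ≤ degreeSum p q
  degreeSum-without p q x px = ≤-trans
    (≤-reflexive (trans (cong (∑ (λ z → ⟦ adj G x z ⟧ * (⟦ p z ⟧ * degreeIn q z)) +_) (sym (∑-⁅⁆ x (degreeIn q))))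
      (sym (∑-+ (λ z → ⟦ adj G x z ⟧ * (⟦ p z ⟧ * degreeIn q z)) (λ z → ⟦ ⁅ x ⁆ z ⟧ * degreeIn q z)))))
    (∑-mono λ z → pointwise z (z ≟ x))
    where
    pointwise : ∀ z (d : Dec (z ≡ x)) → ⟦ adj G x z ⟧ * (⟦ p z ⟧ * degreeIn q z) + ⟦ does d ⟧ * degreeIn q z ≤ ⟦ p z ⟧ * degreeIn q z
    pointwise z (no _)     = ≤-trans (≤-reflexive (+-identityʳ _)) (≤-trans (*-monoˡ-≤ (⟦ p z ⟧ * degreeIn q z) (⟦⟧≤1 (adj G x z))) (≤-reflexive (*-identityˡ _)))
    pointwise z (yes refl) rewrite irrefl G z | px = ≤-refl

  degreeSum-within : ∀ p q x → ∑ (λ z → ⟦ adj G x z ⟧ * (⟦ p z ⟧ * degreeIn q z)) ≤ degreeSum p q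
  degreeSum-within p q x = ∑-mono λ z → ≤-trans (*-monoˡ-≤ (⟦ p z ⟧ * degreeIn q z) (⟦⟧≤1 (adj G x z))) (≤-reflexive (*-identityˡ _))

  degree-remove : ∀ U v → U v ≡ true → ∀ z → degreeIn U z ≡ ⟦ adj G z v ⟧ + degreeIn (U ∖ ⁅ v ⁆) z
  degree-remove U v Uv z = trans (count-remove (U ∩ adj G z) v)
    (cong₂ (λ b c → ⟦ b ∧ adj G z v ⟧ + c) Uv (∑-cong (λ u → cong ⟦_⟧ (swap∧ (U u) (adj G z u) (not (⁅ v ⁆ u))))))
    where
    swap∧ : ∀ a b c → (a ∧ b) ∧ c ≡ (a ∧ c) ∧ b
    swap∧ true  true  true  = refl
    swap∧ true  true  false = refl
    swap∧ true  false true  = refl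
    swap∧ true  false false = refl
    swap∧ false b     c     = refl

  -- A lost walk has v in the middle, which gives the first correction, or ends in v, and then its
  -- middle vertex is a neighbour of v.
  walks-remove : ∀ U x v → U v ≡ true → walksIn U x ≤
    walksIn (U ∖ ⁅ v ⁆) x + (⟦ adj G x v ⟧ * degreeIn U v + degreeIn U v)
  walks-remove U x v Uv = ≤-trans (∑-mono pointwise) (≤-reflexive total)
    where
    U′ : Subset n
    U′ = U ∖ ⁅ v ⁆
    bound : Fin n → ℕ
    bound z = ⟦ (U′ ∩ adj G x) z ⟧ * degreeIn U′ z + (⟦ ⁅ v ⁆ z ⟧ * (⟦ adj G x z ⟧ * degreeIn U z) + ⟦ (U ∩ adj G v) z ⟧)
    pointwise : ∀ z → ⟦ (U ∩ adj G x) z ⟧ * degreeIn U z ≤ bound z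
    pointwise z = cases (U z) (adj G x z) (⁅ v ⁆ z) (adj G v z) _ _ (trans (degree-remove U v Uv z) (cong (λ b → ⟦ b ⟧ + degreeIn U′ z) (symm G z v)))
      where
      cases : ∀ a b c f d d′ → d ≡ ⟦ f ⟧ + d′ →
        ⟦ a ∧ b ⟧ * d ≤ ⟦ (a ∧ not c) ∧ b ⟧ * d′ + (⟦ c ⟧ * (⟦ b ⟧ * d) + ⟦ a ∧ f ⟧)
      cases false _     _     _     _  _  _  = z≤n
      cases true  false _     _     _  _  _  = z≤n
      cases true  true  true  f     d  _  _  = by-slack ⟦ f ⟧ (identity d ⟦ f ⟧)
        where
        identity : ∀ d f → 1 * d + f ≡ 1 * (1 * d) + f
        identity = solve-∀
      cases true  true  false f     _  d′ refl = ≤-reflexive (identity d′ ⟦ f ⟧)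
        where
        identity : ∀ d f → 1 * (f + d) ≡ 1 * d + f
        identity = solve-∀
    total : ∑ bound ≡ walksIn U′ x + (⟦ adj G x v ⟧ * degreeIn U v + degreeIn U v)
    total = trans (∑-+ (λ z → ⟦ (U′ ∩ adj G x) z ⟧ * degreeIn U′ z) _) (cong (walksIn U′ x +_)
      (trans (∑-+ (λ z → ⟦ ⁅ v ⁆ z ⟧ * (⟦ adj G x z ⟧ * degreeIn U z)) (λ z → ⟦ (U ∩ adj G v) z ⟧))
        (cong (_+ degreeIn U v) (∑-⁅⁆ v (λ z → ⟦ adj G x z ⟧ * degreeIn U z)))))

  degree<size : ∀ U z → U z ≡ true → suc (degreeIn U z) ≤ count U
  degree<size U z Uz = ≤-trans (s≤s (count-mono {p = U ∩ adj G z} {U ∖ ⁅ z ⁆} away))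
    (≤-reflexive (sym (trans (count-remove U z) (cong (λ b → ⟦ b ⟧ + count (U ∖ ⁅ z ⁆)) Uz))))
    where
    away : ∀ u → (U ∩ adj G z) u ≡ true → (U ∖ ⁅ z ⁆) u ≡ true
    away u h = ∧-intro (proj₁ (∧-true h)) (not-intro (dec-false (u ≟ z) λ { refl → ~-irrefl (proj₂ (∧-true {U u} h)) }))

  walks≤degree*size : ∀ U x → walksIn U x + degreeIn U x ≤ degreeIn U x * count U
  walks≤degree*size U x = ≤-trans
    (≤-reflexive (sym (∑-+ (λ z → ⟦ (U ∩ adj G x) z ⟧ * degreeIn U z) (λ z → ⟦ (U ∩ adj G x) z ⟧))))
    (≤-trans (∑-mono pointwise) (≤-reflexive (sym (*-distribʳ-sum (count U) (λ z → ⟦ (U ∩ adj G x) z ⟧)))))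
    where
    pointwise : ∀ z → ⟦ (U ∩ adj G x) z ⟧ * degreeIn U z + ⟦ (U ∩ adj G x) z ⟧ ≤ ⟦ (U ∩ adj G x) z ⟧ * count U
    pointwise z with (U ∩ adj G x) z in h
    ... | false = z≤n
    ... | true  = ≤-trans (≤-reflexive (identity (degreeIn U z))) (*-monoʳ-≤ 1 (degree<size U z (proj₁ (∧-true h))))
      where
      identity : ∀ d → 1 * d + 1 ≡ 1 * suc d
      identity = solve-∀

module Reduction {n} (G : Graph n) (k′ e : ℕ) (x : Fin n) where
  open Walks G

  private
    k : ℕ
    k = suc k′

  -- W − k′ d ≥ k (m − k) + (n − m) + e for W = walksIn U x, d = degreeIn U x and
  -- m = count U; deleting from U a vertex of degree less than k preserves this.
  Rich : Subset n → Set
  Rich U = U x ≡ true × k′ * degreeIn U x + k′ * count U + (n + e) ≤ walksIn U x + k * k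

  -- Closedness preserves the degrees that occur in walks from x, while the terms k′ d and k′ m can
  -- only shrink.
  rich-closed : ∀ {U U′} → (∀ v → U′ v ≡ true → U v ≡ true) → U′ x ≡ true →
    (∀ u v → U′ u ≡ true → U v ≡ true → u ~ v → U′ v ≡ true) → Rich U → Rich U′
  rich-closed {U} {U′} sub x∈ closed (_ , rich) = x∈ , ≤-trans
    ((*-monoʳ-≤ k′ (count-mono {p = U′ ∩ adj G x} {U ∩ adj G x} (λ v h → ∧-intro (sub v (proj₁ (∧-true h))) (proj₂ (∧-true {U′ v} h))))
      ⊕ *-monoʳ-≤ k′ (count-mono {p = U′} {U} sub)) ⊕ ≤-refl {n + e})
    (≤-trans rich (+-monoˡ-≤ (k * k) (∑-mono pointwise)))
    where
    pointwise : ∀ z → ⟦ (U ∩ adj G x) z ⟧ * degreeIn U z ≤ ⟦ (U′ ∩ adj G x) z ⟧ * degreeIn U′ z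
    pointwise z with (U ∩ adj G x) z in h
    ... | false = z≤n
    ... | true  = subst (λ b → 1 * degreeIn U z ≤ ⟦ b ⟧ * degreeIn U′ z) (sym (∧-intro U′z x~z))
          (*-monoʳ-≤ 1 (count-mono {p = U ∩ adj G z} {U′ ∩ adj G z} λ v g →
            ∧-intro (closed z v U′z (proj₁ (∧-true g)) (proj₂ (∧-true {U v} g))) (proj₂ (∧-true {U v} g))))
      where
      x~z : x ~ z
      x~z = proj₂ (∧-true {U z} h)
      U′z : U′ z ≡ true
      U′z = closed x z x∈ (proj₁ (∧-true h)) x~z

  -- With a = 1 if v is adjacent to x and a = 0 otherwise, at most a k′ + k′ walks are lost, and k′
  -- d + k′ m loses exactly this much.
  rich-remove : ∀ {U v} → U v ≡ true → v ≢ x → degreeIn U v ≤ k′ → Rich U → Rich (U ∖ ⁅ v ⁆)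
  rich-remove {U} {v} Uv v≢x d≤k′ (x∈ , rich) = ∧-intro x∈ (not-intro (dec-false (x ≟ v) (v≢x ∘ sym)))
    , linear _ _ 0 (rich ⊕ walks-remove U x v Uv ⊕ *-monoʳ-≤ a d≤k′ ⊕ d≤k′)
      (subst₂ (λ D C → k′ * d′ + k′ * m′ + (n + e) + (walksIn U x + k * k + (W′ + (a * d + d)) + a * k′ + k′) + 0 ≡
                 W′ + k * k + (k′ * D + k′ * C + (n + e) + walksIn U x + a * d + d))
        (sym (degree-remove U v Uv x)) (sym (trans (count-remove U v) (cong (λ b → ⟦ b ⟧ + m′) Uv)))
        (identity k′ d′ m′ (n + e) (walksIn U x) W′ a d (k * k)))
    where
    d′ = degreeIn (U ∖ ⁅ v ⁆) x
    m′ = count (U ∖ ⁅ v ⁆)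
    W′ = walksIn (U ∖ ⁅ v ⁆) x
    a = ⟦ adj G x v ⟧
    d = degreeIn U v
    identity : ∀ k′ d′ m′ N W W′ a d K →
      k′ * d′ + k′ * m′ + N + (W + K + (W′ + (a * d + d)) + a * k′ + k′) + 0 ≡
      W′ + K + (k′ * (a + d′) + k′ * (1 + m′) + N + W + a * d + d)
    identity = solve-∀

  module Minimal (U : Subset n) (rich : Rich U) (minimal : ∀ U′ → Rich U′ → count U′ < count U → ⊥)
                 (k²<n : k * k < n) where

    x∈U : U x ≡ true
    x∈U = proj₁ rich

    smaller : ∀ v → U v ≡ true → count (U ∖ ⁅ v ⁆) < count U
    smaller v Uv = ≤-reflexive (sym (trans (count-remove U v) (cong (λ b → ⟦ b ⟧ + count (U ∖ ⁅ v ⁆)) Uv)))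

    minDegree : ∀ v → U v ≡ true → k ≤ degreeIn U v
    minDegree v Uv with v ≟ x
    ... | no v≢x = ≰⇒> λ d≤k′ → minimal (U ∖ ⁅ v ⁆) (rich-remove Uv v≢x d≤k′ rich) (smaller v Uv)
    -- x itself may not be removed; but if its degree were at most k′, there would be at most k′ m
    -- walks, and richness would give n ≤ k².
    ... | yes refl = ≰⇒> λ d≤k′ → <⇒≱ k²<n
          (linear n (k * k) _ (proj₂ rich ⊕ walks≤degree*size U x ⊕ *-monoˡ-≤ (count U) d≤k′)
            (identity k′ (degreeIn U x) (count U) n e (walksIn U x) (k * k)))
      where
      identity : ∀ k′ d m n e W K → n + (W + K + d * m + k′ * m) + (k′ * d + e + d) ≡
        K + (k′ * d + k′ * m + (n + e) + (W + d) + d * m)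
      identity = solve-∀

    -- Connectivity of U: otherwise x lies in one of `U ∩ D` and `U ∖ D`, and that part would be a
    -- smaller rich set.
    closed⇒all : ∀ (D : Subset n) a → U a ≡ true → D a ≡ true →
      (∀ u v → U u ≡ true → D u ≡ true → U v ≡ true → u ~ v → D v ≡ true) → ∀ b → U b ≡ true → D b ≡ true
    closed⇒all D a Ua Da closed b Ub with bool-cases (D b)
    ... | inj₁ Db = Db
    ... | inj₂ ¬Db with bool-cases (D x)
    ...   | inj₁ Dx = ⊥-elim (minimal (U ∩ D)
              (rich-closed {U} {U ∩ D} (λ v h → proj₁ (∧-true h)) (∧-intro x∈U Dx)
                (λ u v h Uv u~v → ∧-intro Uv (closed u v (proj₁ (∧-true h)) (proj₂ (∧-true {U u} h)) Uv u~v)) rich)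
              (≤-trans (s≤s (count-mono {p = U ∩ D} {U ∖ ⁅ b ⁆} λ v h → ∧-intro (proj₁ (∧-true h))
                (not-intro (dec-false (v ≟ b) λ { refl → true≢false (proj₂ (∧-true {U v} h)) ¬Db })))) (smaller b Ub)))
    ...   | inj₂ ¬Dx = ⊥-elim (minimal (U ∖ D)
              (rich-closed {U} {U ∖ D} (λ v h → proj₁ (∧-true h)) (∧-intro x∈U (not-intro ¬Dx))
                (λ u v h Uv u~v → ∧-intro Uv (not-intro (¬-closed u v h Uv u~v))) rich)
              (≤-trans (s≤s (count-mono {p = U ∖ D} {U ∖ ⁅ a ⁆} λ v h → ∧-intro (proj₁ (∧-true h))
                (not-intro (dec-false (v ≟ a) λ { refl → true≢false Da (not-true (proj₂ (∧-true {U v} h))) })))) (smaller a Ua)))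
      where
      ¬-closed : ∀ u v → (U ∖ D) u ≡ true → U v ≡ true → u ~ v → D v ≡ false
      ¬-closed u v h Uv u~v with bool-cases (D v)
      ... | inj₂ ¬Dv = ¬Dv
      ... | inj₁ Dv  = ⊥-elim (true≢false (closed v u Uv Dv (proj₁ (∧-true h)) (~-sym u~v)) (not-true (proj₂ (∧-true {U u} h))))

    -- L is the clique of the extremal graph and R a part of its independent set.
    record Kernel : Set where
      field
        L R      : List (Fin n)
        L-unique : Unique L
        R-unique : Unique R
        L⊆U      : L ⊆ U
        R⊆U      : R ⊆ U
        ∣L∣≡k    : length L ≡ k
        k<∣R∣    : k < length R
        R~L      : ∀ {r l} → r ∈ R → l ∈ L → r ~ l
        R-only-L : ∀ {r u} → r ∈ R → U u ≡ true → r ~ u → u ∈ L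

    -- In `big` the first summand is for the pigeonhole over the subsets of P, the second is the
    -- error term of `Y₀-large`.
    module FindKernel (e≤1 : e ≤ 1) (no-long-path : ∀ l → Path l → length l ≤ suc (2 * k + e))
             (big : 2 ^ suc (2 * k + e) * k + ((k + 1 + e) * (2 * k + e) + k * k) < n + e) where

      module _ (P : List (Fin n)) (P-path : Path P) (P⊆U : P ⊆ U)
               (longest : ∀ l → Path l → l ⊆ U → length l ≤ length P) where

        p≤2k+2 : length P ≤ 2 * k + 2
        p≤2k+2 = ≤-trans (no-long-path P P-path) (≤-trans (s≤s (+-monoʳ-≤ (2 * k) e≤1)) (≤-reflexive (sym (+-suc (2 * k) 1))))

        open LongestPath G U P k P-path P⊆U longest p≤2k+2 minDegree

        good⁺ : ∀ y → Y y ≡ true → Attached y → Good y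
        good⁺ y Yy att = decidable-good (λ ¬good → good y Yy att ¬good)
          where
          decidable-good : (¬ ¬ Good y) → Good y
          decidable-good ¬¬good = decidable-stable (degreeIn U y ≤? k) (λ ¬d → ¬¬good (¬d ∘ proj₁))
            , λ u Yu y~u → decidable-stable (attached? u) (λ ¬a → ¬¬good (λ g → ¬a (proj₂ g u Yu y~u)))

        some∈P : ∃[ v ] v ∈ P
        some∈P = nonempty (longest (x ∷ []) (mkPath ([] ∷ []) [-]) (λ { (here refl) → x∈U }))
          where
          nonempty : ∀ {l : List (Fin n)} → 1 ≤ length l → ∃[ v ] v ∈ l
          nonempty {v ∷ _} _ = v , here refl

        -- P and its attached vertices form a closed set by the second half of `Good`, and U is
        -- connected.
        all-attached : ∀ y → Y y ≡ true → Attached y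
        all-attached y Yy = does-true (attached? y) (trans (sym (cong (λ b → b ∨ does (attached? y)) (not-true (proj₂ (∧-true {U y} Yy)))))
          (closed⇒all D (proj₁ some∈P) (P⊆U (proj₂ some∈P)) (cong (_∨ does (attached? (proj₁ some∈P))) (∈⇒members {l = P} (proj₂ some∈P))) D-closed y (Y⇒U Yy)))
          where
          D : Subset n
          D v = members P v ∨ does (attached? v)
          D-closed : ∀ u v → U u ≡ true → D u ≡ true → U v ≡ true → u ~ v → D v ≡ true
          D-closed u v Uu Du Uv u~v with bool-cases (members P v)
          ... | inj₁ v∈P rewrite v∈P = refl
          ... | inj₂ v∉P rewrite v∉P = dec-true (attached? v) (step (bool-cases (members P u)))
            where
            step : members P u ≡ true ⊎ members P u ≡ false → Attached v
            step (inj₁ u∈P) = lose (members⇒∈ {l = P} u∈P) (~-sym u~v)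
            step (inj₂ u∉P) = proj₂ (good⁺ u (∧-intro Uu (not-intro u∉P))
                (does-true (attached? u) (trans (sym (cong (_∨ does (attached? u)) u∉P)) Du)))
              v (∧-intro Uv (not-intro v∉P)) u~v

        degree≤ : ∀ y → Y y ≡ true → degreeIn U y ≤ k
        degree≤ y Yy = proj₁ (good⁺ y Yy (all-attached y Yy))

        Y₀ : Subset n
        Y₀ y = Y y ∧ (degreeIn Y y ≡ᵇ 0)

        pathDegree≤ : ∀ z → z ∈ P → pathDegree z ≤ 2 * k + e
        pathDegree≤ z z∈ = from-split (∈-∃++ z∈)
          where
          from-split : ∃[ as ] ∃[ bs ] P ≡ as ++ z ∷ bs → pathDegree z ≤ 2 * k + e
          from-split (as , bs , eq) = ≤-trans (count-cover ((U ∩ members P) ∩ adj G z) (as ++ bs) cover)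
              (s≤s⁻¹ (≤-trans (≤-reflexive (sym (trans (cong length eq) (↭-length (shift z as bs))))) (no-long-path P P-path)))
            where
            cover : ∀ u → ((U ∩ members P) ∩ adj G z) u ≡ true → u ∈ as ++ bs
            cover u h with ∈-resp-↭ (shift z as bs) (subst (u ∈_) eq (members⇒∈ {l = P} (proj₂ (∧-true {U u} (proj₁ (∧-true {(U ∩ members P) u} h))))))
            ... | here refl = ⊥-elim (~-irrefl (proj₂ (∧-true {(U ∩ members P) u} h)))
            ... | there u∈  = u∈

        private
          c : ℕ
          -- This is 2 k + e, the bound on neighbours along P for a vertex of P, less k′.
          c = k + 1 + e
          a : Fin n → ℕ
          a z = ⟦ (U ∩ adj G x) z ⟧
          inP : Fin n → ℕ
          inP z = ⟦ (U ∩ members P) z ⟧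

        cross : ℕ
        cross = degreeSum (U ∩ members P) Y

        -- A vertex outside P sends at most k edges to P, and at most k′ if it also has a neighbour
        -- outside P.
        cross≤ : cross ≤ k′ * count Y + count Y₀
        cross≤ = ≤-trans (≤-reflexive (degreeSum-swap (U ∩ members P) Y)) (≤-trans (∑-mono pointwise) (≤-reflexive
          (trans (∑-+ (λ y → k′ * ⟦ Y y ⟧) (λ y → ⟦ Y₀ y ⟧)) (cong (_+ count Y₀) (sym (*-distribˡ-sum k′ (λ y → ⟦ Y y ⟧)))))))
          where
          pointwise : ∀ y → ⟦ Y y ⟧ * pathDegree y ≤ k′ * ⟦ Y y ⟧ + ⟦ Y₀ y ⟧
          pointwise y with Y y in Yy
          ... | false = z≤n
          ... | true with degreeIn Y y in dY
          ...   | zero  = ≤-trans (*-monoʳ-≤ 1 (≤-trans (by-slack _ refl) (≤-trans (≤-reflexive (sym (degree-split U (members P) y))) (degree≤ y Yy))))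
                  (≤-reflexive (identity k′))
            where
            identity : ∀ k′ → 1 * suc k′ ≡ k′ * 1 + 1
            identity = solve-∀
          ...   | suc d = ≤-trans (*-monoʳ-≤ 1 (s≤s⁻¹ (≤-trans
                    (linear (suc (pathDegree y)) (degreeIn U y) d (≤-reflexive (trans (cong (pathDegree y +_) (sym dY)) (sym (degree-split U (members P) y))))
                      (identity₁ (pathDegree y) d (degreeIn U y))) (degree≤ y Yy))))
                  (≤-reflexive (identity₂ k′))
            where
            identity₁ : ∀ p d D → suc p + D + d ≡ D + (p + suc d)
            identity₁ = solve-∀
            identity₂ : ∀ k′ → 1 * k′ ≡ k′ * 1 + 0
            identity₂ = solve-∀

        -- Beyond k′, a neighbour of x on P contributes at most c and its edges to Y, a neighbour
        -- outside P at most 1.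
        walks≤ : walksIn U x ≤ k′ * degreeIn U x + (degreeIn Y x + c * pathDegree x + ∑ (λ z → ⟦ adj G x z ⟧ * (inP z * degreeIn Y z)))
        walks≤ = ≤-trans (∑-mono pointwise) (≤-reflexive total)
          where
          bound : Fin n → ℕ
          bound z = k′ * a z + (⟦ (Y ∩ adj G x) z ⟧ + c * ⟦ ((U ∩ members P) ∩ adj G x) z ⟧ + ⟦ adj G x z ⟧ * (inP z * degreeIn Y z))
          pointwise : ∀ z → a z * degreeIn U z ≤ bound z
          pointwise z with U z in Uz | adj G x z | members P z in z∈
          ... | false | _     | _ = z≤n
          ... | true  | false | _ = z≤n
          ... | true  | true  | true  = linear _ _ 0
                (≤-reflexive (degree-split U (members P) z) ⊕ pathDegree≤ z (members⇒∈ {l = P} z∈))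
                (identity k′ (degreeIn U z) (pathDegree z) (degreeIn Y z) e)
            where
            identity : ∀ k′ D p y e → 1 * D + (p + y + (2 * suc k′ + e)) + 0 ≡
              (k′ * 1 + (0 + (suc k′ + 1 + e) * 1 + 1 * (1 * y))) + (D + p)
            identity = solve-∀
          ... | true  | true  | false = linear _ _ 0 (degree≤ z (∧-intro Uz (not-intro z∈)))
                (identity k′ (degreeIn U z) (degreeIn Y z) e)
            where
            identity : ∀ k′ D y e → 1 * D + suc k′ + 0 ≡ (k′ * 1 + (1 + (suc k′ + 1 + e) * 0 + 1 * (0 * y))) + D
            identity = solve-∀
          total : ∑ bound ≡ k′ * degreeIn U x + (degreeIn Y x + c * pathDegree x + ∑ (λ z → ⟦ adj G x z ⟧ * (inP z * degreeIn Y z)))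
          total = trans (∑-+ (λ z → k′ * a z) _) (cong₂ _+_ (sym (*-distribˡ-sum k′ a))
            (trans (∑-+ (λ z → ⟦ (Y ∩ adj G x) z ⟧ + c * ⟦ ((U ∩ members P) ∩ adj G x) z ⟧) _) (cong (_+ ∑ (λ z → ⟦ adj G x z ⟧ * (inP z * degreeIn Y z)))
              (trans (∑-+ (λ z → ⟦ (Y ∩ adj G x) z ⟧) _) (cong (degreeIn Y x +_) (sym (*-distribˡ-sum c (λ z → ⟦ ((U ∩ members P) ∩ adj G x) z ⟧))))))))

        -- If x lies on P, its edges to Y are a part of `cross` missed by the sum over its
        -- neighbours. Otherwise x has degree at most k, and weighting all its edges by c stays
        -- below c (2 k + e).
        rest≤ : degreeIn Y x + c * pathDegree x + ∑ (λ z → ⟦ adj G x z ⟧ * (inP z * degreeIn Y z)) ≤ c * (2 * k + e) + cross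
        rest≤ with bool-cases (members P x)
        ... | inj₁ x∈P = linear _ _ 0 (degreeSum-without (U ∩ members P) Y x (∧-intro x∈U x∈P) ⊕ *-monoʳ-≤ c (pathDegree≤ x (members⇒∈ {l = P} x∈P)))
                (identity (degreeIn Y x) (c * pathDegree x) (∑ (λ z → ⟦ adj G x z ⟧ * (inP z * degreeIn Y z))) (c * (2 * k + e)) cross)
          where
          identity : ∀ d p s q t → d + p + s + (t + q) + 0 ≡ q + t + (s + d + p)
          identity = solve-∀
        ... | inj₂ x∉P = ≤-trans (≤-trans
                (degreeIn≤c* ⊕ ≤-refl {c * pathDegree x}) (≤-trans (≤-reflexive (sym (*-distribˡ-+ c (degreeIn Y x) (pathDegree x)))) (*-monoʳ-≤ c total≤)) ⊕ degreeSum-within (U ∩ members P) Y x) ≤-refl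
          where
          degreeIn≤c* : degreeIn Y x ≤ c * degreeIn Y x
          degreeIn≤c* = by-slack _ (identity k′ e (degreeIn Y x))
            where
            identity : ∀ k′ e d → d + (k′ + 1 + e) * d ≡ (suc k′ + 1 + e) * d
            identity = solve-∀
          total≤ : degreeIn Y x + pathDegree x ≤ 2 * k + e
          total≤ = ≤-trans (≤-reflexive (trans (+-comm (degreeIn Y x) (pathDegree x)) (sym (degree-split U (members P) x))))
            (≤-trans (degree≤ x (∧-intro x∈U (not-intro x∉P))) (by-slack _ (identity k e)))
            where
            identity : ∀ k e → k + (k + e) ≡ 2 * k + e
            identity = solve-∀

        -- After inserting the walk bound into richness, k′ d cancels and k′ |Y| is absorbed by k′
        -- |U|.
        Y₀-large : n + e ≤ c * (2 * k + e) + k * k + count Y₀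
        Y₀-large = linear _ _ 0
          (proj₂ rich ⊕ walks≤ ⊕ rest≤ ⊕ cross≤ ⊕ *-monoʳ-≤ k′ (count-mono {p = Y} {U} (λ v → Y⇒U)))
          (identity (n + e) (walksIn U x) (k * k) (k′ * degreeIn U x) (k′ * count U)
            (degreeIn Y x + c * pathDegree x + ∑ (λ z → ⟦ adj G x z ⟧ * (inP z * degreeIn Y z))) (c * (2 * k + e)) cross (k′ * count Y) (count Y₀))
          where
          identity : ∀ N W K D m r q x y z → N + (W + K + (D + r) + (q + x) + (y + z) + m) + 0 ≡ q + K + z + (D + m + N + W + r + x + y)
          identity = solve-∀

        -- Members of `Y₀` that agree on P have the same neighbourhood in U; the degree bound k and
        -- the minimum degree k fix its size.
        kernel : Kernel
        kernel = from-agreeing (agreeing-subset (adj G) P Y₀ k (<-≤-trans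
            (s≤s (*-monoˡ-≤ k (^-monoʳ-≤ 2 (no-long-path P P-path))))
            (+-cancelʳ-≤ (c * (2 * k + e) + k * k) _ _ (≤-trans big (≤-trans Y₀-large (≤-reflexive (+-comm (c * (2 * k + e) + k * k) (count Y₀))))))))
          where
          from-agreeing : ∃[ q ] k < count q × (∀ v → q v ≡ true → Y₀ v ≡ true) ×
            (∀ u v w → q u ≡ true → q v ≡ true → w ∈ P → adj G u w ≡ adj G v w) → Kernel
          from-agreeing (q , k<q , q⊆Y₀ , agree) = from-member (count-positive q (≤-trans (s≤s z≤n) k<q))
            where
            from-member : ∃[ y ] q y ≡ true → Kernel
            from-member (y , qy) = record
              { L = filterᵇ (adj G y) P ; R = elements q
              ; L-unique = Uniqueₚ.filter⁺ (λ u → Bool.T? (adj G y u)) (unique P-path)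
              ; R-unique = elements-unique q
              ; L⊆U = λ l∈ → P⊆U (proj₁ (L⁻ l∈))
              ; R⊆U = λ r∈ → R-in-U (∈-elements⁻ q r∈)
              ; ∣L∣≡k = ≤-antisym (≤-trans (unique⇒length≤count (U ∩ adj G y) (Uniqueₚ.filter⁺ (λ u → Bool.T? (adj G y u)) (unique P-path))
                    (λ l∈ → ∧-intro (P⊆U (proj₁ (L⁻ l∈))) (proj₂ (L⁻ l∈)))) (degree≤ y (proj₁ (∧-true (q⊆Y₀ y qy)))))
                  (≤-trans (minDegree y (R-in-U qy)) (count-cover (U ∩ adj G y) _ (λ u h → only-L qy (proj₁ (∧-true h)) (proj₂ (∧-true {U u} h)))))
              ; k<∣R∣ = ≤-trans k<q (count≤elements q)
              ; R~L = λ r∈ l∈ → trans (agree _ y _ (∈-elements⁻ q r∈) qy (proj₁ (L⁻ l∈))) (proj₂ (L⁻ l∈))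
              ; R-only-L = λ r∈ → only-L (∈-elements⁻ q r∈)
              }
              where
              L⁻ : ∀ {l} → l ∈ filterᵇ (adj G y) P → l ∈ P × adj G y l ≡ true
              L⁻ {l} l∈ with ∈-filter⁻ (λ u → Bool.T? (adj G y u)) {xs = P} l∈
              ... | l∈P , h = l∈P , T⇒true h
                where
                T⇒true : ∀ {b} → Bool.T b → b ≡ true
                T⇒true {true} _ = refl
              R-in-U : ∀ {r} → q r ≡ true → U r ≡ true
              R-in-U {r} qr = Y⇒U (proj₁ (∧-true (q⊆Y₀ r qr)))
              only-L : ∀ {r u} → q r ≡ true → U u ≡ true → r ~ u → u ∈ filterᵇ (adj G y) P
              only-L {r} {u} qr Uu r~u with bool-cases (members P u)
              ... | inj₁ u∈P = ∈-filter⁺ (λ w → Bool.T? (adj G y w)) {xs = P} (members⇒∈ {l = P} u∈P)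
                    (true⇒T (trans (agree y r u qy qr (members⇒∈ {l = P} u∈P)) r~u))
                where
                true⇒T : ∀ {b} → b ≡ true → Bool.T b
                true⇒T refl = _
              ... | inj₂ u∉P = ⊥-elim (true≢false {(Y ∩ adj G r) u} (∧-intro (∧-intro Uu (not-intro u∉P)) r~u)
                    (count-zero (Y ∩ adj G r) (≡ᵇ0 (proj₂ (∧-true {Y r} (q⊆Y₀ r qr)))) u))
                where
                ≡ᵇ0 : ∀ {m} → (m ≡ᵇ 0) ≡ true → m ≡ 0
                ≡ᵇ0 {zero} _ = refl

      with-kernel : (Kernel → ⊥) → ⊥
      with-kernel handle = maximal (λ l → Path l × l ⊆ U) length (suc (2 * k + e)) (λ l (path , _) → no-long-path l path)
        (λ P (P-path , P⊆U) longest → handle (kernel P P-path (λ {v} → P⊆U {v}) (λ l path l⊆U → longest l (path , (λ {v} → l⊆U {v})))))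
        (x ∷ []) (mkPath ([] ∷ []) [-] , λ { (here refl) → x∈U })

-- Paths zigzagging between L and its common neighbours

module _ {A : Set} where

  -- l, r₁, l₁, r₂, l₂, … followed by T
  interleave : A → List A → List A → List A → List A
  interleave l []        _        T = l ∷ T
  interleave l (_ ∷ _)   []       T = l ∷ T
  interleave l (l′ ∷ ls) (r ∷ rs) T = l ∷ r ∷ interleave l′ ls rs T

  lastOf : A → List A → A
  lastOf l []        = l
  lastOf l (l′ ∷ ls) = lastOf l′ ls

  lastOf-++ : ∀ l ms l′ → lastOf l (ms ++ l′ ∷ []) ≡ l′
  lastOf-++ l []       l′ = refl
  lastOf-++ l (m ∷ ms) l′ = lastOf-++ m ms l′

  interleave-↭ : ∀ l ls R T → length R ≡ length ls → interleave l ls R T ↭ (l ∷ ls) ++ R ++ T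
  interleave-↭ l []        []       T _  = ↭-refl
  interleave-↭ l (l′ ∷ ls) (r ∷ rs) T eq = prep l (↭-trans (prep r (interleave-↭ l′ ls rs T (suc-injective eq)))
    (↭-sym (shift r (l′ ∷ ls) (rs ++ T))))

  split-length : ∀ m (R : List A) → m < length R → ∃[ R′ ] ∃[ r ] ∃[ rest ] R ≡ R′ ++ r ∷ rest × length R′ ≡ m
  split-length zero    (r ∷ R) _       = [] , r , R , refl , refl
  split-length (suc m) (r ∷ R) (s≤s h) with R′ , r′ , rest , eq , len ← split-length m R h
    = r ∷ R′ , r′ , rest , cong (r ∷_) eq , cong suc len

  unique-++ˡ : ∀ (xs : List A) {ys} → Unique (xs ++ ys) → Unique xs
  unique-++ˡ []       _              = []
  unique-++ˡ (x ∷ xs) uniq = unique-∷ (λ x∈ → unique⇒∉ uniq (∈-++⁺ˡ x∈)) (unique-++ˡ xs (unique-tail uniq))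

module Zigzag {n} (G : Graph n) (k′ e : ℕ)
  (no-long-path : ∀ l → Adjacency.Path G l → length l ≤ suc (2 * suc k′ + e))
  (L R : List (Fin n)) (L-unique : Unique L) (R-unique : Unique R) (∣L∣≡k : length L ≡ suc k′)
  (R~L : ∀ {r l} → r ∈ R → l ∈ L → Adjacency._~_ G r l) where

  open Adjacency G

  private
    k : ℕ
    k = suc k′

  Fresh : List (Fin n) → Set
  Fresh X = ∀ {x} → x ∈ X → x ∉ L × x ∉ R

  interleave-linked : ∀ l ls R′ t T → length R′ ≡ length ls → (∀ {m} → m ∈ l ∷ ls → m ∈ L) → (∀ {r} → r ∈ R′ → r ∈ R) →
    lastOf l ls ~ t → Linked _~_ (t ∷ T) → Linked _~_ (interleave l ls R′ (t ∷ T))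
  interleave-linked l []        []       t T _  inL inR l~t lT = l~t ∷ lT
  interleave-linked l (l′ ∷ ls) (r ∷ rs) t T eq inL inR l~t lT =
    ~-sym (R~L (inR (here refl)) (inL (here refl))) ∷
    consʳ ls rs (interleave-linked l′ ls rs t T (suc-injective eq) (inL ∘ there) (inR ∘ there) l~t lT)
    where
    consʳ : ∀ ls rs → Linked _~_ (interleave l′ ls rs (t ∷ T)) → Linked _~_ (r ∷ interleave l′ ls rs (t ∷ T))
    consʳ []       _        lk = R~L (inR (here refl)) (inL (there (here refl))) ∷ lk
    consʳ (_ ∷ _)  []       lk = R~L (inR (here refl)) (inL (there (here refl))) ∷ lk
    consʳ (_ ∷ _)  (_ ∷ _)  lk = R~L (inR (here refl)) (inL (there (here refl))) ∷ lk

  -- The zigzag permutes L, R′ and the tail, so distinctness is required of the unmixed list only.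
  assemble : ∀ X l ls R′ t T → l ∷ ls ↭ L → length R′ ≡ k′ → (∀ {r} → r ∈ R′ → r ∈ R) →
    Unique (X ++ (l ∷ ls) ++ R′ ++ t ∷ T) → Linked _~_ (X ++ l ∷ []) → lastOf l ls ~ t → Linked _~_ (t ∷ T) →
    length X + (k + (k′ + length (t ∷ T))) ≤ suc (2 * k + e)
  assemble X l ls R′ t T perm len inR uniq X-linked last~t T-linked = subst (_≤ suc (2 * k + e)) total
    (no-long-path (X ++ zig) (mkPath (unique-resp-↭ (++⁺ˡ X (↭-sym zig↭)) uniq) (whole-linked X-linked)))
    where
    zig : List (Fin n)
    zig = interleave l ls R′ (t ∷ T)
    len-ls : length (l ∷ ls) ≡ k
    len-ls = trans (↭-length perm) ∣L∣≡k
    len′ : length R′ ≡ length ls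
    len′ = trans len (suc-injective (sym len-ls))
    zig↭ : zig ↭ (l ∷ ls) ++ R′ ++ t ∷ T
    zig↭ = interleave-↭ l ls R′ (t ∷ T) len′
    total : length (X ++ zig) ≡ length X + (k + (k′ + length (t ∷ T)))
    total = trans (length-++ X) (cong (length X +_) (trans (↭-length zig↭)
      (trans (length-++ (l ∷ ls)) (cong₂ _+_ len-ls (trans (length-++ R′) (cong (_+ length (t ∷ T)) len))))))
    zig-linked : Linked _~_ zig
    zig-linked = interleave-linked l ls R′ t T len′ (∈-resp-↭ perm) inR last~t T-linked
    starts : ∀ ls R′ {T} → ∃[ rest ] interleave l ls R′ T ≡ l ∷ rest
    starts []      _       = _ , refl
    starts (_ ∷ _) []      = _ , refl
    starts (_ ∷ _) (_ ∷ _) = _ , refl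
    whole-linked : Linked _~_ (X ++ l ∷ []) → Linked _~_ (X ++ zig)
    whole-linked X-linked with rest , eq ← starts ls R′ {t ∷ T} = subst (λ z → Linked _~_ (X ++ z)) (sym eq)
      (linked-join X l X-linked (subst (Linked _~_) eq zig-linked))

  L∩R : ∀ {v} → v ∈ L → v ∉ R
  L∩R v∈L v∈R = ~-irrefl (R~L v∈R v∈L)

  -- The tail is one more vertex of R, so the zigzag alone has 2 k vertices.
  from-end : ∀ X l → l ∈ L → Unique X → Fresh X → Linked _~_ (X ++ l ∷ []) → k ≤ length R →
             length X + 2 * k ≤ suc (2 * k + e)
  from-end X l l∈L X-unique fresh X-linked k≤∣R∣
    with as , bs , eqL ← ∈-∃++ l∈L | R′ , r , rest , eqR , len ← split-length k′ R k≤∣R∣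
    = subst (_≤ suc (2 * k + e)) (cong (length X +_) (identity k′))
      (assemble X l (as ++ bs) R′ r [] perm len (λ r∈ → subst (_ ∈_) (sym eqR) (∈-++⁺ˡ r∈))
        uniq X-linked (~-sym (R~L r∈R (∈-resp-↭ perm (lastOf∈ l (as ++ bs))))) [-])
    where
    identity : ∀ k′ → suc k′ + (k′ + 1) ≡ 2 * suc k′
    identity = solve-∀
    perm : l ∷ as ++ bs ↭ L
    perm = ↭-trans (↭-sym (shift l as bs)) (↭-reflexive (sym eqL))
    lastOf∈ : ∀ l (ls : List (Fin n)) → lastOf l ls ∈ l ∷ ls
    lastOf∈ l []       = here refl
    lastOf∈ l (m ∷ ls) = there (lastOf∈ m ls)
    r∈R : r ∈ R
    r∈R = subst (r ∈_) (sym eqR) (∈-++⁺ʳ R′ (here refl))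
    R″⊆R : ∀ {v} → v ∈ R′ ++ r ∷ [] → v ∈ R
    R″⊆R {v} v∈ = subst (v ∈_) (trans (++-assoc R′ (r ∷ []) rest) (sym eqR)) (∈-++⁺ˡ v∈)
    uniq : Unique (X ++ (l ∷ as ++ bs) ++ R′ ++ r ∷ [])
    uniq = Uniqueₚ.++⁺ X-unique
      (Uniqueₚ.++⁺ (unique-resp-↭ (↭-sym perm) L-unique)
        (unique-++ˡ (R′ ++ r ∷ []) (subst Unique (trans eqR (sym (++-assoc R′ (r ∷ []) rest))) R-unique))
        (λ (v∈L , v∈R) → L∩R (∈-resp-↭ perm v∈L) (R″⊆R v∈R)))
      (λ (v∈X , v∈) → disjoint v∈X (∈-++⁻ (l ∷ as ++ bs) v∈))
      where
      disjoint : ∀ {v} → v ∈ X → v ∈ l ∷ as ++ bs ⊎ v ∈ R′ ++ r ∷ [] → ⊥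
      disjoint v∈X (inj₁ v∈L) = proj₁ (fresh v∈X) (∈-resp-↭ perm v∈L)
      disjoint v∈X (inj₂ v∈R) = proj₂ (fresh v∈X) (R″⊆R v∈R)

  -- The zigzag runs through all of L from l to l′, so its ends must differ unless L is a single
  -- vertex.
  between : ∀ X t T l l′ → l ∈ L → l′ ∈ L → l ≢ l′ ⊎ (k′ ≡ 0 × l ≡ l′) → Unique (X ++ t ∷ T) → Fresh (X ++ t ∷ T) →
            Linked _~_ (X ++ l ∷ []) → l′ ~ t → Linked _~_ (t ∷ T) → k′ < length R →
            length X + (k + (k′ + length (t ∷ T))) ≤ suc (2 * k + e)
  between X t T l l′ l∈L l′∈L distinct XT-unique fresh X-linked l′~t T-linked k′<∣R∣
    with R′ , r , rest , eqR , len ← split-length k′ R k′<∣R∣ | ordering distinct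
    where
    ordering : l ≢ l′ ⊎ (k′ ≡ 0 × l ≡ l′) → ∃[ ls ] l ∷ ls ↭ L × lastOf l ls ≡ l′
    ordering (inj₁ l≢l′) with as , bs , eq ← ∈-∃++ l∈L
      with ∈-resp-↭ (shift l as bs) (subst (l′ ∈_) eq l′∈L)
    ... | here l′≡l = ⊥-elim (l≢l′ (sym l′≡l))
    ... | there l′∈ with cs , ds , eq′ ← ∈-∃++ l′∈ = (cs ++ ds) ++ l′ ∷ []
        , ↭-trans (prep l (↭-trans (++-comm (cs ++ ds) (l′ ∷ [])) (↭-trans (↭-sym (shift l′ cs ds)) (↭-reflexive (sym eq′)))))
            (↭-trans (↭-sym (shift l as bs)) (↭-reflexive (sym eq)))
        , lastOf-++ l (cs ++ ds) l′
    ordering (inj₂ (k′≡0 , refl)) = [] , single L (trans ∣L∣≡k (cong suc k′≡0)) l∈L , refl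
      where
      single : ∀ L → length L ≡ 1 → l ∈ L → l ∷ [] ↭ L
      single (_ ∷ []) _ (here refl) = ↭-refl
  ... | ls , perm , last≡ = assemble X l ls R′ t T perm len R′⊆R uniq X-linked (subst (_~ t) (sym last≡) l′~t) T-linked
    where
    R′⊆R : ∀ {v} → v ∈ R′ → v ∈ R
    R′⊆R {v} v∈ = subst (v ∈_) (sym eqR) (∈-++⁺ˡ v∈)
    uniq : Unique (X ++ (l ∷ ls) ++ R′ ++ t ∷ T)
    uniq = unique-resp-↭ reorder (Uniqueₚ.++⁺
        (Uniqueₚ.++⁺ (unique-resp-↭ (↭-sym perm) L-unique) (unique-++ˡ R′ (subst Unique eqR R-unique))
          (λ (v∈L , v∈R) → L∩R (∈-resp-↭ perm v∈L) (R′⊆R v∈R)))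
        XT-unique
        (λ (v∈LR , v∈XT) → disjoint v∈XT (∈-++⁻ (l ∷ ls) v∈LR)))
      where
      disjoint : ∀ {v} → v ∈ X ++ t ∷ T → v ∈ l ∷ ls ⊎ v ∈ R′ → ⊥
      disjoint v∈XT (inj₁ v∈L) = proj₁ (fresh v∈XT) (∈-resp-↭ perm v∈L)
      disjoint v∈XT (inj₂ v∈R) = proj₂ (fresh v∈XT) (R′⊆R v∈R)
      reorder : ((l ∷ ls) ++ R′) ++ X ++ t ∷ T ↭ X ++ (l ∷ ls) ++ R′ ++ t ∷ T
      reorder = ↭-trans (shifts ((l ∷ ls) ++ R′) X) (++⁺ˡ X (↭-reflexive (++-assoc (l ∷ ls) R′ (t ∷ T))))

-- Structure outside the clique

-- G embeds in the extremal graph with clique L and extra edge a b (present only if e = 1).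
record Skeleton {n} (G : Graph n) (k e : ℕ) : Set where
  field
    L        : List (Fin n)
    L-unique : Unique L
    ∣L∣≡k    : length L ≡ k
    a b      : Fin n
    a∉L      : a ∉ L
    b∉L      : b ∉ L
    a≢b      : a ≢ b
    outside  : ∀ u v → u ∉ L → v ∉ L → adj G u v ≡ true → e ≡ 1 × ((u ≡ a × v ≡ b) ⊎ (u ≡ b × v ≡ a))

unique₂ : ∀ {A : Set} {a b : A} → a ≢ b → Unique (a ∷ b ∷ [])
unique₂ a≢b = unique-∷ (λ { (here a≡b) → a≢b a≡b }) ([] ∷ [])

unique₃ : ∀ {A : Set} {a b c : A} → a ≢ b → a ≢ c → b ≢ c → Unique (a ∷ b ∷ c ∷ [])
unique₃ a≢b a≢c b≢c = unique-∷ (λ { (here a≡b) → a≢b a≡b ; (there (here a≡c)) → a≢c a≡c }) (unique₂ b≢c)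

unique₄ : ∀ {A : Set} {a b c d : A} → a ≢ b → a ≢ c → a ≢ d → b ≢ c → b ≢ d → c ≢ d → Unique (a ∷ b ∷ c ∷ d ∷ [])
unique₄ a≢b a≢c a≢d b≢c b≢d c≢d = unique-∷
  (λ { (here a≡b) → a≢b a≡b ; (there (here a≡c)) → a≢c a≡c ; (there (there (here a≡d))) → a≢d a≡d }) (unique₃ b≢c b≢d c≢d)

module Outside {n} (G : Graph n) (k′ e : ℕ) (x : Fin n)
  (U : Subset n) (rich : Reduction.Rich G k′ e x U) (minimal : ∀ U′ → Reduction.Rich G k′ e x U′ → count U′ < count U → ⊥) (k²<n : suc k′ * suc k′ < n)
  (no-long-path : ∀ l → Adjacency.Path G l → length l ≤ suc (2 * suc k′ + e))
  (K : Reduction.Minimal.Kernel G k′ e x U rich minimal k²<n) where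

  open Walks G
  open Reduction G k′ e x
  open Minimal U rich minimal k²<n
  open Kernel K
  open Zigzag G k′ e no-long-path L R L-unique R-unique ∣L∣≡k R~L public

  private
    k : ℕ
    k = suc k′

  O : Subset n
  O = U ∖ members L

  O⇒U : ∀ {v} → O v ≡ true → U v ≡ true
  O⇒U h = proj₁ (∧-true h)

  O⇒∉L : ∀ {v} → O v ≡ true → v ∉ L
  O⇒∉L {v} h = members⇒∉ {l = L} (not-true (proj₂ (∧-true {U v} h)))

  ∉L⇒O : ∀ {v} → U v ≡ true → v ∉ L → O v ≡ true
  ∉L⇒O Uv v∉L = ∧-intro Uv (not-intro (∉⇒members {l = L} v∉L))

  Joined : Fin n → Set
  Joined v = Any (v ~_) L

  joined? : ∀ v → Dec (Joined v)
  joined? v = any? (v ~?_) L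

  edge⇒∉R : ∀ {u v} → U u ≡ true → O v ≡ true → u ~ v → u ∉ R
  edge⇒∉R Uu Ov u~v u∈R = O⇒∉L Ov (R-only-L u∈R (O⇒U Ov) u~v)

  d-L d-O : Fin n → ℕ
  d-L = degreeIn (U ∩ members L)
  d-O = degreeIn O

  degree≡ : ∀ z → degreeIn U z ≡ d-L z + d-O z
  degree≡ = degree-split U (members L)

  private
    L-cover : ∀ {z u} → ((U ∩ members L) ∩ adj G z) u ≡ true → u ∈ L
    L-cover {z} {u} h = members⇒∈ {l = L} (proj₂ (∧-true {U u} (proj₁ (∧-true {(U ∩ members L) u} h))))

  d-L≤k : ∀ z → d-L z ≤ k
  d-L≤k z = ≤-trans (count-cover ((U ∩ members L) ∩ adj G z) L (λ u h → L-cover h)) (≤-reflexive ∣L∣≡k)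

  -- By irreflexivity this covers z = l, a vertex of L itself.
  d-L<k : ∀ z l → l ∈ L → ¬ z ~ l → d-L z ≤ k′
  d-L<k z l l∈L z≁l = from-split (∈-∃++ l∈L)
    where
    from-split : ∃[ as ] ∃[ bs ] L ≡ as ++ l ∷ bs → d-L z ≤ k′
    from-split (as , bs , eq) = s≤s⁻¹ (≤-trans (s≤s (count-cover ((U ∩ members L) ∩ adj G z) (as ++ bs) cover))
      (≤-reflexive (trans (sym (trans (cong length eq) (↭-length (shift l as bs)))) ∣L∣≡k)))
      where
      cover : ∀ u → ((U ∩ members L) ∩ adj G z) u ≡ true → u ∈ as ++ bs
      cover u h with ∈-resp-↭ (shift l as bs) (subst (u ∈_) eq (L-cover h))
      ... | here refl = contradiction (proj₂ (∧-true {(U ∩ members L) u} h)) z≁l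
      ... | there u∈  = u∈

  full-or-less : ∀ z → (∀ {l} → l ∈ L → z ~ l) ⊎ d-L z ≤ k′
  full-or-less z with any? (λ l → ¬? (z ~? l)) L
  ... | yes some = inj₂ (missing (find some))
    where
    missing : ∃[ l ] l ∈ L × ¬ z ~ l → d-L z ≤ k′
    missing (l , l∈L , z≁l) = d-L<k z l l∈L z≁l
  ... | no none = inj₁ (λ {l} l∈L → decidable-stable (z ~? l) (λ z≁l → none (lose l∈L z≁l)))

  k+∣O∣≤∣U∣ : k + count O ≤ count U
  k+∣O∣≤∣U∣ = ≤-trans (+-monoˡ-≤ (count O) (≤-trans (≤-reflexive (sym ∣L∣≡k))
      (unique⇒length≤count (U ∩ members L) L-unique (λ l∈L → ∧-intro (L⊆U l∈L) (∈⇒members {l = L} l∈L)))))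
    (≤-reflexive (sym (count-split U (members L))))

  crossing : ℕ
  crossing = degreeSum (U ∩ members L) O

  crossing≤ : crossing ≤ k * count O
  crossing≤ = ≤-trans (≤-reflexive (degreeSum-swap (U ∩ members L) O))
    (≤-trans (∑-mono (λ o → ≤-trans (*-monoʳ-≤ ⟦ O o ⟧ (d-L≤k o)) (≤-reflexive (*-comm ⟦ O o ⟧ k))))
      (≤-reflexive (sym (*-distribˡ-sum k (λ o → ⟦ O o ⟧)))))

  module _ (t : Fin n → ℕ) (degree≤ : ∀ o → O o ≡ true → degreeIn U o ≤ k + t o) where

    -- Correction to the edge count of the extremal graph: edges from x within O when x is off the
    -- clique, and excess degrees t at neighbours of x in O.
    excess : ℕ
    excess = ⟦ O x ⟧ * d-O x + ∑ (λ o → ⟦ (O ∩ adj G x) o ⟧ * t o)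

    private
      inner : Fin n → ℕ
      inner z = ⟦ adj G x z ⟧ * (⟦ (U ∩ members L) z ⟧ * d-O z)

    -- Beyond k′, a neighbour in L contributes at most its edges to O, since it has at most k′
    -- neighbours in L; a neighbour in O contributes at most 1 + t.
    walks-bound : walksIn U x ≤ k′ * degreeIn U x + (∑ inner + (d-O x + ∑ (λ o → ⟦ (O ∩ adj G x) o ⟧ * t o)))
    walks-bound = ≤-trans (∑-mono pointwise) (≤-reflexive total)
      where
      bound : Fin n → ℕ
      bound z = k′ * ⟦ (U ∩ adj G x) z ⟧ + (inner z + (⟦ (O ∩ adj G x) z ⟧ + ⟦ (O ∩ adj G x) z ⟧ * t z))
      pointwise : ∀ z → ⟦ (U ∩ adj G x) z ⟧ * degreeIn U z ≤ bound z
      pointwise z with U z in Uz | adj G x z | members L z in z∈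
      ... | false | _     | _ = z≤n
      ... | true  | false | _ = z≤n
      ... | true  | true  | true  = linear _ _ 0
            (≤-reflexive (degree≡ z) ⊕ d-L<k z z (members⇒∈ {l = L} z∈) ~-irrefl) (identity k′ (degreeIn U z) (d-L z) (d-O z))
        where
        identity : ∀ k′ D p y → 1 * D + (p + y + k′) + 0 ≡ (k′ * 1 + (1 * (1 * y) + 0)) + (D + p)
        identity = solve-∀
      ... | true  | true  | false = ≤-trans (*-monoʳ-≤ 1 (degree≤ z (∧-intro Uz (not-intro z∈)))) (by-slack 0 (identity k′ (d-O z) (t z)))
        where
        identity : ∀ k′ y t → 1 * (suc k′ + t) + 0 ≡ k′ * 1 + (1 * (0 * y) + (1 + 1 * t))
        identity = solve-∀
      total : ∑ bound ≡ k′ * degreeIn U x + (∑ inner + (d-O x + ∑ (λ o → ⟦ (O ∩ adj G x) o ⟧ * t o)))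
      total = trans (∑-+ (λ z → k′ * ⟦ (U ∩ adj G x) z ⟧) _) (cong₂ _+_ (sym (*-distribˡ-sum k′ (λ z → ⟦ (U ∩ adj G x) z ⟧)))
        (trans (∑-+ inner _) (cong (∑ inner +_) (∑-+ (λ z → ⟦ (O ∩ adj G x) z ⟧) _))))

    inner≤ : ∑ inner + d-O x ≤ crossing + ⟦ O x ⟧ * d-O x
    inner≤ with bool-cases (members L x)
    ... | inj₁ x∈L = ≤-trans (degreeSum-without (U ∩ members L) O x (∧-intro x∈U x∈L)) (m≤m+n crossing _)
    ... | inj₂ x∉L rewrite ∧-intro {U x} {not (members L x)} x∈U (not-intro x∉L) =
          degreeSum-within (U ∩ members L) O x ⊕ ≤-reflexive (sym (*-identityˡ (d-O x)))

    -- Insert the walk count into `Rich` and use k + |O| ≤ |U|. The result limits how many vertices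
    -- the reduction has deleted.
    size-bound : ∀ B → crossing + excess ≤ k * count O + B → n + e ≤ count U + B
    size-bound B h = linear _ _ 0 (proj₂ rich ⊕ walks-bound ⊕ inner≤ ⊕ h ⊕ k ⊛ k+∣O∣≤∣U∣)
      (identity k′ (n + e) (count U) (count O) (k′ * degreeIn U x) (walksIn U x) (∑ inner) (d-O x) (∑ (λ o → ⟦ (O ∩ adj G x) o ⟧ * t o)) crossing (⟦ O x ⟧ * d-O x) B)
      where
      identity : ∀ k′ N m o D W i d s c f B → N + (W + suc k′ * suc k′ + (D + (i + (d + s))) + (c + f) + (suc k′ * o + B) + suc k′ * m) + 0 ≡
        m + B + (D + k′ * m + N + W + (i + d) + (c + (f + s)) + suc k′ * (suc k′ + o))
      identity = solve-∀

  -- The at most k edges at a vertex of O go to L or stay in O; the latter, summed over O, cover the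
  -- excess.
  no-excess : (∀ o → O o ≡ true → degreeIn U o ≤ k) → n + e ≤ count U
  no-excess degree≤ = ≤-trans (size-bound (λ _ → 0) (λ o Oo → ≤-trans (degree≤ o Oo) (m≤m+n k 0)) 0
      (≤-trans (≤-trans (+-mono-≤ (≤-reflexive (degreeSum-swap (U ∩ members L) O)) excess≤) combined) (m≤m+n (k * count O) 0)))
    (≤-reflexive (+-identityʳ (count U)))
    where
    excess≤ : excess (λ _ → 0) (λ o Oo → ≤-trans (degree≤ o Oo) (m≤m+n k 0)) ≤ degreeSum O O
    excess≤ = ≤-trans (≤-reflexive (trans (cong (⟦ O x ⟧ * d-O x +_) (∑-zero (λ o → *-zeroʳ ⟦ (O ∩ adj G x) o ⟧))) (+-identityʳ _)))
      (≤-trans (≤-reflexive (sym (∑-⁅⁆ x (λ z → ⟦ O z ⟧ * d-O z)))) (∑-mono (λ z → ≤-trans (*-monoˡ-≤ (⟦ O z ⟧ * d-O z) (⟦⟧≤1 (⁅ x ⁆ z))) (≤-reflexive (*-identityˡ _)))))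
    combined : degreeSum O (U ∩ members L) + degreeSum O O ≤ k * count O
    combined = ≤-trans (≤-reflexive (sym (∑-+ (λ o → ⟦ O o ⟧ * d-L o) (λ o → ⟦ O o ⟧ * d-O o))))
      (≤-trans (∑-mono pointwise) (≤-reflexive (sym (*-distribˡ-sum k (λ o → ⟦ O o ⟧)))))
      where
      pointwise : ∀ o → ⟦ O o ⟧ * d-L o + ⟦ O o ⟧ * d-O o ≤ k * ⟦ O o ⟧
      pointwise o with O o in Oo
      ... | false = z≤n
      ... | true  = ≤-trans (≤-reflexive (trans (cong₂ _+_ (*-identityˡ (d-L o)) (*-identityˡ (d-O o))) (sym (degree≡ o))))
            (≤-trans (degree≤ o Oo) (≤-reflexive (sym (*-identityʳ k))))

  -- The connectivity argument of `all-attached`, with L in place of P.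
  all-joined : (∀ u v → O u ≡ true → Joined u → O v ≡ true → u ~ v → Joined v) → ∀ v → O v ≡ true → Joined v
  all-joined step v Ov = does-true (joined? v) (trans (sym (cong (_∨ does (joined? v)) (not-true (proj₂ (∧-true {U v} Ov)))))
    (closed⇒all D l₀ (L⊆U l₀∈L) (cong (_∨ does (joined? l₀)) (∈⇒members {l = L} l₀∈L)) D-closed v (O⇒U Ov)))
    where
    some∈L : ∃[ l ] l ∈ L
    some∈L = nonempty (subst (1 ≤_) (sym ∣L∣≡k) (s≤s z≤n))
      where
      nonempty : ∀ {l : List (Fin n)} → 1 ≤ length l → ∃[ v ] v ∈ l
      nonempty {v ∷ _} _ = v , here refl
    l₀ : Fin n
    l₀ = proj₁ some∈L
    l₀∈L : l₀ ∈ L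
    l₀∈L = proj₂ some∈L
    D : Subset n
    D v = members L v ∨ does (joined? v)
    D-closed : ∀ u v → U u ≡ true → D u ≡ true → U v ≡ true → u ~ v → D v ≡ true
    D-closed u v Uu Du Uv u~v with bool-cases (members L v)
    ... | inj₁ v∈L rewrite v∈L = refl
    ... | inj₂ v∉L rewrite v∉L = dec-true (joined? v) (from (bool-cases (members L u)))
      where
      from : members L u ≡ true ⊎ members L u ≡ false → Joined v
      from (inj₁ u∈L) = lose (members⇒∈ {l = L} u∈L) (~-sym u~v)
      from (inj₂ u∉L) = step u v (∧-intro Uu (not-intro u∉L))
        (does-true (joined? u) (trans (sym (cong (_∨ does (joined? u)) u∉L)) Du)) (∧-intro Uv (not-intro v∉L)) u~v

  k≤∣R∣ : k ≤ length R
  k≤∣R∣ = ≤-trans (n≤1+n k) k<∣R∣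

  -- A tail of 2 + e vertices in front of a zigzag of 2 k is one vertex too long.
  no-tail : ∀ X → Unique X → Fresh X → ∀ {l} → l ∈ L → Linked _~_ (X ++ l ∷ []) → 2 + e ≤ length X → ⊥
  no-tail X X-unique fresh {l} l∈L X-linked long = 1+n≰n {0} (linear _ _ 0
    (from-end X l l∈L X-unique fresh X-linked k≤∣R∣ ⊕ long) (identity k e (length X)))
    where
    identity : ∀ k e X → suc (0) + (suc (2 * k + e) + X) + 0 ≡ 0 + (X + 2 * k + (2 + e))
    identity = solve-∀

  everything : n ≤ count U → ∀ v → U v ≡ true
  everything n≤ v with bool-cases (U v)
  ... | inj₁ Uv  = Uv
  ... | inj₂ ¬Uv = contradiction n≤ (<⇒≱ (≤-trans (s≤s (count-mono {p = U} {(λ _ → true) ∖ ⁅ v ⁆} λ u Uu →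
          not-intro (dec-false (u ≟ v) λ { refl → true≢false Uu ¬Uv })))
        (≤-reflexive (trans (sym (count-remove (λ _ → true) v)) (count-full n)))))

  count≤n : count U ≤ n
  count≤n = ≤-trans (count-mono {p = U} {λ _ → true} (λ _ _ → refl)) (≤-reflexive (count-full n))

  d-O≤ : ∀ z l → (∀ u → O u ≡ true → z ~ u → u ∈ l) → d-O z ≤ length l
  d-O≤ z l cover = count-cover (O ∩ adj G z) l (λ u h → cover u (proj₁ (∧-true h)) (proj₂ (∧-true {O u} h)))

  U∌⇒fresh : ∀ {v} → U v ≡ false → v ∉ L × v ∉ R
  U∌⇒fresh ¬Uv = (λ v∈L → true≢false (L⊆U v∈L) ¬Uv) , (λ v∈R → true≢false (R⊆U v∈R) ¬Uv)

  matched⇒fresh : ∀ {u v} → O u ≡ true → O v ≡ true → u ~ v → u ∉ L × u ∉ R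
  matched⇒fresh Ou Ov u~v = O⇒∉L Ou , edge⇒∉R (O⇒U Ou) Ov u~v

  ~⇒≢ : ∀ {u v} → u ~ v → u ≢ v
  ~⇒≢ u~v refl = ~-irrefl u~v

  other : ∀ {l} → l ∈ L → ∃[ l′ ] l′ ∈ L × (l ≢ l′ ⊎ (k′ ≡ 0 × l ≡ l′))
  other {l} l∈L with any? (λ l′ → ¬? (l ≟ l′)) L
  ... | yes some with l′ , l′∈L , l≢l′ ← find some = l′ , l′∈L , inj₁ l≢l′
  ... | no none = l , l∈L , inj₂ (n≤0⇒n≡0 (s≤s⁻¹ (≤-trans (≤-reflexive (sym ∣L∣≡k))
        (≤-trans (unique⇒length≤count ⁅ l ⁆ L-unique λ {v} v∈L → dec-true (v ≟ l)
          (decidable-stable (v ≟ l) λ v≢l → none (lose v∈L (v≢l ∘ sym)))) (≤-reflexive (count-⁅⁆ l))))) , refl)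

  two∈R : ∃[ a ] ∃[ b ] a ∈ R × b ∈ R × a ≢ b
  two∈R = take-two R-unique (≤-trans (s≤s (s≤s z≤n)) k<∣R∣) (λ r∈ → r∈)
    where
    take-two : ∀ {l} → Unique l → 2 ≤ length l → (∀ {r} → r ∈ l → r ∈ R) → ∃[ a ] ∃[ b ] a ∈ R × b ∈ R × a ≢ b
    take-two {a ∷ []}    _    (s≤s ()) _
    take-two {a ∷ b ∷ _} uniq _ sub = a , b , sub (here refl) , sub (there (here refl)) , λ { refl → unique⇒∉ uniq (here refl) }

  module NoExtraEdge (e≡0 : e ≡ 0) where

    no-joined-edge : ∀ u v → O u ≡ true → Joined u → O v ≡ true → u ~ v → ⊥
    no-joined-edge u v Ou ju Ov u~v with l , l∈L , u~l ← find ju =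
      no-tail (v ∷ u ∷ []) (unique₂ (~⇒≢ (~-sym u~v)))
        (λ { (here refl) → matched⇒fresh Ov Ou (~-sym u~v) ; (there (here refl)) → matched⇒fresh Ou Ov u~v })
        l∈L (~-sym u~v ∷ u~l ∷ [-]) (≤-reflexive (cong (2 +_) e≡0))

    independent : ∀ u v → O u ≡ true → O v ≡ true → u ~ v → ⊥
    independent u v Ou Ov u~v = no-joined-edge u v Ou
      (all-joined (λ u v Ou ju Ov u~v → ⊥-elim (no-joined-edge u v Ou ju Ov u~v)) u Ou) Ov u~v

    skeleton : Skeleton G k e
    skeleton = record
      { L = L ; L-unique = L-unique ; ∣L∣≡k = ∣L∣≡k
      -- No edge lies outside L when e = 0, so any two vertices off the clique may be named.
      ; a = proj₁ two∈R ; b = proj₁ (proj₂ two∈R)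
      ; a∉L = λ a∈L → L∩R a∈L (proj₁ (proj₂ (proj₂ two∈R)))
      ; b∉L = λ b∈L → L∩R b∈L (proj₁ (proj₂ (proj₂ (proj₂ two∈R))))
      ; a≢b = proj₂ (proj₂ (proj₂ (proj₂ two∈R)))
      ; outside = λ u v u∉L v∉L u~v → ⊥-elim (independent u v (∉L⇒O (all-U u) u∉L) (∉L⇒O (all-U v) v∉L) u~v) }
      where
      degree≤k : ∀ o → O o ≡ true → degreeIn U o ≤ k
      degree≤k o Oo = ≤-trans (≤-reflexive (degree≡ o)) (≤-trans
        (d-L≤k o ⊕ d-O≤ o [] (λ u Ou o~u → ⊥-elim (independent o u Oo Ou o~u))) (≤-reflexive (+-identityʳ k)))
      all-U : ∀ v → U v ≡ true
      all-U = everything (≤-trans (m≤m+n n e) (no-excess degree≤k))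

  -- The excess 2 of the edge a b against e = 1 leaves room for one deleted vertex, so edges leaving
  -- U have to be excluded separately.
  module ExtraEdge (e≡1 : e ≡ 1) (joined : ∀ v → O v ≡ true → Joined v) (a b : Fin n) (Oa : O a ≡ true) (Ob : O b ≡ true)
    (a~b : a ~ b) (a-full : ∀ {l} → l ∈ L → a ~ l)
    (only : ∀ u v → O u ≡ true → O v ≡ true → u ~ v → (u ≡ a × v ≡ b) ⊎ (u ≡ b × v ≡ a)) where

    a≢b : a ≢ b
    a≢b = ~⇒≢ a~b

    t : Fin n → ℕ
    t o = ⟦ ⁅ a ⁆ o ⟧ + ⟦ ⁅ b ⁆ o ⟧

    d-O≤t : ∀ z → O z ≡ true → d-O z ≤ t z
    d-O≤t z Oz with z ≟ a
    ... | yes refl = ≤-trans (d-O≤ a (b ∷ []) (λ u Ou a~u → to-b u (only a u Oz Ou a~u))) (m≤m+n 1 _)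
      where
      to-b : ∀ u → (a ≡ a × u ≡ b) ⊎ (a ≡ b × u ≡ a) → u ∈ b ∷ []
      to-b u (inj₁ (_ , refl)) = here refl
      to-b u (inj₂ (a≡b , _))  = ⊥-elim (a≢b a≡b)
    ... | no z≢a with z ≟ b
    ...   | yes refl = d-O≤ b (a ∷ []) (λ u Ou b~u → to-a u (only b u Oz Ou b~u))
      where
      to-a : ∀ u → (b ≡ a × u ≡ b) ⊎ (b ≡ b × u ≡ a) → u ∈ a ∷ []
      to-a u (inj₁ (b≡a , _))  = ⊥-elim (z≢a b≡a)
      to-a u (inj₂ (_ , refl)) = here refl
    ...   | no z≢b = d-O≤ z [] (λ u Ou z~u → ⊥-elim (neither u (only z u Oz Ou z~u)))
      where
      neither : ∀ u → (z ≡ a × u ≡ b) ⊎ (z ≡ b × u ≡ a) → ⊥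
      neither u (inj₁ (z≡a , _)) = z≢a z≡a
      neither u (inj₂ (z≡b , _)) = z≢b z≡b

    t≤1 : ∀ z → t z ≤ 1
    t≤1 z with z ≟ a | z ≟ b
    ... | yes refl | yes a≡b = ⊥-elim (a≢b a≡b)
    ... | yes _    | no _    = ≤-refl
    ... | no _     | yes _   = ≤-refl
    ... | no _     | no _    = z≤n

    degree≤ : ∀ o → O o ≡ true → degreeIn U o ≤ k + t o
    degree≤ o Oo = ≤-trans (≤-reflexive (degree≡ o)) (d-L≤k o ⊕ d-O≤t o Oo)

    -- For x in O each summand is at most `d-O x ≤ 1`; otherwise the sum is at most the total of t,
    -- which is 2.
    excess≤2 : excess t degree≤ ≤ 2
    excess≤2 with bool-cases (O x)
    ... | inj₁ Ox  rewrite Ox = ≤-trans (≤-trans (≤-reflexive (+-identityʳ (d-O x))) (d-O≤t x Ox) ⊕ sum≤) (t≤1 x ⊕ t≤1 x)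
      where
      sum≤ : ∑ (λ o → ⟦ (O ∩ adj G x) o ⟧ * t o) ≤ t x
      sum≤ = ≤-trans (∑-mono (λ o → ≤-trans (*-monoʳ-≤ ⟦ (O ∩ adj G x) o ⟧ (t≤1 o)) (≤-reflexive (*-identityʳ _)))) (d-O≤t x Ox)
    ... | inj₂ ¬Ox rewrite ¬Ox = ≤-trans (∑-mono (λ o → ≤-trans (*-monoˡ-≤ (t o) (⟦⟧≤1 ((O ∩ adj G x) o))) (≤-reflexive (*-identityˡ (t o)))))
          (≤-reflexive (trans (∑-+ (λ o → ⟦ ⁅ a ⁆ o ⟧) (λ o → ⟦ ⁅ b ⁆ o ⟧)) (cong₂ _+_ (count-⁅⁆ a) (count-⁅⁆ b))))

    n≤1+∣U∣ : n ≤ suc (count U)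
    n≤1+∣U∣ = s≤s⁻¹ (≤-trans (≤-reflexive (+-comm 1 n)) (≤-trans (≤-reflexive (cong (n +_) (sym e≡1)))
      (≤-trans (size-bound t degree≤ 2 (crossing≤ ⊕ excess≤2)) (≤-reflexive (+-comm (count U) 2)))))

    one-outside : ∀ u v → u ≢ v → U u ≡ false → U v ≡ false → ⊥
    one-outside u v u≢v ¬Uu ¬Uv = 1+n≰n (≤-trans (s≤s (s≤s (count-mono {p = U} {((λ _ → true) ∖ ⁅ u ⁆) ∖ ⁅ v ⁆} λ z Uz →
        ∧-intro (not-intro (dec-false (z ≟ u) λ { refl → true≢false Uz ¬Uu })) (not-intro (dec-false (z ≟ v) λ { refl → true≢false Uz ¬Uv })))))
      (≤-trans (≤-reflexive (sym two)) n≤1+∣U∣))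
      where
      two : n ≡ suc (suc (count (((λ _ → true) ∖ ⁅ u ⁆) ∖ ⁅ v ⁆)))
      two = trans (sym (count-full n)) (trans (count-remove (λ _ → true) u) (cong suc
        (trans (count-remove ((λ _ → true) ∖ ⁅ u ⁆) v) (cong (λ c → ⟦ not c ⟧ + count (((λ _ → true) ∖ ⁅ u ⁆) ∖ ⁅ v ⁆)) (dec-false (v ≟ u) (u≢v ∘ sym))))))

    R-without : Fin n → List (Fin n)
    R-without o = filter (λ r → ¬? (r ≟ o)) R

    -- If o is a or b, then v, a, b make up a tail of three vertices. Otherwise v, o, a zigzag, a, b
    -- has 2 k + 3 vertices; o may lie in R and is taken out first, which k < |R| permits.
    dangling : ∀ v o → U v ≡ false → O o ≡ true → v ~ o → ⊥
    dangling v o ¬Uv Oo v~o with o ≟ a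
    ... | yes refl with l , l∈L , b~l ← find (joined b Ob) = no-tail (v ∷ a ∷ b ∷ [])
          (unique₃ (~⇒≢ v~o) (λ { refl → true≢false (O⇒U Ob) ¬Uv }) a≢b)
          (λ { (here refl) → U∌⇒fresh ¬Uv ; (there (here refl)) → matched⇒fresh Oa Ob a~b ; (there (there (here refl))) → matched⇒fresh Ob Oa (~-sym a~b) })
          l∈L (v~o ∷ a~b ∷ b~l ∷ [-]) (≤-reflexive (cong (2 +_) e≡1))
    ... | no o≢a with o ≟ b
    ...   | yes refl with l , l∈L , a~l ← find (joined a Oa) = no-tail (v ∷ b ∷ a ∷ [])
          (unique₃ (~⇒≢ v~o) (λ { refl → true≢false (O⇒U Oa) ¬Uv }) (a≢b ∘ sym))
          (λ { (here refl) → U∌⇒fresh ¬Uv ; (there (here refl)) → matched⇒fresh Ob Oa (~-sym a~b) ; (there (there (here refl))) → matched⇒fresh Oa Ob a~b })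
          l∈L (v~o ∷ ~-sym a~b ∷ a~l ∷ [-]) (≤-reflexive (cong (2 +_) e≡1))
    ...   | no o≢b = through (find (joined o Oo))
      where
      R⁻ : ∀ {r} → r ∈ R-without o → r ∈ R × r ≢ o
      R⁻ = ∈-filter⁻ (λ r → ¬? (r ≟ o)) {xs = R}
      module Z = Zigzag G k′ e no-long-path L (R-without o) L-unique (Uniqueₚ.filter⁺ (λ r → ¬? (r ≟ o)) R-unique) ∣L∣≡k (λ r∈ → R~L (proj₁ (R⁻ r∈)))
      enough : k′ < length (R-without o)
      enough = s≤s⁻¹ (≤-trans k<∣R∣ (≤-trans (unique⇒length≤count (members R) R-unique (∈⇒members {l = R}))
        (count-cover (members R) (o ∷ R-without o) cover)))
        where
        cover : ∀ r → members R r ≡ true → r ∈ o ∷ R-without o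
        cover r h with r ≟ o
        ... | yes refl = here refl
        ... | no r≢o   = there (∈-filter⁺ (λ r → ¬? (r ≟ o)) (members⇒∈ {l = R} h) r≢o)
      through : ∃[ l ] l ∈ L × o ~ l → ⊥
      through (l , l∈L , o~l) = finish (other l∈L)
        where
        finish : ∃[ l′ ] l′ ∈ L × (l ≢ l′ ⊎ (k′ ≡ 0 × l ≡ l′)) → ⊥
        finish (l′ , l′∈L , distinct) = 1+n≰n {0} (linear _ _ 0
            (Z.between (v ∷ o ∷ []) a (b ∷ []) l l′ l∈L l′∈L distinct
              (unique₄ (~⇒≢ v~o) (λ { refl → true≢false (O⇒U Oa) ¬Uv }) (λ { refl → true≢false (O⇒U Ob) ¬Uv }) o≢a o≢b a≢b)
              fresh (v~o ∷ o~l ∷ [-]) (~-sym (a-full l′∈L)) (a~b ∷ [-]) enough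
             ⊕ ≤-reflexive e≡1)
            (identity k′ e))
          where
          identity : ∀ k′ e → 1 + (suc (2 * suc k′ + e) + 1) + 0 ≡ 0 + (2 + (suc k′ + (k′ + 2)) + e)
          identity = solve-∀
          fresh : Z.Fresh (v ∷ o ∷ a ∷ b ∷ [])
          fresh (here refl)                         = proj₁ (U∌⇒fresh ¬Uv) , proj₂ (U∌⇒fresh ¬Uv) ∘ proj₁ ∘ R⁻
          fresh (there (here refl))                 = O⇒∉L Oo , λ r∈ → proj₂ (R⁻ r∈) refl
          fresh (there (there (here refl)))         = O⇒∉L Oa , proj₂ (matched⇒fresh Oa Ob a~b) ∘ proj₁ ∘ R⁻
          fresh (there (there (there (here refl)))) = O⇒∉L Ob , proj₂ (matched⇒fresh Ob Oa (~-sym a~b)) ∘ proj₁ ∘ R⁻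

    skeleton : Skeleton G k e
    skeleton = record
      { L = L ; L-unique = L-unique ; ∣L∣≡k = ∣L∣≡k ; a = a ; b = b ; a∉L = O⇒∉L Oa ; b∉L = O⇒∉L Ob ; a≢b = a≢b
      ; outside = λ u v u∉L v∉L u~v → e≡1 , locate u v u∉L v∉L u~v (bool-cases (U u)) (bool-cases (U v)) }
      where
      locate : ∀ u v → u ∉ L → v ∉ L → u ~ v → U u ≡ true ⊎ U u ≡ false → U v ≡ true ⊎ U v ≡ false →
               (u ≡ a × v ≡ b) ⊎ (u ≡ b × v ≡ a)
      locate u v u∉L v∉L u~v (inj₁ Uu)  (inj₁ Uv)  = only u v (∉L⇒O Uu u∉L) (∉L⇒O Uv v∉L) u~v
      locate u v u∉L v∉L u~v (inj₂ ¬Uu) (inj₁ Uv)  = ⊥-elim (dangling u v ¬Uu (∉L⇒O Uv v∉L) u~v)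
      locate u v u∉L v∉L u~v (inj₁ Uu)  (inj₂ ¬Uv) = ⊥-elim (dangling v u ¬Uv (∉L⇒O Uu u∉L) (~-sym u~v))
      locate u v u∉L v∉L u~v (inj₂ ¬Uu) (inj₂ ¬Uv) = ⊥-elim (one-outside u v (~⇒≢ u~v) ¬Uu ¬Uv)

  module FindExtraEdge (e≡1 : e ≡ 1) (1≤k′ : 1 ≤ k′) where

    no-path₃ : ∀ c b a → O c ≡ true → O b ≡ true → O a ≡ true → c ~ b → b ~ a → c ≢ a → Joined a → ⊥
    no-path₃ c b a Oc Ob Oa c~b b~a c≢a ja with l , l∈L , a~l ← find ja =
      no-tail (c ∷ b ∷ a ∷ []) (unique₃ (~⇒≢ c~b) c≢a (~⇒≢ b~a))
        (λ { (here refl) → matched⇒fresh Oc Ob c~b ; (there (here refl)) → matched⇒fresh Ob Oa b~a ; (there (there (here refl))) → matched⇒fresh Oa Ob (~-sym b~a) })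
        l∈L (c~b ∷ b~a ∷ a~l ∷ [-]) (≤-reflexive (cong (2 +_) e≡1))

    -- A vertex v with no neighbour in L has, as k ≥ 2, a second neighbour outside L, and a tail of
    -- three vertices ends in the joined u.
    joined : ∀ v → O v ≡ true → Joined v
    joined = all-joined λ u v Ou ju Ov u~v → decidable-stable (joined? v) λ ¬jv → step u v Ou ju Ov u~v ¬jv
      where
      step : ∀ u v → O u ≡ true → Joined u → O v ≡ true → u ~ v → ¬ Joined v → ⊥
      step u v Ou ju Ov u~v ¬jv = second (count-positive ((U ∩ adj G v) ∖ ⁅ u ⁆) (s≤s⁻¹ (≤-trans (s≤s 1≤k′)
          (≤-trans (minDegree v (O⇒U Ov)) (≤-trans (≤-reflexive (count-remove (U ∩ adj G v) u)) (+-monoˡ-≤ _ (⟦⟧≤1 ((U ∩ adj G v) u))))))))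
        where
        second : ∃[ w ] ((U ∩ adj G v) ∖ ⁅ u ⁆) w ≡ true → ⊥
        second (w , h) = no-path₃ w v u (∉L⇒O Uw (λ w∈L → ¬jv (lose w∈L v~w))) Ov Ou (~-sym v~w) (~-sym u~v)
            (does-false (w ≟ u) (not-true (proj₂ (∧-true {(U ∩ adj G v) w} h)))) ju
          where
          Uw : U w ≡ true
          Uw = proj₁ (∧-true (proj₁ (∧-true {(U ∩ adj G v) w} h)))
          v~w : v ~ w
          v~w = proj₂ (∧-true {U w} (proj₁ (∧-true {(U ∩ adj G v) w} h)))

    matching : ∀ a b c → O a ≡ true → O b ≡ true → O c ≡ true → a ~ b → b ~ c → a ≡ c
    matching a b c Oa Ob Oc a~b b~c = decidable-stable (a ≟ c) λ a≢c → no-path₃ a b c Oa Ob Oc a~b b~c a≢c (joined c Oc)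

    -- By `matching` another edge u v is disjoint from a b, and u, v, a zigzag, a, b has 2 k + 3
    -- vertices. Fullness of a lets the zigzag end at any vertex of L.
    only-edge : ∀ a b → O a ≡ true → O b ≡ true → a ~ b → (∀ {l} → l ∈ L → a ~ l) →
      ∀ u v → O u ≡ true → O v ≡ true → u ~ v → (u ≡ a × v ≡ b) ⊎ (u ≡ b × v ≡ a)
    only-edge a b Oa Ob a~b a-full u v Ou Ov u~v with u ≟ a | v ≟ a
    ... | yes refl | _        = inj₁ (refl , matching v a b Ov Oa Ob (~-sym u~v) a~b)
    ... | no _     | yes refl = inj₂ (matching u a b Ou Oa Ob u~v a~b , refl)
    ... | no u≢a   | no v≢a with u ≟ b | v ≟ b
    ...   | yes refl | _        = ⊥-elim (v≢a (sym (matching a b v Oa Ob Ov a~b u~v)))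
    ...   | no _     | yes refl = ⊥-elim (u≢a (matching u b a Ou Ob Oa u~v (~-sym a~b)))
    ...   | no u≢b   | no v≢b   = ⊥-elim (through (find (joined v Ov)))
      where
      through : ∃[ l ] l ∈ L × v ~ l → ⊥
      through (l , l∈L , v~l) = finish (other l∈L)
        where
        finish : ∃[ l′ ] l′ ∈ L × (l ≢ l′ ⊎ (k′ ≡ 0 × l ≡ l′)) → ⊥
        finish (l′ , l′∈L , distinct) = 1+n≰n {0} (linear _ _ 0
            (between (u ∷ v ∷ []) a (b ∷ []) l l′ l∈L l′∈L distinct
              (unique₄ (~⇒≢ u~v) u≢a u≢b v≢a v≢b (~⇒≢ a~b))
              (λ { (here refl) → matched⇒fresh Ou Ov u~v ; (there (here refl)) → matched⇒fresh Ov Ou (~-sym u~v)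
                 ; (there (there (here refl))) → matched⇒fresh Oa Ob a~b ; (there (there (there (here refl)))) → matched⇒fresh Ob Oa (~-sym a~b) })
              (u~v ∷ v~l ∷ [-]) (~-sym (a-full l′∈L)) (a~b ∷ [-]) k≤∣R∣
             ⊕ ≤-reflexive e≡1)
            (identity k′ e))
          where
          identity : ∀ k′ e → 1 + (suc (2 * suc k′ + e) + 1) + 0 ≡ 0 + (2 + (suc k′ + (k′ + 2)) + e)
          identity = solve-∀

    -- Suppose no edge in O has an end adjacent to all of L. Then each vertex of O either misses
    -- part of L and has at most one neighbour in O, or has none there. All degrees are at most k,
    -- and `no-excess` gives n + 1 ≤ |U|.
    with-skeleton : (Skeleton G k e → ⊥) → ⊥
    with-skeleton handle = 1+n≰n (≤-trans (≤-reflexive (trans (+-comm 1 n) (cong (n +_) (sym e≡1)))) (≤-trans (no-excess degree≤k) count≤n))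
      where
      no-full : ∀ a b → O a ≡ true → O b ≡ true → a ~ b → (∀ {l} → l ∈ L → a ~ l) → ⊥
      no-full a b Oa Ob a~b a-full = handle (ExtraEdge.skeleton e≡1 joined a b Oa Ob a~b a-full (only-edge a b Oa Ob a~b a-full))
      d-O≤1 : ∀ o → O o ≡ true → d-O o ≤ 1
      d-O≤1 o Oo = ≮⇒≥ λ 2≤ → two (count-positive (O ∩ adj G o) (≤-trans (s≤s z≤n) 2≤)) 2≤
        where
        two : ∃[ u ] (O ∩ adj G o) u ≡ true → 2 ≤ d-O o → ⊥
        two (u , h) 2≤ = <⇒≱ 2≤ (d-O≤ o (u ∷ []) λ v Ov o~v →
          here (matching v o u Ov Oo (proj₁ (∧-true h)) (~-sym o~v) (proj₂ (∧-true {O u} h))))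
      degree≤k : ∀ o → O o ≡ true → degreeIn U o ≤ k
      degree≤k o Oo with full-or-less o
      ... | inj₂ few = ≤-trans (≤-reflexive (degree≡ o)) (≤-trans (few ⊕ d-O≤1 o Oo) (≤-reflexive (+-comm k′ 1)))
      ... | inj₁ full = ≤-trans (≤-reflexive (degree≡ o)) (≤-trans
            (d-L≤k o ⊕ d-O≤ o [] (λ u Ou o~u → ⊥-elim (no-full o u Oo Ou o~u full))) (≤-reflexive (+-identityʳ k)))

-- One clique vertex and one extra edge

module StarWithEdge {n} (G : Graph n) (x : Fin n)
  (U : Subset n) (rich : Reduction.Rich G 0 1 x U) (minimal : ∀ U′ → Reduction.Rich G 0 1 x U′ → count U′ < count U → ⊥) (16≤n : 16 ≤ n)
  (no-long-path : ∀ l → Adjacency.Path G l → length l ≤ 4) where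

  open Walks G

  private
    1<n : 1 < n
    1<n = ≤-trans (s≤s (s≤s z≤n)) 16≤n
  open Reduction G 0 1 x
  open Minimal U rich minimal 1<n

  ~⇒≢ : ∀ {u v} → u ~ v → u ≢ v
  ~⇒≢ u~v refl = ~-irrefl u~v

  no-path₅ : ∀ {a b c d f} → a ~ b → b ~ c → c ~ d → d ~ f →
    a ≢ c → a ≢ d → a ≢ f → b ≢ d → b ≢ f → c ≢ f → ⊥
  no-path₅ {a} {b} {c} {d} {f} a~b b~c c~d d~f a≢c a≢d a≢f b≢d b≢f c≢f = 1+n≰n (no-long-path (a ∷ b ∷ c ∷ d ∷ f ∷ []) (mkPath
    (unique-∷ (λ { (here refl) → ~-irrefl a~b ; (there (here refl)) → a≢c refl ; (there (there (here refl))) → a≢d refl ; (there (there (there (here refl)))) → a≢f refl })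
      (unique₄ (~⇒≢ b~c) b≢d b≢f (~⇒≢ c~d) c≢f (~⇒≢ d~f)))
    (a~b ∷ b~c ∷ c~d ∷ d~f ∷ [-])))

  n≤walks : n ≤ walksIn U x
  n≤walks = s≤s⁻¹ (≤-trans (≤-reflexive (+-comm 1 n)) (≤-trans (proj₂ rich) (≤-reflexive (+-comm (walksIn U x) 1))))

  -- On at most four vertices there are at most 3 · 4 = 12 two-step walks from x, fewer than 16.
  5≤∣U∣ : 5 ≤ count U
  5≤∣U∣ = ≰⇒> λ m≤4 → <⇒≱ (≤-trans (s≤s (s≤s (s≤s (s≤s (s≤s (s≤s (s≤s (s≤s (s≤s (s≤s (s≤s (s≤s (s≤s z≤n))))))))))))) 16≤n)
    (≤-trans n≤walks (≤-trans (m≤m+n (walksIn U x) (degreeIn U x)) (≤-trans (walks≤degree*size U x)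
      (*-mono-≤ (s≤s⁻¹ (≤-trans (degree<size U x x∈U) m≤4)) m≤4))))

  not-covered : ∀ l → length l ≤ 4 → (∀ v → U v ≡ true → members l v ≡ true) → ⊥
  not-covered l short cover = <⇒≱ 5≤∣U∣ (≤-trans (count-cover U l (λ v Uv → members⇒∈ {l = l} (cover v Uv))) short)

  -- U is connected and has at least five vertices, so some vertex off the cycle is adjacent to it;
  -- opening the cycle there gives a path on five vertices.
  no-square : ∀ {a b c d} → U a ≡ true → a ~ b → b ~ c → c ~ d → d ~ a → a ≢ c → b ≢ d → ⊥
  no-square {a} {b} {c} {d} Ua a~b b~c c~d d~a a≢c b≢d = not-covered corners ≤-refl
    (closed⇒all (members corners) a Ua (∈⇒members {l = corners} (here refl)) λ u v _ u∈ _ u~v → ∈⇒members {l = corners}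
      (decidable-stable (v ∈? corners) λ v∉ → leave v v∉ u~v (members⇒∈ {l = corners} u∈)))
    where
    corners : List (Fin n)
    corners = a ∷ b ∷ c ∷ d ∷ []
    leave : ∀ {u} v → v ∉ corners → u ~ v → u ∈ corners → ⊥
    leave v v∉ u~v (here refl) = no-path₅ (~-sym u~v) a~b b~c c~d
      (v∉ ∘ there ∘ here) (v∉ ∘ there ∘ there ∘ here) (v∉ ∘ there ∘ there ∘ there ∘ here) a≢c (~⇒≢ (~-sym d~a)) b≢d
    leave v v∉ u~v (there (here refl)) = no-path₅ (~-sym u~v) b~c c~d d~a
      (v∉ ∘ there ∘ there ∘ here) (v∉ ∘ there ∘ there ∘ there ∘ here) (v∉ ∘ here) b≢d (~⇒≢ (~-sym a~b)) (a≢c ∘ sym)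
    leave v v∉ u~v (there (there (here refl))) = no-path₅ (~-sym u~v) c~d d~a a~b
      (v∉ ∘ there ∘ there ∘ there ∘ here) (v∉ ∘ here) (v∉ ∘ there ∘ here) (a≢c ∘ sym) (~⇒≢ (~-sym b~c)) (b≢d ∘ sym)
    leave v v∉ u~v (there (there (there (here refl)))) = no-path₅ (~-sym u~v) d~a a~b b~c
      (v∉ ∘ here) (v∉ ∘ there ∘ here) (v∉ ∘ there ∘ there ∘ here) (b≢d ∘ sym) (~⇒≢ (~-sym c~d)) a≢c

  module _ (handle : Skeleton G 1 1 → ⊥) where

    -- A triangle with a further neighbour o of t forces U to be a star at t with the edge p q, as
    -- any other vertex or edge completes a path on five vertices. The kernel is t with the
    -- remaining leaves.
    center : ∀ t p q o → U t ≡ true → U p ≡ true → U q ≡ true → U o ≡ true → t ~ p → p ~ q → q ~ t →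
             o ∉ t ∷ p ∷ q ∷ [] → o ~ t → ⊥
    center t p q o Ut Up Uq Uo t~p p~q q~t o∉ o~t =
      handle (Outside.ExtraEdge.skeleton G 0 1 x U rich minimal 1<n no-long-path K
        refl joined p q Op Oq p~q (λ { (here refl) → ~-sym t~p }) only)
      where
      corners : List (Fin n)
      corners = t ∷ p ∷ q ∷ []
      t≢p : t ≢ p
      t≢p = ~⇒≢ t~p
      t≢q : t ≢ q
      t≢q = ~⇒≢ (~-sym q~t)
      D : Subset n
      D v = members corners v ∨ adj G t v
      D-cases : ∀ v → D v ≡ true → v ∈ corners ⊎ (v ∉ corners × t ~ v)
      D-cases v Dv with bool-cases (members corners v)
      ... | inj₁ v∈corners = inj₁ (members⇒∈ {l = corners} v∈corners)
      ... | inj₂ v∉corners = inj₂ (members⇒∉ {l = corners} v∉corners , trans (sym (cong (_∨ adj G t v) v∉corners)) Dv)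
      leave : ∀ {u} v → u ∈ corners ⊎ (u ∉ corners × t ~ u) → u ~ v → v ∉ corners → ¬ t ~ v → ⊥
      leave v (inj₁ (here refl)) u~v v∉corners t≁v = t≁v u~v
      leave v (inj₁ (there (here refl))) u~v v∉corners t≁v with v ≟ o
      ... | yes refl = t≁v (~-sym o~t)
      ... | no v≢o   = no-path₅ o~t (~-sym q~t) (~-sym p~q) u~v (o∉ ∘ there ∘ there ∘ here) (o∉ ∘ there ∘ here) (v≢o ∘ sym) t≢p
                         (λ { refl → v∉corners (here refl) }) (λ { refl → v∉corners (there (there (here refl))) })
      leave v (inj₁ (there (there (here refl)))) u~v v∉corners t≁v with v ≟ o
      ... | yes refl = t≁v (~-sym o~t)
      ... | no v≢o   = no-path₅ o~t t~p p~q u~v (o∉ ∘ there ∘ here) (o∉ ∘ there ∘ there ∘ here) (v≢o ∘ sym) t≢q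
                         (λ { refl → v∉corners (here refl) }) (λ { refl → v∉corners (there (here refl)) })
      leave v (inj₂ (u∉corners , t~u)) u~v v∉corners t≁v = no-path₅ (~-sym u~v) (~-sym t~u) t~p p~q (v∉corners ∘ here) (v∉corners ∘ there ∘ here) (v∉corners ∘ there ∘ there ∘ here)
        (u∉corners ∘ there ∘ here) (u∉corners ∘ there ∘ there ∘ here) t≢q
      D-closed : ∀ u v → U u ≡ true → D u ≡ true → U v ≡ true → u ~ v → D v ≡ true
      D-closed u v _ Du _ u~v with bool-cases (members corners v)
      ... | inj₁ v∈corners = cong (_∨ adj G t v) v∈corners
      ... | inj₂ v∉corners = trans (cong (_∨ adj G t v) v∉corners) (decidable-stable (t ~? v) (leave v (D-cases u Du) u~v (members⇒∉ {l = corners} v∉corners)))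
      all-D : ∀ v → U v ≡ true → D v ≡ true
      all-D = closed⇒all D t Ut (cong (_∨ adj G t t) (∈⇒members {l = corners} (here refl))) D-closed
      pendant : ∀ v → U v ≡ true → v ∉ corners → t ~ v
      pendant v Uv v∉corners = from (D-cases v (all-D v Uv))
        where
        from : v ∈ corners ⊎ (v ∉ corners × t ~ v) → t ~ v
        from (inj₁ v∈corners)       = ⊥-elim (v∉corners v∈corners)
        from (inj₂ (_ , t~v)) = t~v
      Rset : Subset n
      Rset = U ∖ members corners
      R⁻ : ∀ {r} → r ∈ elements Rset → U r ≡ true × r ∉ corners
      R⁻ {r} r∈ = proj₁ (∧-true (∈-elements⁻ Rset r∈)) , members⇒∉ {l = corners} (not-true (proj₂ (∧-true {U r} (∈-elements⁻ Rset r∈))))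
      only-t : ∀ r u → U r ≡ true → r ∉ corners → U u ≡ true → r ~ u → u ∈ t ∷ []
      only-t r u Ur r∉corners Uu r~u with u ∈? corners
      ... | yes (here refl)                 = here refl
      ... | yes (there (here refl))         = ⊥-elim (no-square Ur (~-sym (pendant r Ur r∉corners)) (~-sym q~t) (~-sym p~q) (~-sym r~u) (r∉corners ∘ there ∘ there ∘ here) t≢p)
      ... | yes (there (there (here refl))) = ⊥-elim (no-square Ur (~-sym (pendant r Ur r∉corners)) t~p p~q (~-sym r~u) (r∉corners ∘ there ∘ here) t≢q)
      ... | no u∉corners = ⊥-elim (no-path₅ (~-sym r~u) (~-sym (pendant r Ur r∉corners)) t~p p~q (u∉corners ∘ here) (u∉corners ∘ there ∘ here) (u∉corners ∘ there ∘ there ∘ here)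
            (r∉corners ∘ there ∘ here) (r∉corners ∘ there ∘ there ∘ here) t≢q)
      K : Kernel
      K = record
        { L = t ∷ [] ; R = elements Rset ; L-unique = [] ∷ [] ; R-unique = elements-unique Rset
        ; L⊆U = λ { (here refl) → Ut } ; R⊆U = λ r∈ → proj₁ (R⁻ r∈) ; ∣L∣≡k = refl
        ; k<∣R∣ = +-cancelˡ-≤ 3 2 _ (≤-trans 5≤∣U∣ (count-cover U (corners ++ elements Rset) cover))
        ; R~L = λ { r∈ (here refl) → ~-sym (pendant _ (proj₁ (R⁻ r∈)) (proj₂ (R⁻ r∈))) }
        ; R-only-L = λ r∈ → only-t _ _ (proj₁ (R⁻ r∈)) (proj₂ (R⁻ r∈)) }
        where
        cover : ∀ v → U v ≡ true → v ∈ corners ++ elements Rset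
        cover v Uv with bool-cases (members corners v)
        ... | inj₁ v∈corners = ∈-++⁺ˡ (members⇒∈ {l = corners} v∈corners)
        ... | inj₂ v∉corners = ∈-++⁺ʳ corners (∈-elements⁺ Rset (∧-intro Uv (not-intro v∉corners)))
      O : Subset n
      O = U ∖ members (t ∷ [])
      O⁻ : ∀ {v} → O v ≡ true → U v ≡ true × v ≢ t
      O⁻ {v} h = proj₁ (∧-true h) , λ { refl → members⇒∉ {l = t ∷ []} (not-true (proj₂ (∧-true {U v} h))) (here refl) }
      O⁺ : ∀ {v} → U v ≡ true → v ≢ t → O v ≡ true
      O⁺ Uv v≢t = ∧-intro Uv (not-intro (∉⇒members {l = t ∷ []} λ { (here v≡t) → v≢t v≡t }))
      Op : O p ≡ true
      Op = O⁺ Up (t≢p ∘ sym)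
      Oq : O q ≡ true
      Oq = O⁺ Uq (t≢q ∘ sym)
      joined : ∀ v → O v ≡ true → Outside.Joined G 0 1 x U rich minimal 1<n no-long-path K v
      joined v Ov with v ∈? corners
      ... | yes (here refl)                 = ⊥-elim (proj₂ (O⁻ Ov) refl)
      ... | yes (there (here refl))         = here (~-sym t~p)
      ... | yes (there (there (here refl))) = here q~t
      ... | no v∉corners                          = here (~-sym (pendant v (proj₁ (O⁻ Ov)) v∉corners))
      only : ∀ u v → O u ≡ true → O v ≡ true → u ~ v → (u ≡ p × v ≡ q) ⊎ (u ≡ q × v ≡ p)
      only u v Ou Ov u~v with u ∈? corners | v ∈? corners
      ... | yes (here refl) | _ = ⊥-elim (proj₂ (O⁻ Ou) refl)
      ... | _ | yes (here refl) = ⊥-elim (proj₂ (O⁻ Ov) refl)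
      ... | no u∉corners | _ = ⊥-elim (absurd (only-t u v (proj₁ (O⁻ Ou)) u∉corners (proj₁ (O⁻ Ov)) u~v))
        where
        absurd : v ∈ t ∷ [] → ⊥
        absurd (here refl) = proj₂ (O⁻ Ov) refl
      ... | _ | no v∉corners = ⊥-elim (absurd (only-t v u (proj₁ (O⁻ Ov)) v∉corners (proj₁ (O⁻ Ou)) (~-sym u~v)))
        where
        absurd : u ∈ t ∷ [] → ⊥
        absurd (here refl) = proj₂ (O⁻ Ou) refl
      ... | yes (there (here refl))         | yes (there (here refl))         = ⊥-elim (~-irrefl u~v)
      ... | yes (there (here refl))         | yes (there (there (here refl))) = inj₁ (refl , refl)
      ... | yes (there (there (here refl))) | yes (there (here refl))         = inj₂ (refl , refl)
      ... | yes (there (there (here refl))) | yes (there (there (here refl))) = ⊥-elim (~-irrefl u~v)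

    -- Either a further vertex is adjacent to a corner, which then serves as `center`, or U has only
    -- three vertices.
    no-triangle : ∀ a b c → U a ≡ true → U b ≡ true → U c ≡ true → a ~ b → b ~ c → c ~ a → ⊥
    no-triangle a b c Ua Ub Uc a~b b~c c~a = not-covered corners (s≤s (s≤s (s≤s z≤n)))
      (closed⇒all (members corners) a Ua (∈⇒members {l = corners} (here refl)) λ u v _ u∈ Uv u~v → ∈⇒members {l = corners}
        (decidable-stable (v ∈? corners) λ v∉ → leave v Uv v∉ u~v (members⇒∈ {l = corners} u∈)))
      where
      corners : List (Fin n)
      corners = a ∷ b ∷ c ∷ []
      leave : ∀ {u} v → U v ≡ true → v ∉ corners → u ~ v → u ∈ corners → ⊥
      leave v Uv v∉ u~v (here refl) = center a b c v Ua Ub Uc Uv a~b b~c c~a v∉ (~-sym u~v)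
      leave v Uv v∉ u~v (there (here refl)) = center b c a v Ub Uc Ua Uv b~c c~a a~b
        (λ { (here refl) → v∉ (there (here refl)) ; (there (here refl)) → v∉ (there (there (here refl))) ; (there (there (here refl))) → v∉ (here refl) }) (~-sym u~v)
      leave v Uv v∉ u~v (there (there (here refl))) = center c a b v Uc Ua Ub Uv c~a a~b b~c
        (λ { (here refl) → v∉ (there (there (here refl))) ; (there (here refl)) → v∉ (here refl) ; (there (there (here refl))) → v∉ (there (here refl)) }) (~-sym u~v)

    N : Subset n
    N = U ∩ adj G x

    -- Two common neighbours of x and y close a four-cycle, and one of them with the edge x y a
    -- triangle.
    few-common : ∀ y → U y ≡ true → y ≢ x → degreeIn N y + ⟦ adj G x y ⟧ ≤ 1
    few-common y Uy y≢x with adj G x y in x~y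
    ... | true  = ≮⇒≥ λ 2≤ → one (count-positive (N ∩ adj G y) (s≤s⁻¹ (≤-trans 2≤ (≤-reflexive (+-comm (degreeIn N y) 1)))))
      where
      one : ∃[ z ] (N ∩ adj G y) z ≡ true → ⊥
      one (z , h) = no-triangle x y z x∈U Uy (proj₁ (∧-true (proj₁ (∧-true {N z} h)))) x~y (proj₂ (∧-true {N z} h)) (~-sym (proj₂ (∧-true {U z} (proj₁ (∧-true {N z} h)))))
    ... | false = ≮⇒≥ λ 2≤ → one (≤-trans 2≤ (≤-reflexive (+-identityʳ (degreeIn N y)))) (count-positive (N ∩ adj G y) (≤-trans (s≤s z≤n) (≤-trans 2≤ (≤-reflexive (+-identityʳ (degreeIn N y))))))
      where
      one : 2 ≤ degreeIn N y → ∃[ z ] (N ∩ adj G y) z ≡ true → ⊥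
      one 2≤ (z , h) = two (count-positive ((N ∩ adj G y) ∖ ⁅ z ⁆) (s≤s⁻¹ (≤-trans 2≤ (≤-trans (≤-reflexive (count-remove (N ∩ adj G y) z)) (+-monoˡ-≤ _ (⟦⟧≤1 ((N ∩ adj G y) z)))))))
        where
        two : ∃[ z′ ] ((N ∩ adj G y) ∖ ⁅ z ⁆) z′ ≡ true → ⊥
        two (z′ , h′) = no-square x∈U (proj₂ (∧-true {U z} (proj₁ (∧-true {N z} h)))) (~-sym (proj₂ (∧-true {N z} h)))
            (proj₂ (∧-true {N z′} g)) (~-sym (proj₂ (∧-true {U z′} (proj₁ (∧-true {N z′} g))))) (y≢x ∘ sym)
            (does-false (z′ ≟ z) (not-true (proj₂ (∧-true {(N ∩ adj G y) z′} h′))) ∘ sym)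
          where
          g : (N ∩ adj G y) z′ ≡ true
          g = proj₁ (∧-true {(N ∩ adj G y) z′} h′)

    -- Walks are counted by their end y. Each y ≠ x accounts for at most one, or none if y is
    -- adjacent to x; that saving pays for the closed walks at x. The total is below |U|, hence
    -- below n.
    conclusion : ⊥
    conclusion = <⇒≱ walks<n n≤walks
      where
      pointwise : ∀ y → ⟦ U y ⟧ * degreeIn N y + ⟦ N y ⟧ ≤ ⟦ (U ∖ ⁅ x ⁆) y ⟧ + ⟦ ⁅ x ⁆ y ⟧ * degreeIn N y
      pointwise y with U y in Uy
      ... | false = z≤n
      ... | true  with y ≟ x
      ...   | yes refl rewrite irrefl G y = ≤-reflexive (+-identityʳ (degreeIn N y + 0))
      ...   | no y≢x = ≤-trans (≤-reflexive (cong (_+ ⟦ adj G x y ⟧) (*-identityˡ (degreeIn N y)))) (few-common y Uy y≢x)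
      walks<n : walksIn U x < n
      walks<n = +-cancelʳ-≤ (degreeIn U x) (suc (walksIn U x)) n (≤-trans (s≤s (≤-trans
          (≤-reflexive (trans (cong (_+ degreeIn U x) (degreeSum-swap N U)) (sym (∑-+ (λ y → ⟦ U y ⟧ * degreeIn N y) (λ y → ⟦ N y ⟧)))))
          (≤-trans (∑-mono pointwise) (≤-reflexive (trans (∑-+ (λ y → ⟦ (U ∖ ⁅ x ⁆) y ⟧) (λ y → ⟦ ⁅ x ⁆ y ⟧ * degreeIn N y))
            (cong (count (U ∖ ⁅ x ⁆) +_) (∑-⁅⁆ x (degreeIn N))))))))
        (smaller x x∈U ⊕ count-mono {p = N ∩ adj G x} {N} (λ v h → proj₁ (∧-true {N v} h)) |> λ le →
          ≤-trans le (+-monoˡ-≤ (degreeIn U x) (≤-trans (count-mono {p = U} {λ _ → true} (λ _ _ → refl)) (≤-reflexive (count-full n))))))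

-- Embedding into the extremal graph

any-vec? : ∀ {n} r {P : Vec (Fin n) r → Set} → (∀ v → Dec (P v)) → Dec (∃[ v ] P v)
any-vec? zero    P? = map′ (λ p → [] , p) (λ { ([] , p) → p }) (P? [])
any-vec? (suc r) P? = map′ (λ (x , v , p) → x ∷ v , p) (λ { (x ∷ v , p) → x , v , p })
  (Finₚ.any? (λ x → any-vec? r (λ v → P? (x ∷ v))))

-- The search runs over vectors, which unlike functions are enumerated up to propositional equality.
-- Decidability turns the refutation of path-freeness into an actual path.
⊑-dec : ∀ {m n} (H : Graph m) (G : Graph n) → Dec (H ⊑ G)
⊑-dec {m} {n} H G = map′ from-vec to-vec (any-vec? m embeds?)
  where
  Embeds : (Fin m → Fin n) → Set
  Embeds f = (∀ i j → f i ≡ f j → i ≡ j) × (∀ i j → adj H i j ≡ true → adj G (f i) (f j) ≡ true)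
  embeds? : ∀ v → Dec (Embeds (Vec.lookup v))
  embeds? v = Finₚ.all? (λ i → Finₚ.all? (λ j → (Vec.lookup v i ≟ Vec.lookup v j) →-dec (i ≟ j)))
    ×-dec Finₚ.all? (λ i → Finₚ.all? (λ j → (adj H i j Bool.≟ true) →-dec (adj G (Vec.lookup v i) (Vec.lookup v j) Bool.≟ true)))
  from-vec : ∃[ v ] Embeds (Vec.lookup v) → H ⊑ G
  from-vec (v , inj , edges) = Vec.lookup v , (λ {i} {j} → inj i j) , edges
  to-vec : H ⊑ G → ∃[ v ] Embeds (Vec.lookup v)
  to-vec (f , inj , edges) = Vec.tabulate f
    , (λ i j eq → inj (trans (sym (Vecₚ.lookup∘tabulate f i)) (trans eq (Vecₚ.lookup∘tabulate f j))))
    , (λ i j e → subst₂ (λ a b → adj G a b ≡ true) (sym (Vecₚ.lookup∘tabulate f i)) (sym (Vecₚ.lookup∘tabulate f j)) (edges i j e))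

lookup-injective : ∀ {A : Set} {l : List A} → Unique l → ∀ i j → lookup l i ≡ lookup l j → i ≡ j
lookup-injective (x∉ ∷ u) zero    zero    eq = refl
lookup-injective {l = x ∷ l} (x∉ ∷ u) zero    (suc j) eq = contradiction eq (All.lookup x∉ (∈-lookup {xs = l} j))
lookup-injective {l = x ∷ l} (x∉ ∷ u) (suc i) zero    eq = contradiction (sym eq) (All.lookup x∉ (∈-lookup {xs = l} i))
lookup-injective (x∉ ∷ u) (suc i) (suc j) eq = cong suc (lookup-injective u i j eq)

linked-lookup : ∀ {A : Set} {R : A → A → Set} {l} → Linked R l → ∀ i j → suc (toℕ i) ≡ toℕ j → R (lookup l i) (lookup l j)
linked-lookup (r ∷ l) zero    (suc zero)    _  = r
linked-lookup (r ∷ l) (suc i) (suc j)       eq = linked-lookup l i j (suc-injective eq)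
linked-lookup [-]     zero    (suc ())

module _ {n} (G : Graph n) where
  open Adjacency G

  path⊑ : ∀ r l → Path l → r ≤ length l → path r ⊑ G
  path⊑ r l p r≤ = f , inj , edges
    where
    f : Fin r → Fin n
    f i = lookup l (inject≤ i r≤)
    inj : ∀ {i j} → f i ≡ f j → i ≡ j
    inj {i} {j} eq = Finₚ.inject≤-injective r≤ r≤ i j (lookup-injective (unique p) (inject≤ i r≤) (inject≤ j r≤) eq)
    consecutive : ∀ i j → (suc (toℕ i) ≡ᵇ toℕ j) ≡ true → adj G (f i) (f j) ≡ true
    consecutive i j h = linked-lookup (linked p) (inject≤ i r≤) (inject≤ j r≤)
      (trans (cong suc (Finₚ.toℕ-inject≤ i r≤)) (trans (≡ᵇ⇒≡ _ _ (subst T (sym h) _)) (sym (Finₚ.toℕ-inject≤ j r≤))))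
    edges : ∀ i j → adj (path r) i j ≡ true → adj G (f i) (f j) ≡ true
    edges i j h with suc (toℕ i) ≡ᵇ toℕ j in eq
    ... | true  = consecutive i j eq
    ... | false = ~-sym (consecutive j i h)

-- Positions in the lists L and M serve as the vertices of the extremal graph.
module Placement {n} (G : Graph n) (e : Bool) (L M : List (Fin n)) (L-unique : Unique L) (M-unique : Unique M)
  (disjoint : ∀ {v} → v ∈ L → v ∉ M) (covering : ∀ v → v ∉ L → v ∈ M) where

  place : Fin n → Fin (length L) ⊎ Fin (length M)
  place v with v ∈? L
  ... | yes v∈L = inj₁ (index v∈L)
  ... | no v∉L  = inj₂ (index (covering v v∉L))

  at : Fin (length L) ⊎ Fin (length M) → Fin n
  at = [ lookup L , lookup M ]′

  at-place : ∀ v → at (place v) ≡ v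
  at-place v with v ∈? L
  ... | yes v∈L = sym (lookup-index v∈L)
  ... | no v∉L  = sym (lookup-index (covering v v∉L))

  place-at : ∀ s → place (at s) ≡ s
  place-at (inj₁ i) with lookup L i ∈? L
  ... | yes v∈L = cong inj₁ (lookup-injective L-unique (index v∈L) i (sym (lookup-index v∈L)))
  ... | no v∉L  = contradiction (∈-lookup {xs = L} i) v∉L
  place-at (inj₂ j) with lookup M j ∈? L
  ... | yes v∈L = contradiction (∈-lookup {xs = M} j) (disjoint v∈L)
  ... | no v∉L  = cong inj₂ (lookup-injective M-unique (index (covering _ v∉L)) j (sym (lookup-index (covering _ v∉L))))

  placement : Fin n ↔ Fin (length L + length M)
  placement = ↔-sym Finₚ.+↔⊎ ↔-∘ mk↔ₛ′ place at place-at at-place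

  T′ : Graph (length L + length M)
  T′ = extremal e (length L) (length M)

  module _ (outside : ∀ u v → u ∉ L → v ∉ L → adj G u v ≡ true →
              ∃[ i ] ∃[ j ] lookup M i ≡ u × lookup M j ≡ v × adj (extraEdge e (length M)) i j ≡ true) where

    placement-edges : ∀ u v → adj G u v ≡ true → adj T′ (Inverse.to placement u) (Inverse.to placement v) ≡ true
    placement-edges u v h with u ∈? L | v ∈? L
    ... | yes u∈L | yes v∈L = trans (join-ˡˡ (complete (length L)) (extraEdge e (length M)) (index u∈L) (index v∈L))
          (cong not (dec-false (index u∈L ≟ index v∈L) λ eq → Adjacency.~-irrefl G (subst (λ w → adj G u w ≡ true)
            (sym (trans (lookup-index u∈L) (trans (cong (lookup L) eq) (sym (lookup-index v∈L))))) h)))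
    ... | yes u∈L | no v∉L  = join-ˡʳ (complete (length L)) (extraEdge e (length M)) (index u∈L) (index (covering v v∉L))
    ... | no u∉L  | yes v∈L = join-ʳˡ (complete (length L)) (extraEdge e (length M)) (index (covering u u∉L)) (index v∈L)
    ... | no u∉L  | no v∉L with i , j , refl , refl , edge ← outside u v u∉L v∉L h =
          trans (join-ʳʳ (complete (length L)) (extraEdge e (length M)) (index (covering u u∉L)) (index (covering v v∉L)))
            (trans (cong₂ (adj (extraEdge e (length M)))
              (lookup-injective M-unique _ i (sym (lookup-index (covering u u∉L))))
              (lookup-injective M-unique _ j (sym (lookup-index (covering v v∉L))))) edge)

Embedding : ∀ {n} → Graph n → Bool → ℕ → ℕ → Set
Embedding {n} G e k N = Σ (Fin n ↔ Fin (k + N))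
  λ π → ∀ u v → adj G u v ≡ true → adj (extremal e k N) (Inverse.to π u) (Inverse.to π v) ≡ true

module _ {n} (G : Graph n) (e : Bool) (k N : ℕ) (n≡k+N : n ≡ k + N) where

  skeleton⇒embedding : Skeleton G k ⟦ e ⟧ → Embedding G e k N
  skeleton⇒embedding skeleton = resize ∣L∣≡k ∣M∣≡N (placement , placement-edges outside-M)
    where
    open Skeleton skeleton
    rest : List (Fin n)
    rest = elements ((λ _ → true) ∖ members (L ++ a ∷ b ∷ []))
    M : List (Fin n)
    -- `oneEdge` joins the vertices 0 and 1, so the ends of the extra edge come first.
    M = a ∷ b ∷ rest
    rest⁻ : ∀ {v} → v ∈ rest → v ∉ L ++ a ∷ b ∷ []
    rest⁻ v∈ = members⇒∉ {l = L ++ a ∷ b ∷ []} (not-true (∈-elements⁻ ((λ _ → true) ∖ members (L ++ a ∷ b ∷ [])) v∈))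
    M-unique : Unique M
    M-unique = unique-∷ a∉ (unique-∷ b∉ (elements-unique ((λ _ → true) ∖ members (L ++ a ∷ b ∷ []))))
      where
      b∉ : b ∉ rest
      b∉ b∈ = rest⁻ b∈ (∈-++⁺ʳ L (there (here refl)))
      a∉ : a ∉ b ∷ rest
      a∉ (here a≡b) = a≢b a≡b
      a∉ (there a∈) = rest⁻ a∈ (∈-++⁺ʳ L (here refl))
    disjoint : ∀ {v} → v ∈ L → v ∉ M
    disjoint v∈L (here refl)         = a∉L v∈L
    disjoint v∈L (there (here refl)) = b∉L v∈L
    disjoint v∈L (there (there v∈))  = rest⁻ v∈ (∈-++⁺ˡ v∈L)
    covering : ∀ v → v ∉ L → v ∈ M
    covering v v∉L with v ≟ a | v ≟ b
    ... | yes refl | _        = here refl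
    ... | no _     | yes refl = there (here refl)
    ... | no v≢a   | no v≢b   = there (there (∈-elements⁺ ((λ _ → true) ∖ members (L ++ a ∷ b ∷ []))
          (not-intro (∉⇒members {l = L ++ a ∷ b ∷ []} (away ∘ ∈-++⁻′)))))
      where
      ∈-++⁻′ : v ∈ L ++ a ∷ b ∷ [] → v ∈ L ⊎ v ∈ a ∷ b ∷ []
      ∈-++⁻′ = ∈-++⁻ L
      away : v ∈ L ⊎ v ∈ a ∷ b ∷ [] → ⊥
      away (inj₁ v∈L)                 = v∉L v∈L
      away (inj₂ (here v≡a))          = v≢a v≡a
      away (inj₂ (there (here v≡b))) = v≢b v≡b
    open Placement G e L M L-unique M-unique disjoint covering
    ∣M∣≡N : length M ≡ N
    ∣M∣≡N = +-cancelˡ-≡ k (length M) N (trans (cong (_+ length M) (sym ∣L∣≡k)) (trans (sym (↔-size placement)) n≡k+N))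
      where
      ↔-size : ∀ {m n} → Fin m ↔ Fin n → m ≡ n
      ↔-size π = ≤-antisym (Finₚ.injective⇒≤ (λ {i} {j} → to-injective i j)) (Finₚ.injective⇒≤ (λ {i} {j} → from-injective i j))
        where
        to-injective : ∀ i j → Inverse.to π i ≡ Inverse.to π j → i ≡ j
        to-injective i j eq = trans (sym (Inverse.strictlyInverseʳ π i)) (trans (cong (Inverse.from π) eq) (Inverse.strictlyInverseʳ π j))
        from-injective : ∀ i j → Inverse.from π i ≡ Inverse.from π j → i ≡ j
        from-injective i j eq = trans (sym (Inverse.strictlyInverseˡ π i)) (trans (cong (Inverse.to π) eq) (Inverse.strictlyInverseˡ π j))
    outside-M : ∀ u v → u ∉ L → v ∉ L → adj G u v ≡ true →
      ∃[ i ] ∃[ j ] lookup M i ≡ u × lookup M j ≡ v × adj (extraEdge e (length M)) i j ≡ true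
    outside-M u v u∉L v∉L h = ends (outside u v u∉L v∉L h)
      where
      extra : ∀ b → ⟦ b ⟧ ≡ 1 → adj (extraEdge b (length M)) zero (suc zero) ≡ true × adj (extraEdge b (length M)) (suc zero) zero ≡ true
      extra true _ = refl , refl
      extra false ()
      ends : ⟦ e ⟧ ≡ 1 × ((u ≡ a × v ≡ b) ⊎ (u ≡ b × v ≡ a)) →
        ∃[ i ] ∃[ j ] lookup M i ≡ u × lookup M j ≡ v × adj (extraEdge e (length M)) i j ≡ true
      ends (e≡1 , inj₁ (u≡a , v≡b)) = zero , suc zero , sym u≡a , sym v≡b , proj₁ (extra e e≡1)
      ends (e≡1 , inj₂ (u≡b , v≡a)) = suc zero , zero , sym u≡b , sym v≡a , proj₂ (extra e e≡1)
    resize : ∀ {m M m′ M′} → m ≡ m′ → M ≡ M′ → Embedding G e m M → Embedding G e m′ M′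
    resize refl refl p = p

-- Estimates for n ≥ 2^(4 k)

4*k≤2^2k : ∀ k → 1 ≤ k → 4 * k ≤ 2 ^ (2 * k)
4*k≤2^2k k 1≤k = ≤-trans (bound k 1≤k) (≤-reflexive (^-*-assoc 2 2 k))
  where
  bound : ∀ k → 1 ≤ k → 4 * k ≤ 4 ^ k
  bound (suc zero)    _ = ≤-refl
  bound (suc (suc j)) _ = linear (4 * suc (suc j)) (4 ^ suc (suc j)) (12 * j + 8) (4 ⊛ bound (suc j) (s≤s z≤n)) (identity j (4 ^ suc j))
    where
    identity : ∀ j P → 4 * suc (suc j) + 4 * P + (12 * j + 8) ≡ 4 * P + 4 * (4 * suc j)
    identity = solve-∀

-- Equality at k = 2 starts the induction. The failure at k = 1 is what sends k = e = 1 to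
-- `StarWithEdge`.
8*k≤2^2k : ∀ k → 2 ≤ k → 8 * k ≤ 2 ^ (2 * k)
8*k≤2^2k k 2≤k = ≤-trans (bound k 2≤k) (≤-reflexive (^-*-assoc 2 2 k))
  where
  bound : ∀ k → 2 ≤ k → 8 * k ≤ 4 ^ k
  bound (suc zero) (s≤s ())
  bound (suc (suc zero))    _ = ≤-refl
  bound (suc (suc (suc j))) _ = linear (8 * suc (suc (suc j))) (4 ^ suc (suc (suc j))) (24 * j + 40) (4 ⊛ bound (suc (suc j)) (s≤s (s≤s z≤n)))
      (identity j (4 ^ suc (suc j)))
    where
    identity : ∀ j P → 8 * suc (suc (suc j)) + 4 * P + (24 * j + 40) ≡ 4 * P + 4 * (8 * suc (suc j))
    identity = solve-∀

module _ {n : ℕ} (k′ : ℕ) (large : 2 ^ (4 * suc k′) ≤ n) where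

  private
    k P : ℕ
    k = suc k′
    P = 2 ^ (2 * k)
    P²≤n : P * P ≤ n
    P²≤n = ≤-trans (≤-reflexive (trans (sym (^-distribˡ-+-* 2 (2 * k) (2 * k))) (cong (2 ^_) (double k)))) large
      where
      double : ∀ k → 2 * k + 2 * k ≡ 4 * k
      double = solve-∀

  -- With P = 2^(2 k) ≥ 4 k one has n ≥ P² ≥ 2 k P + 2 k P ≥ 2 k P + 8 k², and 8 k² exceeds the
  -- remaining 3 k² + 2 k.
  big₀ : 2 ^ suc (2 * k + 0) * k + ((k + 1 + 0) * (2 * k + 0) + k * k) < n + 0
  big₀ = subst (λ m → 2 ^ suc m * k + ((k + 1 + 0) * (2 * k + 0) + k * k) < n + 0) (sym (+-identityʳ (2 * k)))
    (bound P (4*k≤2^2k k (s≤s z≤n)) P²≤n)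
    where
    bound : ∀ P → 4 * k ≤ P → P * P ≤ n → 2 * P * k + ((k + 1 + 0) * (2 * k + 0) + k * k) < n + 0
    bound P 4k≤P P²≤n = linear (suc (2 * P * k + ((k + 1 + 0) * (2 * k + 0) + k * k))) (n + 0) (5 * (k′ * k′) + 8 * k′ + 2)
      (P²≤n ⊕ (P ⊛ 4k≤P ⊕ (2 * k) ⊛ 4k≤P)) (identity k′ P n)
      where
      identity : ∀ j P n → suc (2 * P * suc j + ((suc j + 1 + 0) * (2 * suc j + 0) + suc j * suc j))
        + (n + (P * P + 2 * suc j * P)) + (5 * (j * j) + 8 * j + 2)
        ≡ n + 0 + (P * P + (P * (4 * suc j) + 2 * suc j * (4 * suc j)))
      identity = solve-∀

  -- As for `big₀`, but from P ≥ 8 k: n ≥ P² ≥ 4 k P + 32 k².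
  big₁ : 1 ≤ k′ → 2 ^ suc (2 * k + 1) * k + ((k + 1 + 1) * (2 * k + 1) + k * k) < n + 1
  big₁ 1≤k′ = subst (λ m → 2 ^ suc m * k + ((k + 1 + 1) * (2 * k + 1) + k * k) < n + 1) (+-comm 1 (2 * k))
    (bound P (8*k≤2^2k k (s≤s 1≤k′)) P²≤n)
    where
    bound : ∀ P → 8 * k ≤ P → P * P ≤ n → 2 * (2 * P) * k + ((k + 1 + 1) * (2 * k + 1) + k * k) < n + 1
    bound P 8k≤P P²≤n = linear (suc (2 * (2 * P) * k + ((k + 1 + 1) * (2 * k + 1) + k * k))) (n + 1) (29 * (k′ * k′) + 53 * k′ + 22)
      (P²≤n ⊕ (P ⊛ 8k≤P ⊕ (4 * k) ⊛ 8k≤P)) (identity k′ P n)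
      where
      identity : ∀ j P n → suc (2 * (2 * P) * suc j + ((suc j + 1 + 1) * (2 * suc j + 1) + suc j * suc j))
        + (n + (P * P + 4 * suc j * P)) + (29 * (j * j) + 53 * j + 22)
        ≡ n + 1 + (P * P + (P * (8 * suc j) + 4 * suc j * (8 * suc j)))
      identity = solve-∀

  k²<n : k * k < n
  k²<n = ≤-trans (s≤s (≤-trans (m≤n+m (k * k) ((k + 1 + 0) * (2 * k + 0))) (m≤n+m ((k + 1 + 0) * (2 * k + 0) + k * k) (2 ^ suc (2 * k + 0) * k)))) (≤-trans big₀ (≤-reflexive (+-identityʳ n)))

  k+2≤n : k + 2 ≤ n
  k+2≤n = ≤-trans (by-slack (3 * (k′ * k′) + 7 * k′ + 3) (identity k′))
    (≤-trans (s≤s (m≤n+m ((k + 1 + 0) * (2 * k + 0) + k * k) (2 ^ suc (2 * k + 0) * k))) (≤-trans big₀ (≤-reflexive (+-identityʳ n))))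
    where
    identity : ∀ j → suc j + 2 + (3 * (j * j) + 7 * j + 3) ≡ suc ((suc j + 1 + 0) * (2 * suc j + 0) + suc j * suc j)
    identity = solve-∀

-- Deriving the long path

rich⇒skeleton : ∀ {n} e k′ (G : Graph n) x → 2 ^ (4 * suc k′) ≤ n →
  (∀ l → Adjacency.Path G l → length l ≤ suc (2 * suc k′ + ⟦ e ⟧)) →
  Reduction.Rich G k′ ⟦ e ⟧ x (λ _ → true) → (Skeleton G (suc k′) ⟦ e ⟧ → ⊥) → ⊥
rich⇒skeleton false k′ G x large no-long-path rich handle =
  minimal (Reduction.Rich G k′ 0 x) count reduced (λ _ → true) rich
  where
  reduced : ∀ U → Reduction.Rich G k′ 0 x U → (∀ U′ → Reduction.Rich G k′ 0 x U′ → count U′ < count U → ⊥) → ⊥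
  reduced U rich min = Reduction.Minimal.FindKernel.with-kernel G k′ 0 x U rich min (k²<n k′ large) z≤n no-long-path (big₀ k′ large)
    λ K → handle (Outside.NoExtraEdge.skeleton G k′ 0 x U rich min (k²<n k′ large) no-long-path K refl)
rich⇒skeleton true zero G x large no-long-path rich handle =
  minimal (Reduction.Rich G 0 1 x) count reduced (λ _ → true) rich
  where
  reduced : ∀ U → Reduction.Rich G 0 1 x U → (∀ U′ → Reduction.Rich G 0 1 x U′ → count U′ < count U → ⊥) → ⊥
  reduced U rich min = StarWithEdge.conclusion G x U rich min large no-long-path handle
rich⇒skeleton true (suc k″) G x large no-long-path rich handle =
  minimal (Reduction.Rich G (suc k″) 1 x) count reduced (λ _ → true) rich
  where
  reduced : ∀ U → Reduction.Rich G (suc k″) 1 x U → (∀ U′ → Reduction.Rich G (suc k″) 1 x U′ → count U′ < count U → ⊥) → ⊥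
  reduced U rich min = Reduction.Minimal.FindKernel.with-kernel G (suc k″) 1 x U rich min (k²<n (suc k″) large) ≤-refl no-long-path
      (big₁ (suc k″) large (s≤s z≤n))
    λ K → Outside.FindExtraEdge.with-skeleton G (suc k″) 1 x U rich min (k²<n (suc k″) large) no-long-path K refl (s≤s z≤n) handle

module _ {n} (e : Bool) (k′ : ℕ) (G : Graph n) (large : 2 ^ (4 * suc k′) ≤ n) {μG μT : ℝ} (radiusG : IsSpectralRadius G μG) where

  long-path : ∀ N → n ≡ suc k′ + N → IsSpectralRadius (extremal e (suc k′) N) μT → μT ≤ℝ μG → ¬ (G ≅ extremal e (suc k′) N) →
    ¬ (∀ l → Adjacency.Path G l → length l ≤ suc (2 * suc k′ + ⟦ e ⟧))
  -- The eigenvector needs two independent vertices for the ends of the extra edge; n ≥ k + 2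
  -- provides them.
  long-path zero          n≡k+N = ⊥-elim (<⇒≱ (<-≤-trans (m<m+n (suc k′) (s≤s z≤n)) (k+2≤n k′ large)) (≤-reflexive (trans n≡k+N (+-identityʳ (suc k′)))))
  long-path (suc zero)    n≡k+N = ⊥-elim (<⇒≱ (≤-trans (≤-reflexive (sym (+-suc (suc k′) 1))) (k+2≤n k′ large)) (≤-reflexive n≡k+N))
  long-path (suc (suc M)) n≡k+N radiusT μT≤μG G≇T no-long-path =
    not-all-walks-small e k′ M G {μG} {μT} radiusG radiusT μT≤μG λ u → ≮⇒≥ λ many-walks →
      rich⇒skeleton e k′ G u large no-long-path (refl , rich u many-walks) embeds
    where
    N : ℕ
    N = suc (suc M)
    -- For the whole vertex set, k n splits into k′ n + n, and the strict inequality absorbs the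
    -- summand 1.
    rich : ∀ u → k′ * degree G u + (suc k′ * (suc k′ + N) + ⟦ e ⟧) < walks G u + (suc k′ * suc k′ + 1) →
      k′ * degree G u + k′ * count {n} (λ _ → true) + (n + ⟦ e ⟧) ≤ walks G u + suc k′ * suc k′
    rich u h = linear (k′ * degree G u + k′ * count {n} (λ _ → true) + (n + ⟦ e ⟧)) (walks G u + suc k′ * suc k′) 0 h
      (trans (cong (λ c → k′ * degree G u + k′ * c + (n + ⟦ e ⟧) + (walks G u + (suc k′ * suc k′ + 1)) + 0) (count-full n))
        (trans (identity k′ n (degree G u) (walks G u) (suc k′ * suc k′) ⟦ e ⟧)
          (cong (λ m → walks G u + suc k′ * suc k′ + suc (k′ * degree G u + (suc k′ * m + ⟦ e ⟧))) n≡k+N)))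
      where
      identity : ∀ k′ n d w s e → k′ * d + k′ * n + (n + e) + (w + (s + 1)) + 0 ≡ w + s + suc (k′ * d + (suc k′ * n + e))
      identity = solve-∀
    embeds : Skeleton G (suc k′) ⟦ e ⟧ → ⊥
    embeds skeleton = isomorphic (skeleton⇒embedding G e (suc k′) N n≡k+N skeleton)
      where
      isomorphic : Embedding G e (suc k′) N → ⊥
      isomorphic (π , G⊆T) = G≇T (record { bijection = π ; adj-≡ = λ i j → same i j (adj G i j) refl })
        where
        same : ∀ i j b → adj G i j ≡ b → adj (extremal e (suc k′) N) (Inverse.to π i) (Inverse.to π j) ≡ adj G i j
        same i j true  eq = trans (G⊆T i j eq) (sym eq)
        same i j false eq = trans (Boolₚ.¬-not (no-missing-edge e k′ M G {μG} {μT} radiusG radiusT μT≤μG π G⊆T i j eq)) (sym eq)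

  path-or-isomorphic : ∀ r (T : Graph (suc k′ + (n ∸ suc k′))) → r ≡ suc (suc (2 * suc k′ + ⟦ e ⟧)) → T ≡ extremal e (suc k′) (n ∸ suc k′) →
    IsSpectralRadius T μT → μT ≤ℝ μG → ¬ (G ≅ T) → path r ⊑ G
  path-or-isomorphic r T r≡ T≡ radiusT μT≤μG G≇T = decidable-stable (⊑-dec (path r) G) λ no-path →
    long-path (n ∸ suc k′) (sym (m+[n∸m]≡n (≤-trans (m≤m+n (suc k′) 2) (k+2≤n k′ large))))
      (subst (λ (H : Graph (suc k′ + (n ∸ suc k′))) → IsSpectralRadius H μT) T≡ radiusT) μT≤μG (λ iso → G≇T (subst (λ (H : Graph (suc k′ + (n ∸ suc k′))) → G ≅ H) (sym T≡) iso))
      (λ l l-path → ≮⇒≥ λ long → no-path (path⊑ G r l l-path (≤-trans (≤-reflexive r≡) long)))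

theorem1 : ∀ (k n : ℕ) → 1 ≤ k → 2 ^ (4 * k) ≤ n → (G : Graph n) →
    (∀ μG μS → IsSpectralRadius G μG → IsSpectralRadius (S n k) μS →
    μS ≤ℝ μG → ¬ (G ≅ S n k) → path (2 * k + 2) ⊑ G)
    ×
    (∀ μG μS → IsSpectralRadius G μG → IsSpectralRadius (S⁺ n k) μS →
    μS ≤ℝ μG → ¬ (G ≅ S⁺ n k) → path (2 * k + 3) ⊑ G)
theorem1 (suc k′) n _ large G =
    (λ μG μS radiusG radiusS μS≤μG → path-or-isomorphic false k′ G large {μG} {μS} radiusG (2 * suc k′ + 2) (S n (suc k′)) (shift₂ (2 * suc k′)) refl radiusS μS≤μG)
  , (λ μG μS radiusG radiusS μS≤μG → path-or-isomorphic true k′ G large {μG} {μS} radiusG (2 * suc k′ + 3) (S⁺ n (suc k′)) (shift₃ (2 * suc k′)) refl radiusS μS≤μG)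
  where
  shift₂ : ∀ m → m + 2 ≡ suc (suc (m + 0))
  shift₂ = solve-∀
  shift₃ : ∀ m → m + 3 ≡ suc (suc (m + 1))
  shift₃ = solve-∀
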